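{- There exist absolute constants $c>0$ and $t_0$ such that for all integers $t\ge t_0$ and all integers $1\le s\le t$, \[ r_{K_s}(4,t)\ \ge\ \binom{\lfloor c\, t^3/\log^4 t\rfloor}{s}. \] In particular, there is a function $\varepsilon(t)\to 0$ as $t\to\infty$ (not depending on $s$) such that for all $1\le s\le t$, \[ \binom{r(4,t)}{s}^{1-\varepsilon(t)}\ \le\ r_{K_s}(4,t)\ \le\ \binom{r(4,t)}{s}, \] i.e. $r_{K_s}(4,t)=\binom{r(4,t)}{s}^{1-o(1)}$.
   Context: A graph $G$ is $(t_1,t_2)$-Ramsey if every coloring of the edges of $G$ with red and blue contains either a red copy of $K_{t_1}$ or a blue copy of $K_{t_2}$. The Ramsey number $r(t_1,t_2)$ is the smallest $n$ such that $K_n$ is $(t_1,t_2)$-Ramsey. For a graph $F$, the $F$-Ramsey number $r_F(t_1,t_2)$ is the minimum, over all $(t_1,t_2)$-Ramsey graphs $G$, of the number of (not necessarily induced) copies of $F$ in $G$. Thus $r_{K_s}(t_1,t_2)$ is the minimum number of $s$-cliques in a $(t_1,t_2)$-Ramsey graph. -}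

module Defs where

open import Data.Nat using (ℕ; zero; suc; _≡ᵇ_)
open import Data.Bool using (Bool; true; false; not; _∧_; _∨_; if_then_else_)
open import Data.Fin using (Fin; _≟_)
open import Data.Fin.Subset using (Subset; inside; outside; ∣_∣; _∈_)
open import Data.Fin.Subset.Properties using (_∈?_)
open import Data.Vec using (Vec; []; _∷_)
open import Data.List using (List; []; _∷_; map; _++_; length; filterᵇ; foldr; allFin)
open import Data.Product using (Σ; _×_; _,_)
open import Data.Sum using (_⊎_)
open import Relation.Nullary using (¬_)
open import Relation.Nullary.Decidable using (⌊_⌋; does)
open import Relation.Binary.PropositionalEquality using (_≡_; _≢_; refl)
open import Function.Definitions using (Injective)

record Graph (n : ℕ) : Set where
  field
    adj    : Fin n → Fin n → Bool
    sym    : ∀ i j → adj i j ≡ adj j i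
    irrefl : ∀ i → adj i i ≡ false
open Graph public

neq : ∀ {n} → Fin n → Fin n → Bool
neq i j = not (does (i ≟ j))

neq-sym : ∀ {n} (i j : Fin n) → neq i j ≡ neq j i
neq-sym i j with i ≟ j | j ≟ i
... | Relation.Nullary.yes _ | Relation.Nullary.yes _ = refl
... | Relation.Nullary.no _  | Relation.Nullary.no _  = refl
... | Relation.Nullary.yes p | Relation.Nullary.no q = Data.Empty.⊥-elim (q (Relation.Binary.PropositionalEquality.sym p))
  where import Data.Empty
... | Relation.Nullary.no q  | Relation.Nullary.yes p = Data.Empty.⊥-elim (q (Relation.Binary.PropositionalEquality.sym p))
  where import Data.Empty

neq-irrefl : ∀ {n} (i : Fin n) → neq i i ≡ false
neq-irrefl i with i ≟ i
... | Relation.Nullary.yes _ = refl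
... | Relation.Nullary.no q = Data.Empty.⊥-elim (q refl)
  where import Data.Empty

K : (n : ℕ) → Graph n
K n = record { adj = neq ; sym = neq-sym ; irrefl = neq-irrefl }

-- An edge colouring of G: a symmetric Bool-valued function on pairs of
-- vertices (its values on non-edges are irrelevant). true = red, false = blue.
-- G contains a copy of K_k all of whose edges have colour b under χ:
MonoClique : ∀ {n} → Graph n → (Fin n → Fin n → Bool) → Bool → ℕ → Set
MonoClique {n} G χ b k =
  Σ (Fin k → Fin n) λ f → Injective _≡_ _≡_ f ×
    (∀ i j → i ≢ j → (adj G (f i) (f j) ≡ true) × (χ (f i) (f j) ≡ b))

IsRamsey : ℕ → ℕ → ∀ {n} → Graph n → Set
IsRamsey t₁ t₂ {n} G =
  (χ : Fin n → Fin n → Bool) → (∀ i j → χ i j ≡ χ j i) →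
  MonoClique G χ true t₁ ⊎ MonoClique G χ false t₂

IsRamseyNumber : ℕ → ℕ → ℕ → Set
IsRamseyNumber t₁ t₂ n =
  IsRamsey t₁ t₂ (K n) × (∀ m → IsRamsey t₁ t₂ (K m) → n Data.Nat.≤ m)
  where import Data.Nat

subsets : (n : ℕ) → List (Subset n)
subsets zero = [] ∷ []
subsets (suc n) = map (inside ∷_) (subsets n) ++ map (outside ∷_) (subsets n)

allB : ∀ {A : Set} → (A → Bool) → List A → Bool
allB p = foldr (λ x b → p x ∧ b) true

isClique : ∀ {n} → Graph n → Subset n → Bool
isClique {n} G p =
  allB (λ i → allB (λ j →
         not (does (i ∈? p)) ∨ not (does (j ∈? p)) ∨ does (i ≟ j) ∨ adj G i j)
       (allFin n)) (allFin n)

cliqueCount : ∀ {n} → Graph n → ℕ → ℕ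
cliqueCount {n} G s = length (filterᵇ (λ p → (∣ p ∣ ≡ᵇ s) ∧ isClique G p) (subsets n))

{-# OPTIONS --safe #-}
-- Let H be a K₄-free graph on N vertices with I independent t-tuples (repetitions allowed).
-- Map the vertices of G to those of H at random and colour an edge of G red if it is sent to an edge
-- of H. No red K₄ arises, and a t-clique is blue iff its image is independent; so a (4,t)-Ramsey
-- graph G has at least N^t / I cliques of order t. The numbers T_s of ordered s-cliques satisfy
-- T_(s+1)^s ≤ T_s^(s+1), which carries the bound from t down to s.
--
-- H is the graph of Mattheus and Verstraete. Its N ~ q⁴ vertices are lines meeting the Hermitian
-- unital of order q in about q of its q³ points; two lines are adjacent if they meet in a point of
-- the unital and are on different sides of a random bipartition of the lines through that point.
-- Since the unital contains no O'Nan configuration, H is K₄-free. A Chernoff bound shows that every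
-- set of at least C q² lines has a vertex adjacent to a 1/(C q) fraction of it, and by the argument
-- of Kleitman and Winston I ≤ (C q²)^t as soon as t ≥ C q log² q. A prime q of this order exists by
-- Chebyshev's theorem. Together with r(4,t) ≤ t³ this gives the second part.
module Submission where

open import Defs renaming (sym to adj-sym)
open import Data.Nat
open import Data.Nat.Properties
open import Data.Nat.Tactic.RingSolver using (solve-∀)
open import Data.Bool using (Bool; true; false; not; _∧_; _∨_; _xor_; if_then_else_; T)
open import Data.Bool.Properties using (∧-comm; ∧-assoc; ∧-zeroʳ)
open import Data.Fin using (Fin; zero; suc; toℕ; fromℕ<; combine; remQuot)
import Data.Fin as Fin
import Data.Fin.Properties as Fin
open import Data.Fin.Subset using (Subset; inside; outside; ∣_∣)
open import Data.List using (List; []; _∷_; map; _++_; length; filterᵇ; foldr; allFin; tabulate)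
import Data.List.Properties as List
open import Data.Vec using (Vec; []; _∷_; lookup)
import Data.Vec as Vec
import Data.Vec.Properties as Vec
open import Data.Product using (Σ; ∃; _×_; _,_; proj₁; proj₂)
open import Data.Sum using (_⊎_; inj₁; inj₂; [_,_]′)
open import Data.Empty using (⊥; ⊥-elim)
open import Data.Unit using (tt)
open import Function using (_∘_; id; case_of_; Injective)
open import Relation.Nullary using (¬_; Dec; yes; no; does; contradiction)
open import Relation.Nullary.Decidable using (dec-true; dec-false; _×-dec_)
open import Relation.Binary.PropositionalEquality using (_≡_; _≢_; refl; sym; trans; cong; cong₂; subst; subst₂; module ≡-Reasoning)
open import Data.Fin.Subset.Properties using (_∈?_)
open import Data.List.Relation.Unary.Any using (here; there)
import Data.List.Membership.Propositional as Membership
import Data.List.Membership.Propositional.Properties as Membership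
import Data.Bool as Bool using (_≟_)
import Data.Bool.Properties as Bool using (¬-not; xor-comm; xor-same)
open import Data.Nat.Divisibility
open import Data.Nat.DivMod using (_%_; _/_; /-congʳ; m/n*n≡m; m/n*n≤m; m≡m%n+[m/n]*n; m%n<n)
open import Data.Nat.Primality
open import Data.Nat.Primality.Factorisation using (factorise)
open import Data.Nat.Combinatorics using (_C_; k>n⇒nCk≡0; nC1≡n; nCk+nC[k+1]≡[n+1]C[k+1]; nCk≡n!/k![n-k]!; k![n∸k]!∣n!)
open import Data.Nat.ListAction using (product)
open import Data.Nat.ListAction.Properties using (∈⇒∣product)
open import Data.List.Relation.Unary.All using (All; []; _∷_)
import Data.List.Relation.Unary.All as All
import Data.List.Relation.Unary.All.Properties as All
open import Data.List.Membership.Propositional using (find)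
open import Data.Nat.Logarithm using (⌊log₂_⌋; ⌊log₂⌋-mono-≤; ⌊log₂[2^n]⌋≡n)
import Data.Nat.Divisibility as ℕ
open import Data.Nat.Coprimality using (Coprime; coprime-Bézout)
open import Data.Nat.GCD using (module Bézout)
open import Data.Integer as ℤ using (ℤ)
import Data.Integer.Properties as ℤ
import Data.Integer.DivMod as ℤ
open import Data.Integer.Divisibility.Signed as ℤ using (divides)
open import Data.Integer.Tactic.RingSolver using () renaming (solve-∀ to solveℤ-∀)
open import Data.Maybe using (Maybe; just; nothing)
open import Algebra.Bundles using (CommutativeRing)
import Algebra.Solver.Ring
open import Algebra.Solver.Ring.AlmostCommutativeRing using (fromCommutativeRing; _-Raw-AlmostCommutative⟶_)
import Relation.Binary.Reasoning.Setoid
open import Level using (0ℓ)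

-- Finite sums

-- The exponents arise as follows. The count of independent tuples forces `q` down to about
-- `t / log² t`, and `G` then has at least `d ^ t` cliques of order `t`, with `d` about `q²`. This
-- is short of `t³ / log⁴ t` by a factor `t`, which the orderings of a clique supply:
-- `T_t = t ! * cliqueCount G t` is at least `(t d / 4) ^ t`. Ordered cliques lose nothing on the
-- way from `t` down to `s`, and dividing by `s !` at the end turns a power into a binomial
-- coefficient. Two obstacles shape the construction. A random map need not be injective, so
-- independent tuples have to allow repetitions. And all lines through a point would be mutually
-- adjacent in the plain intersection graph; the bipartitions leave no triangle at a single point,
-- and still a constant proportion of the incidences lies on minority sides inside every large set
-- simultaneously. Probabilities appear as sums over finite sample spaces with denominators cleared,
-- and roots are avoided by comparing powers.

does-true : ∀ {A : Set} (A? : Dec A) → does A? ≡ true → A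
does-true (yes a) _ = a

𝟙 : Bool → ℕ
𝟙 true  = 1
𝟙 false = 0

𝟙-∧ : ∀ a b → 𝟙 (a ∧ b) ≡ 𝟙 a * 𝟙 b
𝟙-∧ true  b = sym (+-identityʳ (𝟙 b))
𝟙-∧ false b = refl

𝟙≤1 : ∀ a → 𝟙 a ≤ 1
𝟙≤1 true  = ≤-refl
𝟙≤1 false = z≤n

𝟙-mono : ∀ {a b} → (a ≡ true → b ≡ true) → 𝟙 a ≤ 𝟙 b
𝟙-mono {false} h = z≤n
𝟙-mono {true}  h = ≤-reflexive (cong 𝟙 (sym (h refl)))

module _ {A : Set} where

  ∑ : List A → (A → ℕ) → ℕ
  ∑ [] f       = 0
  ∑ (x ∷ xs) f = f x + ∑ xs f

  ∑-mono : ∀ xs {f g} → (∀ x → f x ≤ g x) → ∑ xs f ≤ ∑ xs g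
  ∑-mono [] h       = z≤n
  ∑-mono (x ∷ xs) h = +-mono-≤ (h x) (∑-mono xs h)

  ∑-cong : ∀ xs {f g} → (∀ x → f x ≡ g x) → ∑ xs f ≡ ∑ xs g
  ∑-cong [] h       = refl
  ∑-cong (x ∷ xs) h = cong₂ _+_ (h x) (∑-cong xs h)

  ∑-+ : ∀ xs f g → ∑ xs (λ x → f x + g x) ≡ ∑ xs f + ∑ xs g
  ∑-+ [] f g       = refl
  ∑-+ (x ∷ xs) f g = trans (cong (f x + g x +_) (∑-+ xs f g)) (eq (f x) (g x) (∑ xs f) (∑ xs g))
    where
    eq : ∀ a b c d → (a + b) + (c + d) ≡ (a + c) + (b + d)
    eq = solve-∀

  ∑-*ˡ : ∀ xs c f → ∑ xs (λ x → c * f x) ≡ c * ∑ xs f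
  ∑-*ˡ [] c f       = sym (*-zeroʳ c)
  ∑-*ˡ (x ∷ xs) c f = trans (cong (c * f x +_) (∑-*ˡ xs c f)) (sym (*-distribˡ-+ c (f x) (∑ xs f)))

  ∑-*ʳ : ∀ xs c f → ∑ xs (λ x → f x * c) ≡ ∑ xs f * c
  ∑-*ʳ xs c f = trans (∑-cong xs (λ x → *-comm (f x) c)) (trans (∑-*ˡ xs c f) (*-comm c (∑ xs f)))

  ∑-const : ∀ xs c → ∑ xs (λ _ → c) ≡ length xs * c
  ∑-const [] c       = refl
  ∑-const (x ∷ xs) c = cong (c +_) (∑-const xs c)

  ∑-zero : ∀ xs {f} → (∀ x → f x ≡ 0) → ∑ xs f ≡ 0
  ∑-zero xs h = trans (∑-cong xs h) (trans (∑-const xs 0) (*-zeroʳ (length xs)))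

  ∑-++ : ∀ xs ys f → ∑ (xs ++ ys) f ≡ ∑ xs f + ∑ ys f
  ∑-++ [] ys f       = refl
  ∑-++ (x ∷ xs) ys f = trans (cong (f x +_) (∑-++ xs ys f)) (sym (+-assoc (f x) _ _))

  ∑-filterᵇ : ∀ p xs f → ∑ (filterᵇ p xs) f ≡ ∑ xs (λ x → 𝟙 (p x) * f x)
  ∑-filterᵇ p [] f = refl
  ∑-filterᵇ p (x ∷ xs) f with p x
  ... | true  = cong₂ _+_ (sym (+-identityʳ (f x))) (∑-filterᵇ p xs f)
  ... | false = ∑-filterᵇ p xs f

  -- The first-moment method: an inequality between sums over a sample space holds at some sample
  -- point. Random maps, random bipartitions and vertices of large degree are all obtained from it.
  ∑-<⇒∃< : ∀ xs {f g} → ∑ xs f < ∑ xs g → ∃ λ x → f x < g x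
  ∑-<⇒∃< (x ∷ xs) {f} {g} h with f x <? g x
  ... | yes p = x , p
  ... | no ¬p = ∑-<⇒∃< xs (+-cancelˡ-< (g x) _ _ (≤-<-trans (+-monoˡ-≤ _ (≮⇒≥ ¬p)) h))

  length-∑ : ∀ xs → length xs ≡ ∑ xs (λ _ → 1)
  length-∑ xs = sym (trans (∑-const xs 1) (*-identityʳ _))

∑-map : ∀ {A B : Set} (h : A → B) xs (f : B → ℕ) → ∑ (map h xs) f ≡ ∑ xs (f ∘ h)
∑-map h [] f       = refl
∑-map h (x ∷ xs) f = cong (f (h x) +_) (∑-map h xs f)

∑-comm : ∀ {A B : Set} (xs : List A) (ys : List B) (f : A → B → ℕ) →
  ∑ xs (λ x → ∑ ys (f x)) ≡ ∑ ys (λ y → ∑ xs (λ x → f x y))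
∑-comm [] ys f       = sym (∑-zero ys (λ _ → refl))
∑-comm (x ∷ xs) ys f = trans (cong (∑ ys (f x) +_) (∑-comm xs ys f)) (sym (∑-+ ys (f x) _))

∑-*-∑ : ∀ {A B : Set} (xs : List A) (ys : List B) (f : A → ℕ) (g : B → ℕ) →
  ∑ xs f * ∑ ys g ≡ ∑ xs (λ x → ∑ ys (λ y → f x * g y))
∑-*-∑ xs ys f g = trans (sym (∑-*ʳ xs (∑ ys g) f)) (∑-cong xs (λ x → sym (∑-*ˡ ys (f x) g)))

∑-tabulate : ∀ {A : Set} {n} (h : Fin n → A) (f : A → ℕ) → ∑ (tabulate h) f ≡ ∑ (allFin n) (f ∘ h)
∑-tabulate {n = n} h f = trans (cong (λ xs → ∑ xs f) (sym (List.map-tabulate id h))) (∑-map h (allFin n) f)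

∑-suc : ∀ {n} (f : Fin (suc n) → ℕ) → ∑ (allFin (suc n)) f ≡ f zero + ∑ (allFin n) (f ∘ suc)
∑-suc f = cong (f zero +_) (∑-tabulate suc f)

∑-allFin-const : ∀ n c → ∑ (allFin n) (λ _ → c) ≡ n * c
∑-allFin-const n c = trans (∑-const (allFin n) c) (cong (_* c) (List.length-tabulate {n = n} id))

# : ∀ {n} → (Fin n → Bool) → ℕ
# {n} a = ∑ (allFin n) (𝟙 ∘ a)

∑-term : ∀ {n} (f : Fin n → ℕ) i → f i ≤ ∑ (allFin n) f
∑-term f zero    = ≤-trans (m≤m+n _ _) (≤-reflexive (sym (∑-suc f)))
∑-term f (suc i) = ≤-trans (∑-term (f ∘ suc) i) (≤-trans (m≤n+m _ _) (≤-reflexive (sym (∑-suc f))))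

infix 4 _==_
_==_ : ∀ {n} → Fin n → Fin n → Bool
i == j = does (i Fin.≟ j)

==-refl : ∀ {n} (i : Fin n) → (i == i) ≡ true
==-refl i = dec-true (i Fin.≟ i) refl

==⇒≡ : ∀ {n} {i j : Fin n} → (i == j) ≡ true → i ≡ j
==⇒≡ {i = i} {j} e with i Fin.≟ j
... | yes p = p

≢⇒==-false : ∀ {n} {i j : Fin n} → i ≢ j → (i == j) ≡ false
≢⇒==-false {i = i} {j} = dec-false (i Fin.≟ j)

∑-== : ∀ {n} (i : Fin n) (f : Fin n → ℕ) → ∑ (allFin n) (λ j → 𝟙 (i == j) * f j) ≡ f i
∑-== {suc n} zero f = begin
  ∑ (allFin (suc n)) (λ j → 𝟙 (zero == j) * f j) ≡⟨ ∑-suc (λ j → 𝟙 (zero == j) * f j) ⟩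
  1 * f zero + ∑ (allFin n) (λ _ → 0)            ≡⟨ cong₂ _+_ (*-identityˡ (f zero)) (∑-zero (allFin n) (λ _ → refl)) ⟩
  f zero + 0                                     ≡⟨ +-identityʳ (f zero) ⟩
  f zero                                         ∎
  where open ≡-Reasoning
∑-== {suc n} (suc i) f = begin
  ∑ (allFin (suc n)) (λ j → 𝟙 (suc i == j) * f j)       ≡⟨ ∑-suc (λ j → 𝟙 (suc i == j) * f j) ⟩
  ∑ (allFin n) (λ j → 𝟙 (suc i == suc j) * f (suc j))   ≡⟨ ∑-cong (allFin n) (λ j → cong (λ b → 𝟙 b * f (suc j)) (suc-== j)) ⟩
  ∑ (allFin n) (λ j → 𝟙 (i == j) * f (suc j))           ≡⟨ ∑-== i (f ∘ suc) ⟩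
  f (suc i)                                             ∎
  where
  open ≡-Reasoning
  suc-== : ∀ j → (suc i == suc j) ≡ (i == j)
  suc-== j with i Fin.≟ j
  ... | yes _ = refl
  ... | no _  = refl

#-== : ∀ {n} (i : Fin n) → # (i ==_) ≡ 1
#-== {n} i = trans (∑-cong (allFin n) (λ j → sym (*-identityʳ _))) (∑-== i (λ _ → 1))

#-mono : ∀ {n} {a b : Fin n → Bool} → (∀ i → a i ≡ true → b i ≡ true) → # a ≤ # b
#-mono h = ∑-mono (allFin _) (λ i → 𝟙-mono (h i))

#≤n : ∀ {n} (a : Fin n → Bool) → # a ≤ n
#≤n {n} a = ≤-trans (∑-mono (allFin n) (λ i → 𝟙≤1 (a i))) (≤-reflexive (trans (∑-allFin-const n 1) (*-identityʳ n)))

#-none : ∀ {n} {a : Fin n → Bool} → (∀ i → a i ≡ false) → # a ≡ 0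
#-none h = ∑-zero (allFin _) (λ i → cong 𝟙 (h i))

findᵇ : ∀ {n} (a : Fin n → Bool) → (∃ λ i → a i ≡ true) ⊎ (∀ i → a i ≡ false)
findᵇ {zero} a = inj₂ (λ ())
findᵇ {suc n} a with a zero in e | findᵇ (a ∘ suc)
... | true  | _            = inj₁ (zero , e)
... | false | inj₁ (i , p) = inj₁ (suc i , p)
... | false | inj₂ h       = inj₂ (λ { zero → e ; (suc i) → h i })

#≤1 : ∀ {n} (a : Fin n → Bool) → (∀ i j → a i ≡ true → a j ≡ true → i ≡ j) → # a ≤ 1
#≤1 a h with findᵇ a
... | inj₂ none    = ≤-trans (≤-reflexive (#-none none)) z≤n
... | inj₁ (i , p) = ≤-trans
  (#-mono (λ j q → subst (λ k → (i == k) ≡ true) (h i j p q) (==-refl i))) (≤-reflexive (#-== i))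

#-injection : ∀ {m n} (f : Fin m → Fin n) → Injective _≡_ _≡_ f →
  {a : Fin m → Bool} {b : Fin n → Bool} → (∀ i → a i ≡ true → b (f i) ≡ true) → # a ≤ # b
#-injection {m} {n} f f-inj {a} {b} h = begin
  # a                                                              ≤⟨ ∑-mono (allFin m) (λ i → 𝟙-mono (h i)) ⟩
  ∑ (allFin m) (λ i → 𝟙 (b (f i)))                                 ≡⟨ ∑-cong (allFin m) (λ i → ∑-== (f i) (𝟙 ∘ b)) ⟨
  ∑ (allFin m) (λ i → ∑ (allFin n) (λ j → 𝟙 (f i == j) * 𝟙 (b j))) ≡⟨ ∑-comm (allFin m) (allFin n) _ ⟩
  ∑ (allFin n) (λ j → ∑ (allFin m) (λ i → 𝟙 (f i == j) * 𝟙 (b j))) ≡⟨ ∑-cong (allFin n) (λ j → ∑-*ʳ (allFin m) (𝟙 (b j)) _) ⟩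
  ∑ (allFin n) (λ j → # (λ i → f i == j) * 𝟙 (b j))                ≤⟨ ∑-mono (allFin n) (λ j → *-monoˡ-≤ (𝟙 (b j)) (fibre j)) ⟩
  ∑ (allFin n) (λ j → 1 * 𝟙 (b j))                                 ≡⟨ ∑-cong (allFin n) (λ j → *-identityˡ _) ⟩
  # b                                                              ∎
  where
  open ≤-Reasoning
  fibre : ∀ j → # (λ i → f i == j) ≤ 1
  fibre j = #≤1 _ (λ i k p r → f-inj (trans (==⇒≡ p) (sym (==⇒≡ r))))

-- Renumbers a subset by an initial segment. The radii whose circles have enough points are listed
-- in this way, so that the lines are indexed by a `Fin`.
select : ∀ {n} (a : Fin n → Bool) →
  Σ (Fin (# a) → Fin n) λ e → Injective _≡_ _≡_ e × (∀ i → a (e i) ≡ true)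
select {zero} a = (λ ()) , (λ {i} → ⊥-elim (Fin.¬Fin0 i)) , λ ()
select {suc n} a rewrite ∑-suc (𝟙 ∘ a) with a zero in a0 | select (a ∘ suc)
... | false | e , e-inj , e-true = suc ∘ e , (λ p → e-inj (Fin.suc-injective p)) , e-true
... | true | e , e-inj , e-true = e′ , e′-inj , e′-true
  where
  e′ : Fin (suc (# (a ∘ suc))) → Fin (suc n)
  e′ zero    = zero
  e′ (suc i) = suc (e i)
  e′-inj : Injective _≡_ _≡_ e′
  e′-inj {zero} {zero} p   = refl
  e′-inj {suc i} {suc j} p = cong suc (e-inj (Fin.suc-injective p))
  e′-true : ∀ i → a (e′ i) ≡ true
  e′-true zero    = a0
  e′-true (suc i) = e-true i

-- The first `m` elements of `a`. Cutting all lines down to the same number of points makes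
-- incidence counts exact without knowing the exact size of a circle.
truncate : ∀ {n} → ℕ → (Fin n → Bool) → Fin n → Bool
truncate zero a i = false
truncate (suc m) a zero = a zero
truncate (suc m) a (suc i) = truncate (if a zero then m else suc m) (a ∘ suc) i

truncate-sound : ∀ {n} m (a : Fin n → Bool) i → truncate m a i ≡ true → a i ≡ true
truncate-sound (suc m) a zero h = h
truncate-sound (suc m) a (suc i) h = truncate-sound (if a zero then m else suc m) (a ∘ suc) i h

#-truncate : ∀ {n} m (a : Fin n → Bool) → m ≤ # a → # (truncate m a) ≡ m
#-truncate {n} zero a h = ∑-zero (allFin n) (λ _ → refl)
#-truncate {suc n} (suc m) a h rewrite ∑-suc (𝟙 ∘ a) | ∑-suc (𝟙 ∘ truncate (suc m) a) with a zero
... | true  = cong suc (#-truncate m (a ∘ suc) (s≤s⁻¹ h))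
... | false = #-truncate (suc m) (a ∘ suc) h

-- Sums over words and products of independent factors

module _ {B : Set} (cs : List B) where

  vecs : ∀ n → List (Vec B n)
  vecs zero    = [] ∷ []
  vecs (suc n) = foldr (λ c vs → map (c ∷_) (vecs n) ++ vs) [] cs

  ∑-vecs-suc : ∀ {n} f → ∑ (vecs (suc n)) f ≡ ∑ cs (λ c → ∑ (vecs n) (λ v → f (c ∷ v)))
  ∑-vecs-suc {n} f = go cs
    where
    go : ∀ ds → ∑ (foldr (λ c vs → map (c ∷_) (vecs n) ++ vs) [] ds) f ≡ ∑ ds (λ c → ∑ (vecs n) (λ v → f (c ∷ v)))
    go []       = refl
    go (d ∷ ds) = trans (∑-++ (map (d ∷_) (vecs n)) _ f) (cong₂ _+_ (∑-map (d ∷_) (vecs n) f) (go ds))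

∏ : ∀ {n} → (Fin n → ℕ) → ℕ
∏ {zero} f  = 1
∏ {suc n} f = f zero * ∏ (f ∘ suc)

∏-cong : ∀ {n} {f g : Fin n → ℕ} → (∀ i → f i ≡ g i) → ∏ f ≡ ∏ g
∏-cong {zero} h  = refl
∏-cong {suc n} h = cong₂ _*_ (h zero) (∏-cong (h ∘ suc))

∏-mono : ∀ {n} {f g : Fin n → ℕ} → (∀ i → f i ≤ g i) → ∏ f ≤ ∏ g
∏-mono {zero} h  = ≤-refl
∏-mono {suc n} h = *-mono-≤ (h zero) (∏-mono (h ∘ suc))

∏-* : ∀ {n} (f g : Fin n → ℕ) → ∏ (λ i → f i * g i) ≡ ∏ f * ∏ g
∏-* {zero} f g  = refl
∏-* {suc n} f g = trans (cong (f zero * g zero *_) (∏-* (f ∘ suc) (g ∘ suc))) (eq (f zero) (g zero) _ _)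
  where
  eq : ∀ a b c d → (a * b) * (c * d) ≡ (a * c) * (b * d)
  eq = solve-∀

∏-^ : ∀ {n} c (e : Fin n → ℕ) → ∏ (λ i → c ^ e i) ≡ c ^ ∑ (allFin n) e
∏-^ {zero} c e  = refl
∏-^ {suc n} c e = trans (cong (c ^ e zero *_) (∏-^ c (e ∘ suc)))
  (trans (sym (^-distribˡ-+-* c (e zero) _)) (cong (c ^_) (sym (∑-suc e))))

∏-const : ∀ n c → ∏ {n} (λ _ → c) ≡ c ^ n
∏-const zero c    = refl
∏-const (suc n) c = cong (c *_) (∏-const n c)

-- Independence of the coordinates: for a uniformly random word, the expectation of a product of
-- functions of single letters is the product of the expectations.
∑-vecs-∏ : ∀ {B : Set} (cs : List B) n (f : Fin n → B → ℕ) →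
  ∑ (vecs cs n) (λ v → ∏ (λ i → f i (lookup v i))) ≡ ∏ (λ i → ∑ cs (f i))
∑-vecs-∏ cs zero f    = refl
∑-vecs-∏ cs (suc n) f = begin
  ∑ (vecs cs (suc n)) (λ v → ∏ (λ i → f i (lookup v i)))  ≡⟨ ∑-vecs-suc cs _ ⟩
  ∑ cs (λ c → ∑ (vecs cs n) (λ v → f zero c * ∏ (λ i → f (suc i) (lookup v i))))
    ≡⟨ ∑-cong cs (λ c → trans (∑-*ˡ (vecs cs n) (f zero c) _) (cong (f zero c *_) (∑-vecs-∏ cs n (f ∘ suc)))) ⟩
  ∑ cs (λ c → f zero c * ∏ (λ i → ∑ cs (f (suc i))))      ≡⟨ ∑-*ʳ cs _ (f zero) ⟩
  ∑ cs (f zero) * ∏ (λ i → ∑ cs (f (suc i)))              ∎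
  where open ≡-Reasoning

length-vecs : ∀ {B : Set} (cs : List B) n → length (vecs cs n) ≡ length cs ^ n
length-vecs cs n = begin
  length (vecs cs n)                   ≡⟨ length-∑ (vecs cs n) ⟩
  ∑ (vecs cs n) (λ _ → 1)              ≡⟨ ∑-cong (vecs cs n) (λ v → trans (∏-const n 1) (^-zeroˡ n)) ⟨
  ∑ (vecs cs n) (λ v → ∏ {n} (λ _ → 1)) ≡⟨ ∑-vecs-∏ cs n (λ _ _ → 1) ⟩
  ∏ {n} (λ _ → ∑ cs (λ _ → 1))         ≡⟨ ∏-const n _ ⟩
  ∑ cs (λ _ → 1) ^ n                   ≡⟨ cong (_^ n) (length-∑ cs) ⟨
  length cs ^ n                        ∎
  where open ≡-Reasoning

-- Tuples in a graph

∧-true : ∀ {a b} → a ∧ b ≡ true → a ≡ true × b ≡ true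
∧-true {true} {true} _ = refl , refl

true-∧ : ∀ {a b} → a ≡ true → b ≡ true → a ∧ b ≡ true
true-∧ refl refl = refl

not-== : ∀ {n} {i j : Fin n} → i ≢ j → not (i == j) ≡ true
not-== i≢j = cong not (≢⇒==-false i≢j)

infixl 7 _∩_ _∖_
_∩_ : ∀ {n} → (Fin n → Bool) → (Fin n → Bool) → Fin n → Bool
(a ∩ b) i = a i ∧ b i

_∖_ : ∀ {n} → (Fin n → Bool) → Fin n → Fin n → Bool
(a ∖ v) i = a i ∧ not (v == i)

∖⁺ : ∀ {n} {a : Fin n → Bool} {v i} → a i ≡ true → v ≢ i → (a ∖ v) i ≡ true
∖⁺ p v≢i = true-∧ p (not-== v≢i)

∖⁻ : ∀ {n} {a : Fin n → Bool} {v i} → (a ∖ v) i ≡ true → a i ≡ true × v ≢ i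
∖⁻ {a = a} {v} {i} h with ∧-true {a i} h
... | p , r = p , λ { refl → case trans (sym r) (cong not (==-refl v)) of λ () }

#-∖ : ∀ {n} (a : Fin n → Bool) {v} → a v ≡ true → suc (# (a ∖ v)) ≡ # a
#-∖ {n} a {v} av = begin
  suc (# (a ∖ v))                              ≡⟨ cong (_+ # (a ∖ v)) (#-== v) ⟨
  # (v ==_) + # (a ∖ v)                        ≡⟨ ∑-+ (allFin n) _ _ ⟨
  ∑ (allFin n) (λ i → 𝟙 (v == i) + 𝟙 ((a ∖ v) i)) ≡⟨ ∑-cong (allFin n) term ⟩
  # a                                          ∎
  where
  open ≡-Reasoning
  term : ∀ i → 𝟙 (v == i) + 𝟙 ((a ∖ v) i) ≡ 𝟙 (a i)
  term i with v Fin.≟ i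
  ... | yes refl rewrite av = refl
  ... | no _ with a i
  ...   | true  = refl
  ...   | false = refl

-- Serves for cliques (R the adjacency relation) as well as for independent tuples (R its complement,
-- which is reflexive, so that entries may be repeated).
module _ {n} (R : Fin n → Fin n → Bool) where

  -- Each chosen entry cuts the candidates down to its `R`-neighbours. Both the Kleitman-Winston and
  -- the Loomis-Whitney induction run on this recursion.
  tuples : ℕ → (Fin n → Bool) → ℕ
  tuples zero a    = 1
  tuples (suc s) a = ∑ (allFin n) (λ v → 𝟙 (a v) * tuples s (a ∩ R v))

  tuples-mono : ∀ s {a b} → (∀ i → a i ≡ true → b i ≡ true) → tuples s a ≤ tuples s b
  tuples-mono zero h = ≤-refl
  tuples-mono (suc s) {a} h = ∑-mono (allFin n) (λ v → *-mono-≤ (𝟙-mono (h v))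
    (tuples-mono s (λ i p → let q , r = ∧-true {a i} p in true-∧ (h i q) r)))

  tuples≤#^ : ∀ s a → tuples s a ≤ # a ^ s
  tuples≤#^ zero a    = ≤-refl
  tuples≤#^ (suc s) a = begin
    ∑ (allFin n) (λ v → 𝟙 (a v) * tuples s (a ∩ R v)) ≤⟨ ∑-mono (allFin n) (λ v → *-monoʳ-≤ (𝟙 (a v)) (begin
        tuples s (a ∩ R v) ≤⟨ tuples≤#^ s (a ∩ R v) ⟩
        # (a ∩ R v) ^ s    ≤⟨ ^-monoˡ-≤ s (#-mono (λ i p → proj₁ (∧-true {a i} p))) ⟩
        # a ^ s            ∎)) ⟩
    ∑ (allFin n) (λ v → 𝟙 (a v) * # a ^ s) ≡⟨ ∑-*ʳ (allFin n) (# a ^ s) (𝟙 ∘ a) ⟩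
    # a * # a ^ s ∎
    where open ≤-Reasoning

  module _ (R-sym : ∀ i j → R i j ≡ R j i) where

    private
      -- The first entry `u` is `v`, or the tuple avoids `v`, or `v` stands at one of the `s` later
      -- places. For `s = 0` the coefficient of the last summand vanishes, so `pred 0` does no harm.
      split-sum : ∀ s a v → ∑ (allFin n) (λ u → 𝟙 (v == u) * tuples s (a ∩ R v) +
          (𝟙 ((a ∖ v) u) * tuples s (a ∖ v ∩ R u) + s * (𝟙 ((a ∩ R v) u) * tuples (pred s) (a ∩ R v ∩ R u))))
        ≡ tuples (suc s) (a ∖ v) + suc s * tuples s (a ∩ R v)
      split-sum s a v = begin
        ∑ (allFin n) (λ u → 𝟙 (v == u) * tuples s (a ∩ R v) + (second u + s * third u))
          ≡⟨ trans (∑-+ (allFin n) _ _) (cong₂ _+_ (∑-== v (λ _ → tuples s (a ∩ R v)))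
               (trans (∑-+ (allFin n) second _) (cong (tuples (suc s) (a ∖ v) +_) (∑-*ˡ (allFin n) s third)))) ⟩
        tuples s (a ∩ R v) + (tuples (suc s) (a ∖ v) + s * ∑ (allFin n) third)
          ≡⟨ cong (λ z → tuples s (a ∩ R v) + (tuples (suc s) (a ∖ v) + z)) (sum-third s) ⟩
        tuples s (a ∩ R v) + (tuples (suc s) (a ∖ v) + s * tuples s (a ∩ R v))
          ≡⟨ eq (tuples s (a ∩ R v)) (tuples (suc s) (a ∖ v)) s ⟩
        tuples (suc s) (a ∖ v) + suc s * tuples s (a ∩ R v) ∎
        where
        open ≡-Reasoning
        second third : Fin n → ℕ
        second u = 𝟙 ((a ∖ v) u) * tuples s (a ∖ v ∩ R u)
        third u  = 𝟙 ((a ∩ R v) u) * tuples (pred s) (a ∩ R v ∩ R u)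
        sum-third : ∀ s → s * ∑ (allFin n) (λ u → 𝟙 ((a ∩ R v) u) * tuples (pred s) (a ∩ R v ∩ R u)) ≡ s * tuples s (a ∩ R v)
        sum-third zero    = refl
        sum-third (suc s) = refl
        eq : ∀ x y s → x + (y + s * x) ≡ y + (x + s * x)
        eq = solve-∀

    -- A tuple through `v` is determined by one of `suc s` places for `v` and by the remaining
    -- entries, which are `R`-neighbours of `v`. If `R v v` holds, a tuple with several entries `v`
    -- is counted once for each of them, hence only an inequality.
    tuples-remove-≤ : ∀ s a v → tuples (suc s) a ≤ tuples (suc s) (a ∖ v) + suc s * tuples s (a ∩ R v)
    tuples-remove-≤ s a v = ≤-trans (∑-mono (allFin n) term) (≤-reflexive (split-sum s a v))
      where
      open ≤-Reasoning
      remove : ∀ s u → v ≢ u → tuples s (a ∩ R u) ≤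
        tuples s (a ∖ v ∩ R u) + s * (𝟙 (R v u) * tuples (pred s) (a ∩ R v ∩ R u))
      remove zero u v≢u = ≤-refl
      remove (suc s) u v≢u with R v u in e
      ... | false = ≤-trans (tuples-mono (suc s) {a ∩ R u} {a ∖ v ∩ R u} (λ i p → let q , r = ∧-true {a i} p in
        true-∧ (∖⁺ {a = a} {v} {i} q (λ { refl → case trans (sym r) (trans (R-sym u v) e) of λ () })) r)) (m≤m+n _ _)
      ... | true  = ≤-trans (tuples-remove-≤ s (a ∩ R u) v) (+-mono-≤
        (tuples-mono (suc s) {a ∩ R u ∖ v} {a ∖ v ∩ R u} (λ i p → let q , v≢i = ∖⁻ {a = a ∩ R u} {v} {i} p ; q₁ , q₂ = ∧-true {a i} q in true-∧ (∖⁺ {a = a} {v} {i} q₁ v≢i) q₂))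
        (*-monoʳ-≤ (suc s) (≤-trans (tuples-mono s (λ i p → let q , r = ∧-true {a i ∧ R u i} p ; q₁ , q₂ = ∧-true {a i} q in
          true-∧ (true-∧ q₁ r) q₂)) (≤-reflexive (sym (*-identityˡ _))))))
      term : ∀ u → 𝟙 (a u) * tuples s (a ∩ R u) ≤ 𝟙 (v == u) * tuples s (a ∩ R v) +
          (𝟙 ((a ∖ v) u) * tuples s (a ∖ v ∩ R u) + s * (𝟙 ((a ∩ R v) u) * tuples (pred s) (a ∩ R v ∩ R u)))
      term u with v Fin.≟ u
      ... | yes refl = ≤-trans (*-monoˡ-≤ _ (𝟙≤1 (a u))) (m≤m+n _ _)
      ... | no v≢u with a u
      ...   | false = z≤n
      ...   | true  = begin
        1 * tuples s (a ∩ R u) ≡⟨ *-identityˡ _ ⟩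
        tuples s (a ∩ R u) ≤⟨ remove s u v≢u ⟩
        tuples s (a ∖ v ∩ R u) + s * (𝟙 (R v u) * tuples (pred s) (a ∩ R v ∩ R u))
          ≡⟨ cong (_+ s * (𝟙 (R v u) * tuples (pred s) (a ∩ R v ∩ R u))) (*-identityˡ (tuples s (a ∖ v ∩ R u))) ⟨
        1 * tuples s (a ∖ v ∩ R u) + s * (𝟙 (R v u) * tuples (pred s) (a ∩ R v ∩ R u)) ∎

    -- When `R v v` fails, `v` occurs at most once in a tuple and the preceding count is exact. This
    -- is the case of cliques.
    tuples-remove-≥ : ∀ s a v → a v ≡ true → R v v ≡ false →
      tuples (suc s) (a ∖ v) + suc s * tuples s (a ∩ R v) ≤ tuples (suc s) a
    tuples-remove-≥ s a v av Rvv = ≤-trans (≤-reflexive (sym (split-sum s a v))) (∑-mono (allFin n) term)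
      where
      open ≤-Reasoning
      remove : ∀ s u → v ≢ u → a u ≡ true →
        tuples s (a ∖ v ∩ R u) + s * (𝟙 (R v u) * tuples (pred s) (a ∩ R v ∩ R u)) ≤ tuples s (a ∩ R u)
      remove zero u v≢u au = ≤-refl
      remove (suc s) u v≢u au with R v u in e
      ... | false = ≤-trans (≤-reflexive (trans (cong (tuples (suc s) (a ∖ v ∩ R u) +_) (*-zeroʳ (suc s))) (+-identityʳ _)))
        (tuples-mono (suc s) {a ∖ v ∩ R u} {a ∩ R u} (λ i p → let q , r = ∧-true {(a ∖ v) i} p in true-∧ (proj₁ (∖⁻ {a = a} {v} {i} q)) r))
      ... | true  = ≤-trans (+-mono-≤
        (tuples-mono (suc s) {a ∖ v ∩ R u} {a ∩ R u ∖ v} (λ i p → let q , r = ∧-true {(a ∖ v) i} p ; q₁ , q₂ = ∖⁻ {a = a} {v} {i} q in ∖⁺ {a = a ∩ R u} {v} {i} (true-∧ q₁ r) q₂))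
        (*-monoʳ-≤ (suc s) (≤-trans (≤-reflexive (*-identityˡ _)) (tuples-mono s (λ i p →
          let q , r = ∧-true {a i ∧ R v i} p ; q₁ , q₂ = ∧-true {a i} q in true-∧ (true-∧ q₁ r) q₂)))))
        (tuples-remove-≥ s (a ∩ R u) v (true-∧ av (trans (R-sym u v) e)) Rvv)
      term : ∀ u → 𝟙 (v == u) * tuples s (a ∩ R v) +
          (𝟙 ((a ∖ v) u) * tuples s (a ∖ v ∩ R u) + s * (𝟙 ((a ∩ R v) u) * tuples (pred s) (a ∩ R v ∩ R u))) ≤
          𝟙 (a u) * tuples s (a ∩ R u)
      term u with v Fin.≟ u
      ... | yes refl rewrite av | Rvv = ≤-reflexive (trans (cong (1 * tuples s (a ∩ R u) +_) (*-zeroʳ s)) (+-identityʳ _))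
      ... | no v≢u with a u in au
      ...   | false = ≤-reflexive (*-zeroʳ s)
      ...   | true  = begin
        1 * tuples s (a ∖ v ∩ R u) + s * (𝟙 (R v u) * tuples (pred s) (a ∩ R v ∩ R u))
          ≡⟨ cong (_+ s * (𝟙 (R v u) * tuples (pred s) (a ∩ R v ∩ R u))) (*-identityˡ (tuples s (a ∖ v ∩ R u))) ⟩
        tuples s (a ∖ v ∩ R u) + s * (𝟙 (R v u) * tuples (pred s) (a ∩ R v ∩ R u)) ≤⟨ remove s u v≢u au ⟩
        tuples s (a ∩ R u) ≡⟨ *-identityˡ _ ⟨
        1 * tuples s (a ∩ R u) ∎

    -- Kleitman–Winston: as long as a has at least r elements, a vertex v of large degree either is
    -- discarded or is used in the tuple, and the latter can happen at most k times.
    module _ (r b c : ℕ) .{{_ : NonZero r}} .{{_ : NonZero b}}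
      (dense : ∀ a → r ≤ # a → ∃ λ v → a v ≡ true × # (a ∩ R v) * b ≤ # a * c) where

      tuples-bound : ∀ k t a → # a * c ^ k ≤ r * b ^ k → tuples t a ≤ (1 + n * t) ^ k * r ^ t
      tuples-bound k zero a h = >-nonZero⁻¹ ((1 + n * 0) ^ k * 1) {{m*n≢0 _ _ {{m^n≢0 (1 + n * 0) k}}}}
      tuples-bound zero (suc t) a h = begin
        tuples (suc t) a ≤⟨ tuples≤#^ (suc t) a ⟩
        # a ^ suc t ≤⟨ ^-monoˡ-≤ (suc t) (subst₂ _≤_ (*-identityʳ (# a)) (*-identityʳ r) h) ⟩
        r ^ suc t ≡⟨ *-identityˡ _ ⟨
        1 * r ^ suc t ∎
        where open ≤-Reasoning
      tuples-bound (suc k) t@(suc t′) a h = begin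
        tuples t a ≤⟨ go n a (#≤n a) h ⟩
        r ^ t + n * t * B ≤⟨ +-monoˡ-≤ (n * t * B) (m≤n*m (r ^ t) ((1 + n * t) ^ k) {{m^n≢0 (1 + n * t) k}}) ⟩
        B + n * t * B ≡⟨ *-assoc (1 + n * t) ((1 + n * t) ^ k) (r ^ t) ⟨
        (1 + n * t) ^ suc k * r ^ t ∎
        where
        open ≤-Reasoning
        B : ℕ
        B = (1 + n * t) ^ k * r ^ t
        small : ∀ {m} a → # a ≤ r → tuples t a ≤ r ^ t + m
        small a h = ≤-trans (≤-trans (tuples≤#^ t a) (^-monoˡ-≤ t h)) (m≤m+n _ _)
        -- One use of `v` shrinks the candidates by the factor `c / b`, so the bound on the size
        -- survives with `k` lowered by one.
        step : ∀ a v → # (a ∩ R v) * b ≤ # a * c → # a * c ^ suc k ≤ r * b ^ suc k → # (a ∩ R v) * c ^ k ≤ r * b ^ k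
        step a v h₁ h₂ = *-cancelʳ-≤ _ _ b (begin
          # (a ∩ R v) * c ^ k * b ≡⟨ eq₁ (# (a ∩ R v)) (c ^ k) b ⟩
          # (a ∩ R v) * b * c ^ k ≤⟨ *-monoˡ-≤ (c ^ k) h₁ ⟩
          # a * c * c ^ k         ≡⟨ *-assoc (# a) c (c ^ k) ⟩
          # a * c ^ suc k         ≤⟨ h₂ ⟩
          r * b ^ suc k           ≡⟨ eq₂ r b (b ^ k) ⟩
          r * b ^ k * b           ∎)
          where
          eq₁ : ∀ x y z → x * y * z ≡ x * z * y
          eq₁ = solve-∀
          eq₂ : ∀ x y z → x * (y * z) ≡ x * z * y
          eq₂ = solve-∀
        -- `m` is fuel for the discards, of which there are at most `n`. Each discarded `v` is paid
        -- for by the tuples that use it: `t` places for `v`, times the bound `B` for the remaining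
        -- entries.
        go : ∀ m a → # a ≤ m → # a * c ^ suc k ≤ r * b ^ suc k → tuples t a ≤ r ^ t + m * t * B
        go m a #a≤m h with r ≤? # a
        ... | no r≰#a = small a (<⇒≤ (≰⇒> r≰#a))
        go zero a #a≤m h | yes r≤#a = small a (≤-trans #a≤m z≤n)
        go (suc m) a #a≤m h | yes r≤#a with dense a r≤#a
        ... | v , av , h₁ = begin
          tuples t a ≤⟨ tuples-remove-≤ t′ a v ⟩
          tuples t (a ∖ v) + t * tuples t′ (a ∩ R v) ≤⟨ +-mono-≤
            (go m (a ∖ v) (s≤s⁻¹ (subst (_≤ suc m) (sym (#-∖ a av)) #a≤m))
              (≤-trans (*-monoˡ-≤ (c ^ suc k) (≤-trans (n≤1+n _) (≤-reflexive (#-∖ a av)))) h))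
            (*-monoʳ-≤ t (begin
              tuples t′ (a ∩ R v) ≤⟨ tuples-bound k t′ (a ∩ R v) (step a v h₁ h) ⟩
              (1 + n * t′) ^ k * r ^ t′ ≤⟨ *-mono-≤ (^-monoˡ-≤ k (s≤s (*-monoʳ-≤ n (n≤1+n t′)))) (m≤n*m (r ^ t′) r) ⟩
              B ∎)) ⟩
          r ^ t + m * t * B + t * B ≡⟨ eq (r ^ t) m t B ⟩
          r ^ t + suc m * t * B ∎
          where
          eq : ∀ x m t y → x + m * t * y + t * y ≡ x + (t + m * t) * y
          eq = solve-∀

^-cancelˡ-≤ : ∀ {x y} n .{{_ : NonZero n}} → x ^ n ≤ y ^ n → x ≤ y
^-cancelˡ-≤ {x} {y} n h with x ≤? y
... | yes p = p
... | no ¬p = contradiction h (<⇒≱ (^-monoˡ-< n (≰⇒> ¬p)))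

^-distribʳ-* : ∀ x y n → (x * y) ^ n ≡ x ^ n * y ^ n
^-distribʳ-* x y zero    = refl
^-distribʳ-* x y (suc n) = trans (cong (x * y *_) (^-distribʳ-* x y n)) (eq x y (x ^ n) (y ^ n))
  where
  eq : ∀ x y u v → x * y * (u * v) ≡ x * u * (y * v)
  eq = solve-∀

-- Both terms are compared with the one having the larger ratio x / y.
power-+ : ∀ s M x₁ y₁ x₂ y₂ → x₁ ^ suc s ≤ M * y₁ ^ suc s → x₂ ^ suc s ≤ M * y₂ ^ suc s →
  (x₁ + x₂) ^ suc s ≤ M * (y₁ + y₂) ^ suc s
power-+ s M x₁ y₁ x₂ y₂ h₁ h₂ = case ≤-total (x₁ * y₂) (x₂ * y₁) of λ
  { (inj₁ h) → ordered x₁ y₁ x₂ y₂ h₁ h₂ h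
  ; (inj₂ h) → subst₂ (λ x y → x ^ suc s ≤ M * y ^ suc s) (+-comm x₂ x₁) (+-comm y₂ y₁) (ordered x₂ y₂ x₁ y₁ h₂ h₁ h) }
  where
  ordered : ∀ x₁ y₁ x₂ y₂ → x₁ ^ suc s ≤ M * y₁ ^ suc s → x₂ ^ suc s ≤ M * y₂ ^ suc s →
    x₁ * y₂ ≤ x₂ * y₁ → (x₁ + x₂) ^ suc s ≤ M * (y₁ + y₂) ^ suc s
  ordered x₁ y₁ x₂ zero h₁ h₂ h
    rewrite m^n≡0⇒m≡0 x₂ (suc s) (n≤0⇒n≡0 (subst (x₂ ^ suc s ≤_) (*-zeroʳ M) h₂)) | +-identityʳ x₁ | +-identityʳ y₁ = h₁
  ordered x₁ y₁ x₂ y₂@(suc _) h₁ h₂ h = *-cancelʳ-≤ _ _ (y₂ ^ suc s) {{m^n≢0 y₂ (suc s)}} (begin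
    (x₁ + x₂) ^ suc s * y₂ ^ suc s     ≡⟨ ^-distribʳ-* (x₁ + x₂) y₂ (suc s) ⟨
    ((x₁ + x₂) * y₂) ^ suc s           ≤⟨ ^-monoˡ-≤ (suc s) (begin
      (x₁ + x₂) * y₂    ≡⟨ *-distribʳ-+ y₂ x₁ x₂ ⟩
      x₁ * y₂ + x₂ * y₂ ≤⟨ +-monoˡ-≤ (x₂ * y₂) h ⟩
      x₂ * y₁ + x₂ * y₂ ≡⟨ *-distribˡ-+ x₂ y₁ y₂ ⟨
      x₂ * (y₁ + y₂)    ∎) ⟩
    (x₂ * (y₁ + y₂)) ^ suc s           ≡⟨ ^-distribʳ-* x₂ (y₁ + y₂) (suc s) ⟩
    x₂ ^ suc s * (y₁ + y₂) ^ suc s     ≤⟨ *-monoˡ-≤ _ h₂ ⟩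
    M * y₂ ^ suc s * (y₁ + y₂) ^ suc s ≡⟨ eq M (y₂ ^ suc s) _ ⟩
    M * (y₁ + y₂) ^ suc s * y₂ ^ suc s ∎)
    where
    open ≤-Reasoning
    eq : ∀ a b c → a * b * c ≡ a * c * b
    eq = solve-∀

∑-power : ∀ {A : Set} (xs : List A) s M (f g : A → ℕ) → (∀ x → f x ^ suc s ≤ M * g x ^ suc s) →
  ∑ xs f ^ suc s ≤ M * ∑ xs g ^ suc s
∑-power [] s M f g h       = z≤n
∑-power (x ∷ xs) s M f g h = power-+ s M (f x) (g x) (∑ xs f) (∑ xs g) (h x) (∑-power xs s M f g h)

module _ {n} (R : Fin n → Fin n → Bool) where

  -- The Loomis–Whitney inequality for cliques, in place of Kruskal–Katona.
  tuples-power-suc : ∀ s a → tuples R (suc s) a ^ s ≤ tuples R s a ^ suc s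
  tuples-power-suc zero a    = ≤-refl
  tuples-power-suc (suc s) a = begin
    tuples R (suc (suc s)) a ^ suc s               ≤⟨ ∑-power (allFin n) s (tuples R (suc s) a) _ _ term ⟩
    tuples R (suc s) a * tuples R (suc s) a ^ suc s ∎
    where
    open ≤-Reasoning
    term : ∀ v → (𝟙 (a v) * tuples R (suc s) (a ∩ R v)) ^ suc s ≤
      tuples R (suc s) a * (𝟙 (a v) * tuples R s (a ∩ R v)) ^ suc s
    term v with a v
    ... | false = z≤n
    ... | true  rewrite *-identityˡ (tuples R (suc s) (a ∩ R v)) | *-identityˡ (tuples R s (a ∩ R v)) = *-mono-≤
      (tuples-mono R (suc s) {a ∩ R v} {a} (λ i p → proj₁ (∧-true {a i} p))) (tuples-power-suc s (a ∩ R v))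

  -- Induction on `d` by `tuples-power-suc`. In place of taking roots, both sides are raised to the
  -- power `t = d + s`, which cancels at the end. So the `s`-th root of the number of `s`-tuples
  -- does not increase with `s`.
  tuples-power : ∀ s d a .{{_ : NonZero s}} → tuples R (d + s) a ^ s ≤ tuples R s a ^ (d + s)
  tuples-power s zero a = ≤-refl
  tuples-power s@(suc _) (suc d) a = ^-cancelˡ-≤ t {{>-nonZero (≤-trans (s≤s z≤n) (m≤n+m s d))}} (begin
    (τ (suc t) ^ s) ^ t ≡⟨ trans (^-*-assoc (τ (suc t)) s t) (trans (cong (τ (suc t) ^_) (*-comm s t)) (sym (^-*-assoc (τ (suc t)) t s))) ⟩
    (τ (suc t) ^ t) ^ s ≤⟨ ^-monoˡ-≤ s (tuples-power-suc t a) ⟩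
    (τ t ^ suc t) ^ s   ≡⟨ trans (^-*-assoc (τ t) (suc t) s) (trans (cong (τ t ^_) (*-comm (suc t) s)) (sym (^-*-assoc (τ t) s (suc t)))) ⟩
    (τ t ^ s) ^ suc t   ≤⟨ ^-monoˡ-≤ (suc t) (tuples-power s d a) ⟩
    (τ s ^ t) ^ suc t   ≡⟨ trans (^-*-assoc (τ s) t (suc t)) (trans (cong (τ s ^_) (*-comm t (suc t))) (sym (^-*-assoc (τ s) (suc t) t))) ⟩
    (τ s ^ suc t) ^ t   ∎)
    where
    open ≤-Reasoning
    t : ℕ
    t = d + s
    τ : ℕ → ℕ
    τ u = tuples R u a

-- Ordered cliques against sets of vertices

_⁺ : ∀ {n} → (Fin (suc n) → Fin (suc n) → Bool) → Fin n → Fin n → Bool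
(R ⁺) i j = R (suc i) (suc j)

everything : ∀ {n} → Fin n → Bool
everything _ = true

-- A recursive twin of `isClique` that restricts the candidates as `tuples` does, so that the two
-- counts can be compared by deleting vertex `zero`.
cliqueIn : ∀ {n} → (Fin n → Fin n → Bool) → (Fin n → Bool) → Subset n → Bool
cliqueIn R a []          = true
cliqueIn R a (true ∷ p)  = a zero ∧ cliqueIn (R ⁺) ((a ∩ R zero) ∘ suc) p
cliqueIn R a (false ∷ p) = cliqueIn (R ⁺) (a ∘ suc) p

cliquesIn : ∀ {n} → (Fin n → Fin n → Bool) → (Fin n → Bool) → ℕ → ℕ
cliquesIn {n} R a s = ∑ (subsets n) (λ p → 𝟙 ((∣ p ∣ ≡ᵇ s) ∧ cliqueIn R a p))

tuples-shift : ∀ {n} (R : Fin (suc n) → Fin (suc n) → Bool) s a → a zero ≡ false →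
  tuples R s a ≡ tuples (R ⁺) s (a ∘ suc)
tuples-shift R zero a h = refl
tuples-shift {n} R (suc s) a h = trans (∑-suc (λ v → 𝟙 (a v) * tuples R s (a ∩ R v)))
  (cong₂ _+_ (cong (λ b → 𝟙 b * tuples R s (a ∩ R zero)) h)
    (∑-cong (allFin n) (λ v → cong (𝟙 (a (suc v)) *_) (tuples-shift R s (a ∩ R (suc v)) (cong (_∧ R (suc v) zero) h)))))

cliquesIn-suc : ∀ {n} R a s → cliquesIn {suc n} R a s ≡
  ∑ (subsets n) (λ p → 𝟙 ((suc ∣ p ∣ ≡ᵇ s) ∧ (a zero ∧ cliqueIn (R ⁺) ((a ∩ R zero) ∘ suc) p))) +
  cliquesIn (R ⁺) (a ∘ suc) s
cliquesIn-suc {n} R a s = trans (∑-++ (map (inside ∷_) (subsets n)) _ _)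
  (cong₂ _+_ (∑-map (inside ∷_) (subsets n) _) (∑-map (outside ∷_) (subsets n) _))

-- Induction on the number of vertices. Deleting `zero` gives the ordered count the recursion of
-- `tuples-remove-≤` and `tuples-remove-≥`; splitting the subsets by whether they contain `zero`
-- gives the same recursion for the unordered count times `suc s !`.
tuples≡!*cliquesIn : ∀ {n} (R : Fin n → Fin n → Bool) →
  (∀ i j → R i j ≡ R j i) → (∀ i → R i i ≡ false) → ∀ s a → tuples R s a ≡ s ! * cliquesIn R a s
tuples≡!*cliquesIn {zero} R R-sym R-irr zero a    = refl
tuples≡!*cliquesIn {zero} R R-sym R-irr (suc s) a = sym (*-zeroʳ (suc s !))
tuples≡!*cliquesIn {suc n} R R-sym R-irr zero a = begin
  1                                       ≡⟨ tuples≡!*cliquesIn (R ⁺) (λ i j → R-sym _ _) (λ i → R-irr _) zero (a ∘ suc) ⟩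
  1 * cliquesIn (R ⁺) (a ∘ suc) 0         ≡⟨ cong (λ z → 1 * (z + cliquesIn (R ⁺) (a ∘ suc) 0)) (∑-zero (subsets n) (λ _ → refl)) ⟨
  1 * _                                   ≡⟨ cong (1 *_) (cliquesIn-suc R a 0) ⟨
  1 * cliquesIn R a 0                     ∎
  where open ≡-Reasoning
tuples≡!*cliquesIn {suc n} R R-sym R-irr (suc s) a = go (a zero) refl
  where
  open ≡-Reasoning
  k₁ k₂ : ℕ
  k₁ = cliquesIn (R ⁺) (a ∘ suc) (suc s)
  k₂ = cliquesIn (R ⁺) ((a ∩ R zero) ∘ suc) s
  eq : ∀ s f x y → s * f * x + s * (f * y) ≡ s * f * (y + x)
  eq = solve-∀
  go : ∀ b → a zero ≡ b → tuples R (suc s) a ≡ suc s ! * cliquesIn R a (suc s)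
  go false a0 = begin
    tuples R (suc s) a                          ≡⟨ tuples-shift R (suc s) a a0 ⟩
    tuples (R ⁺) (suc s) (a ∘ suc)              ≡⟨ tuples≡!*cliquesIn (R ⁺) (λ i j → R-sym _ _) (λ i → R-irr _) (suc s) (a ∘ suc) ⟩
    suc s ! * cliquesIn (R ⁺) (a ∘ suc) (suc s) ≡⟨ cong (λ z → suc s ! * (z + cliquesIn (R ⁺) (a ∘ suc) (suc s)))
                                                    (∑-zero (subsets n) (λ p → trans (cong (λ b → 𝟙 ((∣ p ∣ ≡ᵇ s) ∧ (b ∧ cliqueIn (R ⁺) ((a ∩ R zero) ∘ suc) p))) a0) (cong 𝟙 (∧-zeroʳ (∣ p ∣ ≡ᵇ s))))) ⟨
    suc s ! * _                                 ≡⟨ cong (suc s ! *_) (cliquesIn-suc R a (suc s)) ⟨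
    suc s ! * cliquesIn R a (suc s)             ∎
  go true a0 = begin
    tuples R (suc s) a ≡⟨ ≤-antisym (tuples-remove-≤ R R-sym s a zero) (tuples-remove-≥ R R-sym s a zero a0 (R-irr zero)) ⟩
    tuples R (suc s) (a ∖ zero) + suc s * tuples R s (a ∩ R zero)
      ≡⟨ cong₂ (λ x y → x + suc s * y)
           (tuples-shift R (suc s) (a ∖ zero) (∧-zeroʳ (a zero)))
           (tuples-shift R s (a ∩ R zero) (trans (cong (a zero ∧_) (R-irr zero)) (∧-zeroʳ (a zero)))) ⟩
    tuples (R ⁺) (suc s) ((a ∖ zero) ∘ suc) + suc s * tuples (R ⁺) s ((a ∩ R zero) ∘ suc)
      ≡⟨ cong₂ (λ x y → x + suc s * y)
           (trans (≤-antisym (tuples-mono (R ⁺) (suc s) {(a ∖ zero) ∘ suc} {a ∘ suc} (λ i p → proj₁ (∧-true {a (suc i)} p)))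
                             (tuples-mono (R ⁺) (suc s) {a ∘ suc} {(a ∖ zero) ∘ suc} (λ i p → true-∧ p refl)))
                  (tuples≡!*cliquesIn (R ⁺) (λ i j → R-sym _ _) (λ i → R-irr _) (suc s) (a ∘ suc)))
           (tuples≡!*cliquesIn (R ⁺) (λ i j → R-sym _ _) (λ i → R-irr _) s ((a ∩ R zero) ∘ suc)) ⟩
    suc s ! * k₁ + suc s * (s ! * k₂)       ≡⟨ eq (suc s) (s !) k₁ k₂ ⟩
    suc s ! * (k₂ + k₁)                     ≡⟨ cong (λ z → suc s ! * (z + k₁)) (∑-cong (subsets n)
                                                 (λ p → cong (λ b → 𝟙 ((∣ p ∣ ≡ᵇ s) ∧ (b ∧ cliqueIn (R ⁺) ((a ∩ R zero) ∘ suc) p))) a0)) ⟨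
    suc s ! * _                             ≡⟨ cong (suc s ! *_) (cliquesIn-suc R a (suc s)) ⟨
    suc s ! * cliquesIn R a (suc s)         ∎

-- Random maps into a graph

∣∣≡# : ∀ {n} (p : Subset n) → ∣ p ∣ ≡ # (lookup p)
∣∣≡# []          = refl
∣∣≡# (true ∷ p)  = trans (cong suc (∣∣≡# p)) (sym (∑-suc (𝟙 ∘ lookup (true ∷ p))))
∣∣≡# (false ∷ p) = trans (∣∣≡# p) (sym (∑-suc (𝟙 ∘ lookup (false ∷ p))))

does-∈? : ∀ {n} i (p : Subset n) → does (i ∈? p) ≡ lookup p i
does-∈? zero (true ∷ p)  = refl
does-∈? zero (false ∷ p) = refl
does-∈? (suc i) (b ∷ p)  = does-∈? i p

Pairwise : ∀ {n} → (Fin n → Fin n → Bool) → Subset n → Set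
Pairwise {n} R p = ∀ i j → lookup p i ≡ true → lookup p j ≡ true → i ≢ j → R i j ≡ true

allB-true : ∀ {A : Set} (f : A → Bool) xs → (∀ x → f x ≡ true) → allB f xs ≡ true
allB-true f [] h       = refl
allB-true f (x ∷ xs) h = true-∧ (h x) (allB-true f xs h)

allB-allFin : ∀ {n} (f : Fin n → Bool) → allB f (allFin n) ≡ true → ∀ i → f i ≡ true
allB-allFin {n} f h = go n id h
  where
  go : ∀ m (e : Fin m → Fin n) → allB f (tabulate e) ≡ true → ∀ i → f (e i) ≡ true
  go (suc m) e h zero    = proj₁ (∧-true h)
  go (suc m) e h (suc i) = go m (e ∘ suc) (proj₂ (∧-true {f (e zero)} h)) i

isClique⇒Pairwise : ∀ {n} (G : Graph n) p → isClique G p ≡ true → Pairwise (adj G) p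
isClique⇒Pairwise G p h i j pi pj i≢j
  with allB-allFin _ (allB-allFin _ h i) j
... | e rewrite does-∈? i p | does-∈? j p | pi | pj | ≢⇒==-false i≢j = e

Pairwise⇒isClique : ∀ {n} (G : Graph n) p → Pairwise (adj G) p → isClique G p ≡ true
Pairwise⇒isClique {n} G p h = allB-true _ (allFin n) (λ i → allB-true _ (allFin n) (entry i))
  where
  entry : ∀ i j → (not (does (i ∈? p)) ∨ not (does (j ∈? p)) ∨ does (i Fin.≟ j) ∨ adj G i j) ≡ true
  entry i j rewrite does-∈? i p | does-∈? j p with lookup p i in pi | lookup p j in pj | i Fin.≟ j
  ... | false | _     | _       = refl
  ... | true  | false | _       = refl
  ... | true  | true  | yes _   = refl
  ... | true  | true  | no i≢j  = h i j pi pj i≢j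

cliqueIn⇒Pairwise : ∀ {n} (R : Fin n → Fin n → Bool) → (∀ i j → R i j ≡ R j i) → ∀ a p →
  cliqueIn R a p ≡ true → (∀ i → lookup p i ≡ true → a i ≡ true) × Pairwise R p
cliqueIn⇒Pairwise R R-sym a [] h = (λ ()) , λ ()
cliqueIn⇒Pairwise R R-sym a (true ∷ p) h with ∧-true {a zero} h
... | a0 , h′ with cliqueIn⇒Pairwise (R ⁺) (λ i j → R-sym _ _) ((a ∩ R zero) ∘ suc) p h′
... | inA , pw = (λ { zero _ → a0 ; (suc i) q → proj₁ (∧-true (inA i q)) }) , λ where
    zero zero _ _ 0≢0       → contradiction refl 0≢0
    zero (suc j) _ q _      → proj₂ (∧-true {a (suc j)} (inA j q))
    (suc i) zero q _ _      → trans (R-sym (suc i) zero) (proj₂ (∧-true {a (suc i)} (inA i q)))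
    (suc i) (suc j) q r i≢j → pw i j q r (i≢j ∘ cong suc)
cliqueIn⇒Pairwise R R-sym a (false ∷ p) h with cliqueIn⇒Pairwise (R ⁺) (λ i j → R-sym _ _) (a ∘ suc) p h
... | inA , pw = (λ { (suc i) q → inA i q }) , λ where
    (suc i) (suc j) q r i≢j → pw i j q r (i≢j ∘ cong suc)

Pairwise⇒cliqueIn : ∀ {n} (R : Fin n → Fin n → Bool) a p →
  (∀ i → lookup p i ≡ true → a i ≡ true) → Pairwise R p → cliqueIn R a p ≡ true
Pairwise⇒cliqueIn R a [] inA pw = refl
Pairwise⇒cliqueIn R a (true ∷ p) inA pw = true-∧ (inA zero refl) (Pairwise⇒cliqueIn (R ⁺) _ p
  (λ i q → true-∧ (inA (suc i) q) (pw zero (suc i) refl q (λ ())))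
  (λ i j q r i≢j → pw (suc i) (suc j) q r (i≢j ∘ Fin.suc-injective)))
Pairwise⇒cliqueIn R a (false ∷ p) inA pw = Pairwise⇒cliqueIn (R ⁺) _ p (λ i q → inA (suc i) q)
  (λ i j q r i≢j → pw (suc i) (suc j) q r (i≢j ∘ Fin.suc-injective))

≡true-ext : ∀ {a b} → (a ≡ true → b ≡ true) → (b ≡ true → a ≡ true) → a ≡ b
≡true-ext {true} {b} f g      = sym (f refl)
≡true-ext {false} {true} f g  = g refl
≡true-ext {false} {false} f g = refl

length-filterᵇ : ∀ {A : Set} (f : A → Bool) xs → length (filterᵇ f xs) ≡ ∑ xs (𝟙 ∘ f)
length-filterᵇ f xs = trans (length-∑ (filterᵇ f xs)) (trans (∑-filterᵇ f xs _) (∑-cong xs (λ x → *-identityʳ _)))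

cliqueCount≡cliquesIn : ∀ {n} (G : Graph n) s → cliqueCount G s ≡ cliquesIn (adj G) everything s
cliqueCount≡cliquesIn {n} G s = trans (length-filterᵇ _ (subsets n)) (∑-cong (subsets n) (λ p →
  cong (λ b → 𝟙 ((∣ p ∣ ≡ᵇ s) ∧ b)) (≡true-ext
    (λ h → Pairwise⇒cliqueIn (adj G) everything p (λ _ _ → refl) (isClique⇒Pairwise G p h))
    (λ h → Pairwise⇒isClique G p (proj₂ (cliqueIn⇒Pairwise (adj G) (adj-sym G) everything p h))))))

tuples≡!*cliqueCount : ∀ {n} (G : Graph n) s → tuples (adj G) s everything ≡ s ! * cliqueCount G s
tuples≡!*cliqueCount G s = trans (tuples≡!*cliquesIn (adj G) (adj-sym G) (irrefl G) s everything)
  (cong (s ! *_) (sym (cliqueCount≡cliquesIn G s)))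

module _ {N : ℕ} where

  independentOn : ∀ {n} → (Fin N → Fin N → Bool) → (Fin N → Bool) → Subset n → Vec (Fin N) n → Bool
  independentOn R a [] []               = true
  independentOn R a (false ∷ p) (v ∷ φ) = independentOn R a p φ
  independentOn R a (true ∷ p) (v ∷ φ)  = a v ∧ independentOn R (a ∩ R v) p φ

  -- A uniformly random map restricted to `p` is a uniformly random tuple of length `∣ p ∣`, and the
  -- values off `p` are free. The resulting probability `tuples R ∣ p ∣ a / N ^ ∣ p ∣` is written
  -- without division.
  count-independentOn : ∀ R {n} a (p : Subset n) →
    ∑ (vecs (allFin N) n) (𝟙 ∘ independentOn R a p) * N ^ ∣ p ∣ ≡ N ^ n * tuples R ∣ p ∣ a
  count-independentOn R a [] = refl
  count-independentOn R {suc n} a (false ∷ p) = begin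
    ∑ (vecs (allFin N) (suc n)) (𝟙 ∘ independentOn R a (false ∷ p)) * N ^ ∣ p ∣
      ≡⟨ cong (_* N ^ ∣ p ∣) (trans (∑-vecs-suc (allFin N) (𝟙 ∘ independentOn R a (false ∷ p))) (∑-allFin-const N _)) ⟩
    N * X * N ^ ∣ p ∣                  ≡⟨ *-assoc N X _ ⟩
    N * (X * N ^ ∣ p ∣)                ≡⟨ cong (N *_) (count-independentOn R a p) ⟩
    N * (N ^ n * tuples R ∣ p ∣ a)     ≡⟨ *-assoc N (N ^ n) _ ⟨
    N ^ suc n * tuples R ∣ p ∣ a       ∎
    where
    open ≡-Reasoning
    X : ℕ
    X = ∑ (vecs (allFin N) n) (𝟙 ∘ independentOn R a p)
  count-independentOn R {suc n} a (true ∷ p) = begin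
    ∑ (vecs (allFin N) (suc n)) (𝟙 ∘ independentOn R a (true ∷ p)) * (N * N ^ k)
      ≡⟨ cong (_* (N * N ^ k)) (trans (∑-vecs-suc (allFin N) (𝟙 ∘ independentOn R a (true ∷ p)))
           (∑-cong (allFin N) (λ v → trans (∑-cong (vecs (allFin N) n) (λ φ → 𝟙-∧ (a v) _)) (∑-*ˡ (vecs (allFin N) n) (𝟙 (a v)) _)))) ⟩
    ∑ (allFin N) (λ v → 𝟙 (a v) * X v) * (N * N ^ k) ≡⟨ ∑-*ʳ (allFin N) (N * N ^ k) _ ⟨
    ∑ (allFin N) (λ v → 𝟙 (a v) * X v * (N * N ^ k)) ≡⟨ ∑-cong (allFin N) (λ v → begin
        𝟙 (a v) * X v * (N * N ^ k)               ≡⟨ eq (𝟙 (a v)) (X v) N (N ^ k) ⟩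
        𝟙 (a v) * N * (X v * N ^ k)               ≡⟨ cong (𝟙 (a v) * N *_) (count-independentOn R (a ∩ R v) p) ⟩
        𝟙 (a v) * N * (N ^ n * tuples R k (a ∩ R v)) ≡⟨ eq′ (𝟙 (a v)) N (N ^ n) (tuples R k (a ∩ R v)) ⟩
        N ^ suc n * (𝟙 (a v) * tuples R k (a ∩ R v)) ∎) ⟩
    ∑ (allFin N) (λ v → N ^ suc n * (𝟙 (a v) * tuples R k (a ∩ R v))) ≡⟨ ∑-*ˡ (allFin N) (N ^ suc n) _ ⟩
    N ^ suc n * tuples R (suc k) a ∎
    where
    open ≡-Reasoning
    k : ℕ
    k = ∣ p ∣
    X : Fin N → ℕ
    X v = ∑ (vecs (allFin N) n) (𝟙 ∘ independentOn R (a ∩ R v) p)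
    eq : ∀ a x n m → a * x * (n * m) ≡ a * n * (x * m)
    eq = solve-∀
    eq′ : ∀ a n m x → a * n * (m * x) ≡ n * m * (a * x)
    eq′ = solve-∀

  independentOn-true : ∀ R {n} a (p : Subset n) φ → (∀ i → lookup p i ≡ true → a (lookup φ i) ≡ true) →
    Pairwise (λ i j → R (lookup φ i) (lookup φ j)) p → independentOn R a p φ ≡ true
  independentOn-true R a [] [] inA pw               = refl
  independentOn-true R a (false ∷ p) (v ∷ φ) inA pw = independentOn-true R a p φ (λ i → inA (suc i))
    (λ i j q r i≢j → pw (suc i) (suc j) q r (i≢j ∘ Fin.suc-injective))
  independentOn-true R a (true ∷ p) (v ∷ φ) inA pw  = true-∧ (inA zero refl) (independentOn-true R (a ∩ R v) p φ
    (λ i q → true-∧ (inA (suc i) q) (pw zero (suc i) refl q (λ ())))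
    (λ i j q r i≢j → pw (suc i) (suc j) q r (i≢j ∘ Fin.suc-injective)))

image : ∀ {k n} → (Fin k → Fin n) → Subset n
image f = Vec.tabulate (λ i → does (Fin.any? (λ j → f j Fin.≟ i)))

lookup-image : ∀ {k n} (f : Fin k → Fin n) {i} → lookup (image f) i ≡ true → ∃ λ j → f j ≡ i
lookup-image f {i} h with Fin.any? (λ j → f j Fin.≟ i) | trans (sym (Vec.lookup∘tabulate (λ i → does (Fin.any? (λ j → f j Fin.≟ i))) i)) h
... | yes p | _ = p

image-size : ∀ {k n} (f : Fin k → Fin n) → Injective _≡_ _≡_ f → ∣ image f ∣ ≡ k
image-size {k} {n} f f-inj = begin
  ∣ image f ∣              ≡⟨ ∣∣≡# (image f) ⟩
  # (lookup (image f))     ≡⟨ ∑-cong (allFin n) term ⟩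
  ∑ (allFin n) (λ i → # (λ j → f j == i)) ≡⟨ ∑-comm (allFin n) (allFin k) (λ i j → 𝟙 (f j == i)) ⟩
  ∑ (allFin k) (λ j → # (λ i → f j == i)) ≡⟨ ∑-cong (allFin k) (λ j → #-== (f j)) ⟩
  ∑ (allFin k) (λ j → 1)   ≡⟨ trans (∑-allFin-const k 1) (*-identityʳ k) ⟩
  k ∎
  where
  open ≡-Reasoning
  term : ∀ i → 𝟙 (lookup (image f) i) ≡ # (λ j → f j == i)
  term i rewrite Vec.lookup∘tabulate (λ i → does (Fin.any? (λ j → f j Fin.≟ i))) i with Fin.any? (λ j → f j Fin.≟ i)
  ... | yes (j , refl) = ≤-antisym
    (≤-trans (≤-reflexive (sym (cong 𝟙 (==-refl (f j))))) (∑-term (λ j′ → 𝟙 (f j′ == f j)) j))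
    (#≤1 (λ j′ → f j′ == f j) (λ j₁ j₂ p q → f-inj (trans (==⇒≡ p) (sym (==⇒≡ q)))))
  ... | no ¬p = sym (#-none (λ j → ≢⇒==-false (λ e → ¬p (j , e))))

∑-member : ∀ {A : Set} xs (f : A → ℕ) {x} → x Membership.∈ xs → f x ≤ ∑ xs f
∑-member (x ∷ xs) f (here refl) = m≤m+n _ _
∑-member (x ∷ xs) f (there x∈)  = ≤-trans (∑-member xs f x∈) (m≤n+m _ _)

∈-subsets : ∀ {n} (p : Subset n) → p Membership.∈ subsets n
∈-subsets []          = here refl
∈-subsets (true ∷ p)  = Membership.∈-++⁺ˡ (Membership.∈-map⁺ (inside ∷_) (∈-subsets p))
∈-subsets {suc n} (false ∷ p) = Membership.∈-++⁺ʳ (map (inside ∷_) (subsets n)) (Membership.∈-map⁺ (outside ∷_) (∈-subsets p))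

Tᵇ : ∀ {b} → T b → b ≡ true
Tᵇ {true} _ = refl

-- Colour an edge of G red when a random map V(G) → Fin N sends it to an edge of H.
ramsey⇒power≤ : ∀ {N} (H : Fin N → Fin N → Bool) → (∀ u v → H u v ≡ H v u) →
  (∀ (g : Fin 4 → Fin N) → ¬ (∀ i j → i ≢ j → H (g i) (g j) ≡ true)) →
  ∀ {n} (G : Graph n) t → .{{NonZero N}} → IsRamsey 4 t G →
  N ^ t ≤ cliqueCount G t * tuples (λ u v → not (H u v)) t everything
ramsey⇒power≤ {N} H H-sym K₄-free {n} G t ramsey = ≮⇒≥ λ few →
  -- By linearity the expected number of `t`-cliques of `G` with independent image is
  -- `cliqueCount G t * I / N ^ t`. If this is below one, some `φ` has none.
  let φ , h = ∑-<⇒∃< Φ (begin-strict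
        ∑ Φ (λ φ → bad φ * N ^ t)            ≡⟨ ∑-*ʳ Φ (N ^ t) bad ⟩
        ∑ Φ bad * N ^ t                      ≡⟨ expected ⟩
        N ^ n * (cliqueCount G t * I)        <⟨ *-monoʳ-< (N ^ n) {{m^n≢0 N n}} few ⟩
        N ^ n * N ^ t                        ≡⟨ cong (_* N ^ t) (trans (length-vecs (allFin N) n) (cong (_^ n) (List.length-tabulate {n = N} id))) ⟨
        length Φ * N ^ t                     ≡⟨ ∑-const Φ (N ^ t) ⟨
        ∑ Φ (λ φ → N ^ t)                    ∎)
  in good φ (n<1⇒n≡0 (*-cancelʳ-< (N ^ t) _ 1 (subst (bad φ * N ^ t <_) (sym (*-identityˡ (N ^ t))) h)))
  where
  open ≤-Reasoning
  R : Fin N → Fin N → Bool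
  R u v = not (H u v)
  I : ℕ
  I = tuples R t everything
  Φ : List (Vec (Fin N) n)
  Φ = vecs (allFin N) n
  isK : Subset n → Bool
  isK p = (∣ p ∣ ≡ᵇ t) ∧ isClique G p
  bad : Vec (Fin N) n → ℕ
  bad φ = ∑ (subsets n) (λ p → 𝟙 (isK p) * 𝟙 (independentOn R everything p φ))

  expected : ∑ Φ bad * N ^ t ≡ N ^ n * (cliqueCount G t * I)
  expected = begin-equality
    ∑ Φ bad * N ^ t ≡⟨ cong (_* N ^ t) (∑-comm Φ (subsets n) _) ⟩
    ∑ (subsets n) (λ p → ∑ Φ (λ φ → 𝟙 (isK p) * 𝟙 (independentOn R everything p φ))) * N ^ t
      ≡⟨ ∑-*ʳ (subsets n) (N ^ t) _ ⟨
    ∑ (subsets n) (λ p → ∑ Φ (λ φ → 𝟙 (isK p) * 𝟙 (independentOn R everything p φ)) * N ^ t)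
      ≡⟨ ∑-cong (subsets n) (λ p → trans (cong (_* N ^ t) (∑-*ˡ Φ (𝟙 (isK p)) _)) (term p)) ⟩
    ∑ (subsets n) (λ p → 𝟙 (isK p) * (N ^ n * I)) ≡⟨ ∑-*ʳ (subsets n) (N ^ n * I) _ ⟩
    ∑ (subsets n) (𝟙 ∘ isK) * (N ^ n * I) ≡⟨ cong (_* (N ^ n * I)) (length-filterᵇ isK (subsets n)) ⟨
    cliqueCount G t * (N ^ n * I) ≡⟨ eq (cliqueCount G t) (N ^ n) I ⟩
    N ^ n * (cliqueCount G t * I) ∎
    where
    eq : ∀ x y z → x * (y * z) ≡ y * (x * z)
    eq = solve-∀
    term : ∀ p → 𝟙 (isK p) * ∑ Φ (𝟙 ∘ independentOn R everything p) * N ^ t ≡ 𝟙 (isK p) * (N ^ n * I)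
    term p with ∣ p ∣ ≡ᵇ t in e | isClique G p
    ... | false | _     = refl
    ... | true  | false = refl
    ... | true  | true  with ≡ᵇ⇒≡ ∣ p ∣ t (subst T (sym e) tt)
    ...   | refl = trans (*-assoc 1 (∑ Φ (𝟙 ∘ independentOn R everything p)) (N ^ ∣ p ∣)) (cong (1 *_) (count-independentOn R everything p))

  good : ∀ φ → bad φ ≡ 0 → ⊥
  good φ h with ramsey (λ i j → H (lookup φ i) (lookup φ j)) (λ i j → H-sym _ _)
  ... | inj₁ (f , f-inj , mono) = K₄-free (lookup φ ∘ f) (λ i j i≢j → proj₂ (mono i j i≢j))
  ... | inj₂ (f , f-inj , mono) = case trans (sym term≡1) (none Q∈) of λ ()
    where
    Q : Subset n
    Q = image f
    pair : ∀ {P : Fin n → Fin n → Bool} → (∀ i j → i ≢ j → P (f i) (f j) ≡ true) → Pairwise P Q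
    pair h i j p q i≢j with lookup-image f p | lookup-image f q
    ... | i′ , refl | j′ , refl = h i′ j′ (λ { refl → i≢j refl })
    none : ∀ {p} → p Membership.∈ subsets n → 𝟙 (isK p) * 𝟙 (independentOn R everything p φ) ≡ 0
    none p∈ = n≤0⇒n≡0 (≤-trans (∑-member (subsets n) _ p∈) (≤-reflexive h))
    Q∈ : Q Membership.∈ subsets n
    Q∈ = ∈-subsets Q
    term≡1 : 𝟙 (isK Q) * 𝟙 (independentOn R everything Q φ) ≡ 1
    term≡1 = cong₂ (λ a b → 𝟙 a * 𝟙 b)
      (true-∧ (Tᵇ (≡⇒≡ᵇ ∣ Q ∣ t (image-size f f-inj))) (Pairwise⇒isClique G Q (pair (λ i j i≢j → proj₁ (mono i j i≢j)))))
      (independentOn-true R everything Q φ (λ _ _ → refl) (pair (λ i j i≢j → cong not (proj₂ (mono i j i≢j)))))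

-- Random bipartitions

bools : List Bool
bools = true ∷ false ∷ []

∑-bools-term : ∀ {n} (f : Vec Bool n → ℕ) v → f v ≤ ∑ (vecs bools n) f
∑-bools-term f []      = m≤m+n _ _
∑-bools-term f (true ∷ v) = ≤-trans (∑-bools-term (f ∘ (true ∷_)) v)
  (≤-trans (m≤m+n _ _) (≤-reflexive (sym (∑-vecs-suc bools f))))
∑-bools-term f (false ∷ v) = ≤-trans (∑-bools-term (f ∘ (false ∷_)) v)
  (≤-trans (≤-trans (m≤m+n _ 0) (m≤n+m _ (∑ (vecs bools _) (f ∘ (true ∷_))))) (≤-reflexive (sym (∑-vecs-suc bools f))))

-- This is `(1 + 1 / y) ^ i ≤ 1 / (1 - i / y)` without denominators; in the induction `z` grows as
-- `i` falls.
bernoulli : ∀ y i z → y ≡ i + z → z * suc y ^ i ≤ y ^ suc i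
bernoulli y zero z refl    = ≤-refl
bernoulli y (suc i) z refl = begin
  z * (suc y * suc y ^ i)   ≡⟨ *-assoc z (suc y) _ ⟨
  z * suc y * suc y ^ i     ≤⟨ *-monoˡ-≤ (suc y ^ i) (begin
    z * suc y ≡⟨ *-suc z y ⟩
    z + z * y ≤⟨ +-monoˡ-≤ (z * y) (m≤n+m z (suc i)) ⟩
    y + z * y ∎) ⟩
  (y + z * y) * suc y ^ i   ≡⟨ eq y z (suc y ^ i) ⟩
  y * (suc z * suc y ^ i)   ≤⟨ *-monoʳ-≤ y (bernoulli y i (suc z) (sym (+-suc i z))) ⟩
  y * y ^ suc i             ∎
  where
  open ≤-Reasoning
  eq : ∀ y z w → (y + z * y) * w ≡ y * ((1 + z) * w)
  eq = solve-∀

-- By `bernoulli`, `(1 + 1 / y) ^ n` is at most `y / (y - n)`, which is below two. Hence the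
-- nonempty subsets of `n` elements have total weight below one when each element has weight
-- `1 / y`.
suc^<2*^ : ∀ {y n} → 2 * n < y → suc y ^ n < 2 * y ^ n
suc^<2*^ {y} {n} 2n<y with m≤n⇒∃[o]m+o≡n (≤-trans (m≤m+n n (n + 0)) (<⇒≤ 2n<y))
... | z , refl = *-cancelˡ-< z _ _ (begin-strict
  z * suc y ^ n     ≤⟨ bernoulli y n z refl ⟩
  y * y ^ n         <⟨ *-monoˡ-< (y ^ n) {{m^n≢0 y n {{>-nonZero (≤-<-trans z≤n 2n<y)}}}} y<2z ⟩
  2 * z * y ^ n     ≡⟨ eq z (y ^ n) ⟩
  z * (2 * y ^ n)   ∎)
  where
  open ≤-Reasoning
  eq : ∀ z w → 2 * z * w ≡ z * (2 * w)
  eq = solve-∀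
  y<2z : n + z < 2 * z
  y<2z = subst (n + z <_) (cong (z +_) (sym (+-identityʳ z)))
    (+-monoˡ-< z (+-cancelˡ-< n n z (subst (_< n + z) (cong (n +_) (+-identityʳ n)) 2n<y)))

-- Cauchy-Schwarz against the constant function, by induction on `n` with the cross terms split by
-- `am-gm`.
∑²≤*∑ : ∀ {n} (f : Fin n → ℕ) → ∑ (allFin n) f * ∑ (allFin n) f ≤ n * ∑ (allFin n) (λ i → f i * f i)
∑²≤*∑ {zero} f  = z≤n
∑²≤*∑ {suc n} f rewrite ∑-suc f | ∑-suc (λ i → f i * f i) = begin
  (a + S) * (a + S)                  ≡⟨ eq₁ a S ⟩
  a * a + 2 * (a * S) + S * S        ≤⟨ +-mono-≤ (+-monoʳ-≤ (a * a) cross) (∑²≤*∑ (f ∘ suc)) ⟩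
  a * a + (n * (a * a) + Q) + n * Q  ≡⟨ eq₂ (a * a) n Q ⟩
  suc n * (a * a + Q)                ∎
  where
  open ≤-Reasoning
  a S Q : ℕ
  a = f zero
  S = ∑ (allFin n) (f ∘ suc)
  Q = ∑ (allFin n) (λ i → f (suc i) * f (suc i))
  eq₁ : ∀ a s → (a + s) * (a + s) ≡ a * a + 2 * (a * s) + s * s
  eq₁ = solve-∀
  eq₂ : ∀ a n q → a + (n * a + q) + n * q ≡ (1 + n) * (a + q)
  eq₂ = solve-∀
  am-gm : ∀ x y → 2 * (x * y) ≤ x * x + y * y
  am-gm x y with ≤-total x y
  ... | inj₁ x≤y with m≤n⇒∃[o]m+o≡n x≤y
  ...   | d , refl = ≤-trans (m≤m+n _ (d * d)) (≤-reflexive (e x d))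
    where
    e : ∀ x d → 2 * (x * (x + d)) + d * d ≡ x * x + (x + d) * (x + d)
    e = solve-∀
  am-gm x y | inj₂ y≤x with m≤n⇒∃[o]m+o≡n y≤x
  ...   | d , refl = ≤-trans (m≤m+n _ (d * d)) (≤-reflexive (e y d))
    where
    e : ∀ y d → 2 * ((y + d) * y) + d * d ≡ (y + d) * (y + d) + y * y
    e = solve-∀
  cross : 2 * (a * S) ≤ n * (a * a) + Q
  cross = begin
    2 * (a * S) ≡⟨ cong (2 *_) (∑-*ˡ (allFin n) a (f ∘ suc)) ⟨
    2 * ∑ (allFin n) (λ i → a * f (suc i)) ≡⟨ ∑-*ˡ (allFin n) 2 _ ⟨
    ∑ (allFin n) (λ i → 2 * (a * f (suc i))) ≤⟨ ∑-mono (allFin n) (λ i → am-gm a (f (suc i))) ⟩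
    ∑ (allFin n) (λ i → a * a + f (suc i) * f (suc i)) ≡⟨ ∑-+ (allFin n) _ _ ⟩
    ∑ (allFin n) (λ i → a * a) + Q ≡⟨ cong (_+ Q) (∑-allFin-const n (a * a)) ⟩
    n * (a * a) + Q ∎

module Bipartitions {P N : ℕ} (inc : Fin P → Fin N → Bool) where

  -- At every point there is a bit for each of the `N` lines, including those that miss the point,
  -- so that the sample space is a plain product.
  Colouring : Set
  Colouring = Vec (Vec Bool N) P

  colour : Colouring → Fin P → Fin N → Bool
  colour b p = lookup (lookup b p)

  edgeAt : Colouring → Fin P → Fin N → Fin N → Bool
  edgeAt b p u v = inc p u ∧ (inc p v ∧ (colour b p u xor colour b p v))

  edgeAt-elim : ∀ b p u v → edgeAt b p u v ≡ true → inc p u ≡ true × inc p v ≡ true × colour b p u xor colour b p v ≡ true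
  edgeAt-elim b p u v h = let x , y = ∧-true {inc p u} h ; z , w = ∧-true {inc p v} y in x , z , w

  edgeAt-sym : ∀ b p u v → edgeAt b p u v ≡ edgeAt b p v u
  edgeAt-sym b p u v = begin
    inc p u ∧ (inc p v ∧ e)  ≡⟨ ∧-assoc (inc p u) (inc p v) e ⟨
    (inc p u ∧ inc p v) ∧ e  ≡⟨ cong₂ _∧_ (∧-comm (inc p u) (inc p v)) (Bool.xor-comm (colour b p u) (colour b p v)) ⟩
    (inc p v ∧ inc p u) ∧ _  ≡⟨ ∧-assoc (inc p v) (inc p u) _ ⟩
    edgeAt b p v u           ∎
    where
    open ≡-Reasoning
    e : Bool
    e = colour b p u xor colour b p v

  edge : Colouring → Fin N → Fin N → Bool
  edge b u v = does (Fin.any? (λ p → edgeAt b p u v Bool.≟ true))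

  edge-elim : ∀ b u v → edge b u v ≡ true → ∃ λ p → edgeAt b p u v ≡ true
  edge-elim b u v h with Fin.any? (λ p → edgeAt b p u v Bool.≟ true)
  ... | yes p = p

  edge-intro : ∀ b u v p → edgeAt b p u v ≡ true → edge b u v ≡ true
  edge-intro b u v p h = dec-true (Fin.any? (λ p → edgeAt b p u v Bool.≟ true)) (p , h)

  edge-sym : ∀ b u v → edge b u v ≡ edge b v u
  edge-sym b u v = ≡true-ext
    (λ h → let p , e = edge-elim b u v h in edge-intro b v u p (trans (edgeAt-sym b p v u) e))
    (λ h → let p , e = edge-elim b v u h in edge-intro b u v p (trans (edgeAt-sym b p u v) e))

  module _ (a : Fin N → Bool) where

    at : Fin P → Fin N → Bool
    at p l = a l ∧ inc p l

    -- There are `reds * blues` bichromatic pairs at `p` inside `a`, at least the square of the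
    -- minority. A lower bound for minorities is an upper bound for majorities, whose exponential
    -- moment is easy to estimate.
    reds blues minority majority : Fin P → Vec Bool N → ℕ
    reds p r = # (λ l → at p l ∧ lookup r l)
    blues p r = # (λ l → at p l ∧ not (lookup r l))
    minority p r = reds p r ⊓ blues p r
    majority p r = reds p r ⊔ blues p r

    totalMajority : Colouring → ℕ
    totalMajority b = ∑ (allFin P) (λ p → majority p (lookup b p))

    minority+majority : ∀ p r → minority p r + majority p r ≡ # (at p)
    minority+majority p r = trans (⊓+⊔ (reds p r) (blues p r))
      (trans (sym (∑-+ (allFin N) _ _)) (∑-cong (allFin N) (λ l → term (at p l) (lookup r l))))
      where
      ⊓+⊔ : ∀ x y → x ⊓ y + (x ⊔ y) ≡ x + y
      ⊓+⊔ x y with ≤-total x y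
      ... | inj₁ h = cong₂ _+_ (m≤n⇒m⊓n≡m h) (m≤n⇒m⊔n≡n h)
      ... | inj₂ h = trans (cong₂ _+_ (m≥n⇒m⊓n≡n h) (m≥n⇒m⊔n≡m h)) (+-comm y x)
      term : ∀ s t → 𝟙 (s ∧ t) + 𝟙 (s ∧ not t) ≡ 𝟙 s
      term true true   = refl
      term true false  = refl
      term false t     = refl

    private
      -- For random bits, each line of `a` through `p` contributes the mean factor `(2 + 1) / 2` and
      -- every other line the factor one. The hypothesis on `s` says that it accepts exactly one of
      -- the two colours, which covers `reds` and `blues` together.
      weigh : ∀ p (s : Bool → Bool) → (∀ n → n ^ 𝟙 (s true) + n ^ 𝟙 (s false) ≡ n + 1) →
        ∑ (vecs bools N) (λ r → 2 ^ # (λ l → at p l ∧ s (lookup r l))) * 2 ^ # (at p) ≡ 2 ^ N * 3 ^ # (at p)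
      weigh p s hs = begin
        ∑ (vecs bools N) (λ r → 2 ^ # (λ l → at p l ∧ s (lookup r l))) * 2 ^ # (at p)
          ≡⟨ cong (_* 2 ^ # (at p)) (∑-cong (vecs bools N) (λ r → ∏-^ 2 (λ l → 𝟙 (at p l ∧ s (lookup r l))))) ⟨
        ∑ (vecs bools N) (λ r → ∏ (λ l → 2 ^ 𝟙 (at p l ∧ s (lookup r l)))) * 2 ^ # (at p)
          ≡⟨ cong₂ _*_ (∑-vecs-∏ bools N (λ l c → 2 ^ 𝟙 (at p l ∧ s c))) (sym (∏-^ 2 (𝟙 ∘ at p))) ⟩
        ∏ (λ l → ∑ bools (λ c → 2 ^ 𝟙 (at p l ∧ s c))) * ∏ (λ l → 2 ^ 𝟙 (at p l))
          ≡⟨ ∏-* _ (λ l → 2 ^ 𝟙 (at p l)) ⟨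
        ∏ (λ l → ∑ bools (λ c → 2 ^ 𝟙 (at p l ∧ s c)) * 2 ^ 𝟙 (at p l)) ≡⟨ ∏-cong (λ l → term (at p l)) ⟩
        ∏ (λ l → 2 * 3 ^ 𝟙 (at p l)) ≡⟨ ∏-* (λ _ → 2) (λ l → 3 ^ 𝟙 (at p l)) ⟩
        ∏ {N} (λ _ → 2) * ∏ (λ l → 3 ^ 𝟙 (at p l)) ≡⟨ cong₂ _*_ (∏-const N 2) (∏-^ 3 (𝟙 ∘ at p)) ⟩
        2 ^ N * 3 ^ # (at p) ∎
        where
        open ≡-Reasoning
        term : ∀ t → (2 ^ 𝟙 (t ∧ s true) + (2 ^ 𝟙 (t ∧ s false) + 0)) * 2 ^ 𝟙 t ≡ 2 * 3 ^ 𝟙 t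
        term false = refl
        term true rewrite +-identityʳ (2 ^ 𝟙 (s false)) | hs 2 = refl

    -- A power of a maximum is at most the sum of the two powers. This costs a factor two at every
    -- point, and the resulting `2 ^ P` is why only sets of at least about `P / j` lines are
    -- treated.
    majority-moment : ∀ p → ∑ (vecs bools N) (λ r → 2 ^ majority p r) * 2 ^ # (at p) ≤ 2 ^ suc N * 3 ^ # (at p)
    majority-moment p = begin
      ∑ (vecs bools N) (λ r → 2 ^ majority p r) * 2 ^ # (at p)
        ≤⟨ *-monoˡ-≤ (2 ^ # (at p)) (∑-mono (vecs bools N) (λ r → ^-⊔ (reds p r) (blues p r))) ⟩
      ∑ (vecs bools N) (λ r → 2 ^ reds p r + 2 ^ blues p r) * 2 ^ # (at p)
        ≡⟨ trans (cong (_* 2 ^ # (at p)) (∑-+ (vecs bools N) _ _)) (*-distribʳ-+ (2 ^ # (at p)) (∑ (vecs bools N) (λ r → 2 ^ reds p r)) _) ⟩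
      ∑ (vecs bools N) (λ r → 2 ^ reds p r) * 2 ^ # (at p) + ∑ (vecs bools N) (λ r → 2 ^ blues p r) * 2 ^ # (at p)
        ≡⟨ cong₂ _+_ (weigh p id (λ n → cong (_+ 1) (*-identityʳ n))) (weigh p not (λ n → trans (cong (1 +_) (*-identityʳ n)) (+-comm 1 n))) ⟩
      2 ^ N * 3 ^ # (at p) + 2 ^ N * 3 ^ # (at p) ≡⟨ eq (2 ^ N) (3 ^ # (at p)) ⟩
      2 ^ suc N * 3 ^ # (at p) ∎
      where
      open ≤-Reasoning
      eq : ∀ x y → x * y + x * y ≡ 2 * x * y
      eq = solve-∀
      ^-⊔ : ∀ x y → 2 ^ (x ⊔ y) ≤ 2 ^ x + 2 ^ y
      ^-⊔ x y with ⊔-sel x y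
      ... | inj₁ e rewrite e = m≤m+n _ _
      ... | inj₂ e rewrite e = m≤n+m _ _

    totalMajority-moment :
      ∑ (vecs (vecs bools N) P) (λ b → 2 ^ totalMajority b) * 2 ^ ∑ (allFin P) (# ∘ at) ≤
      2 ^ (suc N * P) * 3 ^ ∑ (allFin P) (# ∘ at)
    totalMajority-moment = begin
      ∑ (vecs (vecs bools N) P) (λ b → 2 ^ totalMajority b) * 2 ^ ∑ (allFin P) (# ∘ at)
        ≡⟨ cong₂ _*_ (trans (∑-cong (vecs (vecs bools N) P) (λ b → sym (∏-^ 2 (λ p → majority p (lookup b p)))))
             (∑-vecs-∏ (vecs bools N) P (λ p r → 2 ^ majority p r))) (sym (∏-^ 2 (# ∘ at))) ⟩
      ∏ (λ p → ∑ (vecs bools N) (λ r → 2 ^ majority p r)) * ∏ (λ p → 2 ^ # (at p)) ≡⟨ ∏-* _ (λ p → 2 ^ # (at p)) ⟨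
      ∏ (λ p → ∑ (vecs bools N) (λ r → 2 ^ majority p r) * 2 ^ # (at p)) ≤⟨ ∏-mono majority-moment ⟩
      ∏ (λ p → 2 ^ suc N * 3 ^ # (at p)) ≡⟨ ∏-* {P} (λ _ → 2 ^ suc N) (λ p → 3 ^ # (at p)) ⟩
      ∏ {P} (λ _ → 2 ^ suc N) * ∏ (λ p → 3 ^ # (at p))
        ≡⟨ cong₂ _*_ (trans (∏-const P (2 ^ suc N)) (^-*-assoc 2 (suc N) P)) (∏-^ 3 (# ∘ at)) ⟩
      2 ^ (suc N * P) * 3 ^ ∑ (allFin P) (# ∘ at) ∎
      where open ≤-Reasoning

  module _ (j : ℕ) (degree : ∀ l → # (λ p → inc p l) ≡ 8 * j) where

    incidences : ∀ a → ∑ (allFin P) (# ∘ at a) ≡ 8 * j * # a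
    incidences a = begin
      ∑ (allFin P) (# ∘ at a) ≡⟨ ∑-comm (allFin P) (allFin N) (λ p l → 𝟙 (at a p l)) ⟩
      ∑ (allFin N) (λ l → # (λ p → a l ∧ inc p l))
        ≡⟨ ∑-cong (allFin N) (λ l → trans (∑-cong (allFin P) (λ p → 𝟙-∧ (a l) (inc p l))) (∑-*ˡ (allFin P) (𝟙 (a l)) _)) ⟩
      ∑ (allFin N) (λ l → 𝟙 (a l) * # (λ p → inc p l)) ≡⟨ ∑-cong (allFin N) (λ l → cong (𝟙 (a l) *_) (degree l)) ⟩
      ∑ (allFin N) (λ l → 𝟙 (a l) * (8 * j)) ≡⟨ trans (∑-*ʳ (allFin N) (8 * j) _) (*-comm (# a) (8 * j)) ⟩
      8 * j * # a ∎
      where open ≡-Reasoning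

    -- There are `8 * j * # a` incidences in all, so here at least seven eighths of them lie on
    -- majority sides. In a balanced set more than `j * # a` lie on minority sides.
    unbalanced : (Fin N → Bool) → Colouring → Bool
    unbalanced a b = 7 * (j * # a) ≤ᵇ totalMajority a b

    -- Markov's inequality; 3⁸ ≤ 2¹³ makes the Chernoff bound effective.
    count-unbalanced : ∀ a → ∑ (vecs (vecs bools N) P) (𝟙 ∘ unbalanced a) * 2 ^ (2 * (j * # a)) ≤ 2 ^ (N * P) * 2 ^ P
    count-unbalanced a = *-cancelʳ-≤ _ _ (2 ^ (13 * y)) {{m^n≢0 2 (13 * y)}} (begin
      U * 2 ^ (2 * y) * 2 ^ (13 * y)        ≡⟨ *-assoc U _ _ ⟩
      U * (2 ^ (2 * y) * 2 ^ (13 * y))      ≡⟨ cong (U *_) (trans (sym (^-distribˡ-+-* 2 (2 * y) (13 * y)))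
                                                 (trans (cong (2 ^_) (e₁ y)) (^-distribˡ-+-* 2 (7 * y) (8 * y)))) ⟩
      U * (2 ^ (7 * y) * 2 ^ (8 * y))       ≡⟨ *-assoc U _ _ ⟨
      U * 2 ^ (7 * y) * 2 ^ (8 * y)         ≤⟨ *-monoˡ-≤ (2 ^ (8 * y)) markov ⟩
      M * 2 ^ (8 * y)                       ≡⟨ cong (λ z → M * 2 ^ z) A≡8y ⟨
      M * 2 ^ ∑ (allFin P) (# ∘ at a)       ≤⟨ totalMajority-moment a ⟩
      2 ^ (suc N * P) * 3 ^ ∑ (allFin P) (# ∘ at a) ≡⟨ cong₂ _*_ (trans (cong (2 ^_) (+-comm P (N * P))) (^-distribˡ-+-* 2 (N * P) P)) (cong (3 ^_) A≡8y) ⟩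
      2 ^ (N * P) * 2 ^ P * 3 ^ (8 * y)     ≡⟨ cong (2 ^ (N * P) * 2 ^ P *_) (^-*-assoc 3 8 y) ⟨
      2 ^ (N * P) * 2 ^ P * (3 ^ 8) ^ y     ≤⟨ *-monoʳ-≤ (2 ^ (N * P) * 2 ^ P) (^-monoˡ-≤ y (≤ᵇ⇒≤ (3 ^ 8) (2 ^ 13) tt)) ⟩
      2 ^ (N * P) * 2 ^ P * (2 ^ 13) ^ y    ≡⟨ cong (2 ^ (N * P) * 2 ^ P *_) (^-*-assoc 2 13 y) ⟩
      2 ^ (N * P) * 2 ^ P * 2 ^ (13 * y)    ∎)
      where
      open ≤-Reasoning
      B : List Colouring
      B = vecs (vecs bools N) P
      y U M : ℕ
      y = j * # a
      U = ∑ B (𝟙 ∘ unbalanced a)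
      M = ∑ B (λ b → 2 ^ totalMajority a b)
      A≡8y : ∑ (allFin P) (# ∘ at a) ≡ 8 * y
      A≡8y = trans (incidences a) (*-assoc 8 j (# a))
      e₁ : ∀ y → 2 * y + 13 * y ≡ 7 * y + 8 * y
      e₁ = solve-∀
      markov : U * 2 ^ (7 * y) ≤ M
      markov = ≤-trans (≤-reflexive (sym (∑-*ʳ B (2 ^ (7 * y)) _))) (∑-mono B term)
        where
        term : ∀ b → 𝟙 (unbalanced a b) * 2 ^ (7 * y) ≤ 2 ^ totalMajority a b
        term b with 7 * (j * # a) ≤ᵇ totalMajority a b in e
        ... | false = z≤n
        ... | true  = ≤-trans (≤-reflexive (*-identityˡ _)) (^-monoʳ-≤ 2 (≤ᵇ⇒≤ (7 * (j * # a)) (totalMajority a b) (subst T (sym e) tt)))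

    -- The union bound over all large sets of lines, each set X being weighted by 2^(-j|X|).
    balanced-colouring : ∀ r → .{{NonZero r}} → P ≤ j * r → 2 * N < 2 ^ j →
      ∃ λ b → ∀ a → r ≤ # a → totalMajority a b < 7 * (j * # a)
    balanced-colouring r@(suc _) P≤jr 2N<2^j =
      let b , h = ∑-<⇒∃< B total in b , λ a r≤#a → ≰⇒> λ le →
        -- The union bound enumerates vectors, so the function `a` is replaced by the vector of its
        -- values and all counts are transported pointwise.
        let X = Vec.tabulate a
            X≗a = Vec.lookup∘tabulate a
            #X≡#a = ∑-cong (allFin N) (λ l → cong 𝟙 (X≗a l))
            tm≡ = ∑-cong (allFin P) (λ p → cong₂ _⊔_
              (∑-cong (allFin N) (λ l → cong (λ c → 𝟙 ((c ∧ inc p l) ∧ lookup (lookup b p) l)) (X≗a l)))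
              (∑-cong (allFin N) (λ l → cong (λ c → 𝟙 ((c ∧ inc p l) ∧ not (lookup (lookup b p) l))) (X≗a l))))
        in 1+n≰n (begin
          1 ≡⟨ cong₂ (λ c d → 𝟙 c * 𝟙 d)
                 (Tᵇ (≤⇒≤ᵇ (subst (r ≤_) (sym #X≡#a) r≤#a)))
                 (Tᵇ (≤⇒≤ᵇ (subst₂ _≤_ (cong (λ z → 7 * (j * z)) (sym #X≡#a)) (sym tm≡) le))) ⟨
          bad X b ≤⟨ ∑-bools-term (λ X → bad X b) X ⟩
          ∑ (vecs bools N) (λ X → bad X b) ≤⟨ s≤s⁻¹ h ⟩
          0 ∎)
      where
      open ≤-Reasoning
      y : ℕ
      y = 2 ^ j
      instance
        _ : NonZero y
        _ = m^n≢0 2 j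
      B : List Colouring
      B = vecs (vecs bools N) P
      size : Vec Bool N → ℕ
      size X = # (lookup X)
      large : Vec Bool N → Bool
      large X = r ≤ᵇ size X
      bad : Vec Bool N → Colouring → ℕ
      bad X b = 𝟙 (large X) * 𝟙 (unbalanced (lookup X) b)
      -- This is `y ^ (N - size X)`: the weight `1 / y ^ size X`, with `y = 2 ^ j`, multiplied by
      -- the common denominator `y ^ N`.
      weight : Vec Bool N → ℕ
      weight X = ∏ (λ l → if lookup X l then 1 else y)

      weight-size : ∀ X → y ^ size X * weight X ≡ y ^ N
      weight-size X = trans (cong (_* weight X) (sym (∏-^ y (𝟙 ∘ lookup X))))
        (trans (sym (∏-* (λ l → y ^ 𝟙 (lookup X l)) (λ l → if lookup X l then 1 else y))) (trans (∏-cong (λ l → term (lookup X l))) (∏-const N y)))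
        where
        term : ∀ c → y ^ 𝟙 c * (if c then 1 else y) ≡ y
        term true  = trans (*-identityʳ (y * 1)) (*-identityʳ y)
        term false = *-identityˡ y

      ∑-weight : ∑ (vecs bools N) weight ≡ suc y ^ N
      ∑-weight = trans (∑-vecs-∏ bools N (λ _ c → if c then 1 else y))
        (trans (∏-cong {N} (λ _ → cong suc (+-identityʳ y))) (∏-const N (suc y)))

      count-bad : ∀ X → ∑ B (bad X) * y ^ N ≤ 2 ^ (N * P) * (𝟙 (large X) * weight X)
      count-bad X rewrite ∑-*ˡ B (𝟙 (large X)) (𝟙 ∘ unbalanced (lookup X)) with r ≤ᵇ size X in e
      ... | false = z≤n
      ... | true  = begin
        1 * U * y ^ N ≡⟨ cong₂ _*_ (*-identityˡ U) (sym (weight-size X)) ⟩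
        U * (y ^ size X * weight X) ≡⟨ *-assoc U (y ^ size X) (weight X) ⟨
        U * y ^ size X * weight X ≤⟨ *-monoˡ-≤ (weight X) (*-cancelʳ-≤ (U * y ^ size X) (2 ^ (N * P)) (2 ^ z) {{m^n≢0 2 z}} (begin
            U * y ^ size X * 2 ^ z ≡⟨ trans (*-assoc U _ _) (cong (λ w → U * (w * 2 ^ z)) (^-*-assoc 2 j (size X))) ⟩
            U * (2 ^ z * 2 ^ z) ≡⟨ cong (U *_) (trans (sym (^-distribˡ-+-* 2 z z)) (cong (λ w → 2 ^ (z + w)) (sym (+-identityʳ z)))) ⟩
            U * 2 ^ (2 * z) ≤⟨ count-unbalanced (lookup X) ⟩
            -- The saving `2 ^ (2 * z)` is shared: one half pays for `2 ^ P`, since `P ≤ j * r ≤ z`,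
            -- and the other half becomes the weight of `X`.
            2 ^ (N * P) * 2 ^ P ≤⟨ *-monoʳ-≤ (2 ^ (N * P)) (^-monoʳ-≤ 2 (≤-trans P≤jr (*-monoʳ-≤ j (≤ᵇ⇒≤ r (size X) (subst T (sym e) tt))))) ⟩
            2 ^ (N * P) * 2 ^ z ∎)) ⟩
        2 ^ (N * P) * weight X ≡⟨ cong (2 ^ (N * P) *_) (*-identityˡ (weight X)) ⟨
        2 ^ (N * P) * (1 * weight X) ∎
        where
        z U : ℕ
        z = j * size X
        U = ∑ B (𝟙 ∘ unbalanced (lookup X))

      ∅ : Vec Bool N
      ∅ = Vec.replicate N false

      size-∅ : size ∅ ≡ 0
      size-∅ = #-none {a = lookup ∅} (λ l → Vec.lookup-replicate l false)

      weight-∅ : weight ∅ ≡ y ^ N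
      weight-∅ = trans (sym (*-identityˡ (weight ∅))) (trans (cong (λ k → y ^ k * weight ∅) (sym size-∅)) (weight-size ∅))

      -- The empty set alone has weight `y ^ N` and is not large, `r` being nonzero, while all sets
      -- together have weight `suc y ^ N`, less than twice as much.
      large-weight : ∑ (vecs bools N) (λ X → 𝟙 (large X) * weight X) < y ^ N
      large-weight = +-cancelʳ-< (y ^ N) _ _ (begin-strict
        ∑ (vecs bools N) (λ X → 𝟙 (large X) * weight X) + y ^ N
          ≤⟨ +-monoʳ-≤ _ (≤-trans (≤-reflexive small-∅) (∑-bools-term (λ X → 𝟙 (not (large X)) * weight X) ∅)) ⟩
        ∑ (vecs bools N) (λ X → 𝟙 (large X) * weight X) + ∑ (vecs bools N) (λ X → 𝟙 (not (large X)) * weight X)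
          ≡⟨ trans (sym (∑-+ (vecs bools N) _ _)) (∑-cong (vecs bools N) (λ X → split (large X) (weight X))) ⟩
        ∑ (vecs bools N) weight ≡⟨ ∑-weight ⟩
        suc y ^ N <⟨ suc^<2*^ {y} {N} 2N<2^j ⟩
        2 * y ^ N ≡⟨ cong (y ^ N +_) (+-identityʳ (y ^ N)) ⟩
        y ^ N + y ^ N ∎)
        where
        split : ∀ c w → 𝟙 c * w + 𝟙 (not c) * w ≡ w
        split true w  = trans (+-identityʳ (1 * w)) (*-identityˡ w)
        split false w = *-identityˡ w
        small-∅ : y ^ N ≡ 𝟙 (not (large ∅)) * weight ∅
        small-∅ = sym (trans (cong₂ (λ k w → 𝟙 (not (r ≤ᵇ k)) * w) size-∅ weight-∅) (*-identityˡ (y ^ N)))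

      total : ∑ B (λ b → ∑ (vecs bools N) (λ X → bad X b)) < ∑ B (λ _ → 1)
      total = *-cancelʳ-< (y ^ N) _ _ (begin-strict
        ∑ B (λ b → ∑ (vecs bools N) (λ X → bad X b)) * y ^ N ≡⟨ cong (_* y ^ N) (∑-comm B (vecs bools N) (λ b X → bad X b)) ⟩
        ∑ (vecs bools N) (λ X → ∑ B (bad X)) * y ^ N ≡⟨ ∑-*ʳ (vecs bools N) (y ^ N) _ ⟨
        ∑ (vecs bools N) (λ X → ∑ B (bad X) * y ^ N) ≤⟨ ∑-mono (vecs bools N) count-bad ⟩
        ∑ (vecs bools N) (λ X → 2 ^ (N * P) * (𝟙 (large X) * weight X)) ≡⟨ ∑-*ˡ (vecs bools N) (2 ^ (N * P)) _ ⟩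
        2 ^ (N * P) * ∑ (vecs bools N) (λ X → 𝟙 (large X) * weight X) <⟨ *-monoʳ-< (2 ^ (N * P)) {{m^n≢0 2 (N * P)}} large-weight ⟩
        2 ^ (N * P) * y ^ N ≡⟨ cong (_* y ^ N) (trans (trans (sym (^-*-assoc 2 N P)) (cong (_^ P) (sym (length-vecs bools N)))) (trans (sym (length-vecs (vecs bools N) P)) (length-∑ B))) ⟩
        ∑ B (λ _ → 1) * y ^ N ∎)

    module _ (linear : ∀ p p′ l l′ → inc p l ≡ true → inc p l′ ≡ true → inc p′ l ≡ true → inc p′ l′ ≡ true → l ≢ l′ → p ≡ p′) where

      -- A red and a blue line through the same point are adjacent. Two distinct lines share at most
      -- one point, so no pair is counted at two points; a pair is counted with its red line first
      -- only, at the loss of a factor two.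
      degree-sum : ∀ a b → ∑ (allFin P) (λ p → reds a p (lookup b p) * blues a p (lookup b p)) ≤
        ∑ (allFin N) (λ v → 𝟙 (a v) * # (a ∩ edge b v))
      degree-sum a b = begin
        ∑ (allFin P) (λ p → reds a p (lookup b p) * blues a p (lookup b p))
          ≡⟨ ∑-cong (allFin P) (λ p → ∑-*-∑ (allFin N) (allFin N) _ _) ⟩
        ∑ (allFin P) (λ p → ∑ (allFin N) (λ v → ∑ (allFin N) (λ u →
          𝟙 (at a p v ∧ colour b p v) * 𝟙 (at a p u ∧ not (colour b p u)))))
          ≤⟨ ∑-mono (allFin P) (λ p → ∑-mono (allFin N) (λ v → ∑-mono (allFin N) (λ u →
               term (a v) (a u) (inc p v) (inc p u) (colour b p v) (colour b p u)))) ⟩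
        ∑ (allFin P) (λ p → ∑ (allFin N) (λ v → ∑ (allFin N) (λ u → 𝟙 (a v) * (𝟙 (a u) * 𝟙 (edgeAt b p v u)))))
          ≡⟨ trans (∑-comm (allFin P) (allFin N) _) (∑-cong (allFin N) (λ v → ∑-comm (allFin P) (allFin N) _)) ⟩
        ∑ (allFin N) (λ v → ∑ (allFin N) (λ u → ∑ (allFin P) (λ p → 𝟙 (a v) * (𝟙 (a u) * 𝟙 (edgeAt b p v u)))))
          ≡⟨ ∑-cong (allFin N) (λ v → trans (∑-cong (allFin N) (λ u → trans (∑-*ˡ (allFin P) (𝟙 (a v)) _) (cong (𝟙 (a v) *_) (∑-*ˡ (allFin P) (𝟙 (a u)) _))))
               (∑-*ˡ (allFin N) (𝟙 (a v)) _)) ⟩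
        ∑ (allFin N) (λ v → 𝟙 (a v) * ∑ (allFin N) (λ u → 𝟙 (a u) * # (λ p → edgeAt b p v u)))
          ≤⟨ ∑-mono (allFin N) (λ v → *-monoʳ-≤ (𝟙 (a v)) (∑-mono (allFin N) (λ u →
               ≤-trans (*-monoʳ-≤ (𝟙 (a u)) (meet v u)) (≤-reflexive (sym (𝟙-∧ (a u) (edge b v u))))))) ⟩
        ∑ (allFin N) (λ v → 𝟙 (a v) * # (a ∩ edge b v)) ∎
        where
        open ≤-Reasoning
        term : ∀ av au iv iu cv cu → 𝟙 ((av ∧ iv) ∧ cv) * 𝟙 ((au ∧ iu) ∧ not cu) ≤ 𝟙 av * (𝟙 au * 𝟙 (iv ∧ (iu ∧ (cv xor cu))))
        term true true true true true true     = z≤n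
        term true true true true true false    = ≤-refl
        term true true true true false cu      = z≤n
        term true true true false cv cu        = ≤-trans (≤-reflexive (*-zeroʳ (𝟙 cv))) z≤n
        term true true false iu cv cu          = z≤n
        term true false iv iu cv cu            = ≤-trans (≤-reflexive (*-zeroʳ (𝟙 (iv ∧ cv)))) z≤n
        term false au iv iu cv cu              = z≤n
        meet : ∀ v u → # (λ p → edgeAt b p v u) ≤ 𝟙 (edge b v u)
        meet v u with edge b v u in e
        ... | true  = #≤1 _ (λ p p′ h h′ → let x , y , z = edgeAt-elim b p v u h ; x′ , y′ , z′ = edgeAt-elim b p′ v u h′ in
          linear p p′ v u x y x′ y′ λ { refl → case trans (sym z) (Bool.xor-same (colour b p v)) of λ () })
        ... | false = ≤-reflexive (#-none λ p → case edgeAt b p v u Bool.≟ true of λ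
          { (yes h) → case trans (sym e) (edge-intro b v u p h) of λ () ; (no ¬h) → Bool.¬-not ¬h })

      -- More than `j * # a` incidences lie on minority sides. By Cauchy-Schwarz over the `P` points
      -- the degrees inside `a` sum to more than `(j * # a)² / P`, so some vertex of `a` is adjacent
      -- to at least the fraction `j² / P ≥ 1 / suc β` of `a`.
      balanced⇒dense : ∀ a b β → .{{NonZero j}} → P ≤ suc β * (j * j) → totalMajority a b < 7 * (j * # a) →
        ∃ λ v → a v ≡ true × # (a ∩ (λ u → not (edge b v u))) * suc β ≤ # a * β
      balanced⇒dense a b β P≤ balanced = v , av , +-cancelʳ-≤ (x) _ _ (begin
        # (a ∩ (λ u → not (edge b v u))) * suc β + x ≤⟨ +-monoʳ-≤ _ x≤deg ⟩
        # (a ∩ (λ u → not (edge b v u))) * suc β + deg v * suc β ≡⟨ *-distribʳ-+ (suc β) (# (a ∩ (λ u → not (edge b v u)))) (deg v) ⟨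
        (# (a ∩ (λ u → not (edge b v u))) + deg v) * suc β ≡⟨ cong (_* suc β) parts ⟩
        x * suc β ≡⟨ *-suc x β ⟩
        x + x * β ≡⟨ +-comm x (x * β) ⟩
        x * β + x ∎)
        where
        open ≤-Reasoning
        x : ℕ
        x = # a
        deg : Fin N → ℕ
        deg v = # (a ∩ edge b v)
        μ : Fin P → ℕ
        μ p = minority a p (lookup b p)
        μ-large : j * x < ∑ (allFin P) μ
        μ-large = +-cancelʳ-< (totalMajority a b) _ _ (begin-strict
          j * x + totalMajority a b <⟨ +-monoʳ-< (j * x) balanced ⟩
          j * x + 7 * (j * x) ≡⟨ *-assoc 8 j x ⟨
          8 * j * x ≡⟨ incidences a ⟨
          ∑ (allFin P) (# ∘ at a) ≡⟨ ∑-cong (allFin P) (λ p → minority+majority a p (lookup b p)) ⟨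
          ∑ (allFin P) (λ p → μ p + majority a p (lookup b p)) ≡⟨ ∑-+ (allFin P) μ _ ⟩
          ∑ (allFin P) μ + totalMajority a b ∎)
        degrees : ∑ (allFin N) (λ v → 𝟙 (a v) * (j * j * x)) < ∑ (allFin N) (λ v → 𝟙 (a v) * (P * deg v))
        degrees = begin-strict
          ∑ (allFin N) (λ v → 𝟙 (a v) * (j * j * x)) ≡⟨ ∑-*ʳ (allFin N) (j * j * x) _ ⟩
          x * (j * j * x) ≡⟨ eq x j ⟩
          (j * x) * (j * x) <⟨ *-mono-< μ-large μ-large ⟩
          ∑ (allFin P) μ * ∑ (allFin P) μ ≤⟨ ∑²≤*∑ μ ⟩
          P * ∑ (allFin P) (λ p → μ p * μ p) ≤⟨ *-monoʳ-≤ P (∑-mono (allFin P) (λ p → *-mono-≤ (m⊓n≤m (reds a p (lookup b p)) (blues a p (lookup b p))) (m⊓n≤n (reds a p (lookup b p)) (blues a p (lookup b p))))) ⟩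
          P * ∑ (allFin P) (λ p → reds a p (lookup b p) * blues a p (lookup b p)) ≤⟨ *-monoʳ-≤ P (degree-sum a b) ⟩
          P * ∑ (allFin N) (λ v → 𝟙 (a v) * deg v) ≡⟨ ∑-*ˡ (allFin N) P _ ⟨
          ∑ (allFin N) (λ v → P * (𝟙 (a v) * deg v)) ≡⟨ ∑-cong (allFin N) (λ v → eq′ P (𝟙 (a v)) (deg v)) ⟩
          ∑ (allFin N) (λ v → 𝟙 (a v) * (P * deg v)) ∎
          where
          eq : ∀ x j → x * (j * j * x) ≡ (j * x) * (j * x)
          eq = solve-∀
          eq′ : ∀ p a d → p * (a * d) ≡ a * (p * d)
          eq′ = solve-∀
        vertex : ∃ λ v → 𝟙 (a v) * (j * j * x) < 𝟙 (a v) * (P * deg v)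
        vertex = ∑-<⇒∃< (allFin N) degrees
        v : Fin N
        v = proj₁ vertex
        av : a v ≡ true
        av = positive (a v) (proj₂ vertex)
          where
          positive : ∀ c {m n} → 𝟙 c * m < 𝟙 c * n → c ≡ true
          positive true _ = refl
        many : j * j * x ≤ P * deg v
        many = <⇒≤ (*-cancelˡ-< 1 _ _ (subst (λ c → 𝟙 c * (j * j * x) < 𝟙 c * (P * deg v)) av (proj₂ vertex)))
        x≤deg : x ≤ deg v * suc β
        x≤deg = *-cancelˡ-≤ (j * j) {{m*n≢0 j j}} (begin
          j * j * x ≤⟨ many ⟩
          P * deg v ≤⟨ *-monoˡ-≤ (deg v) P≤ ⟩
          suc β * (j * j) * deg v ≡⟨ eq (suc β) (j * j) (deg v) ⟩
          j * j * (deg v * suc β) ∎)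
          where
          eq : ∀ b j d → b * j * d ≡ j * (d * b)
          eq = solve-∀
        parts : # (a ∩ (λ u → not (edge b v u))) + deg v ≡ x
        parts = trans (sym (∑-+ (allFin N) _ _)) (∑-cong (allFin N) (λ u → term (a u) (edge b v u)))
          where
          term : ∀ c d → 𝟙 (c ∧ not d) + 𝟙 (c ∧ d) ≡ 𝟙 c
          term true true   = refl
          term true false  = refl
          term false d     = refl

-- Hermitian unitals

-- The properties of the field with `q²` elements on which O'Nan's theorem rests. Nothing is
-- divided: `≈-stable` turns the absence of zero divisors into cancellation. `fromℤ` supplies
-- integer coefficients to the ring solver.
record ConjugationDomain : Set₁ where
  field
    ring : CommutativeRing 0ℓ 0ℓ
    fromℤ : ℤ.+-*-rawRing -Raw-AlmostCommutative⟶ fromCommutativeRing ring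
  open CommutativeRing ring public
    using (_≈_; setoid)
    renaming (Carrier to E; _+_ to _⊕_; _*_ to _⊗_; -_ to ⊖_; _-_ to _⊝_;
              refl to ≈-refl; sym to ≈-sym; trans to ≈-trans;
              +-cong to ⊕-cong; *-cong to ⊗-cong; -‿cong to ⊖-cong)
  open _-Raw-AlmostCommutative⟶_ fromℤ public using () renaming (⟦_⟧ to scalar)
  O : E
  O = scalar ℤ.0ℤ
  two : E
  two = scalar (ℤ.+ 2)
  field
    conj : E → E
    conj-cong : ∀ {x y} → x ≈ y → conj x ≈ conj y
    conj-⊕ : ∀ x y → conj (x ⊕ y) ≈ conj x ⊕ conj y
    conj-⊗ : ∀ x y → conj (x ⊗ y) ≈ conj x ⊗ conj y
    conj-⊖ : ∀ x → conj (⊖ x) ≈ ⊖ conj x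
    conj-involutive : ∀ x → conj (conj x) ≈ x
    ⊗-≉O : ∀ {x y} → ¬ x ≈ O → ¬ y ≈ O → ¬ x ⊗ y ≈ O
    two≉O : ¬ two ≈ O
    ≈-stable : ∀ {x y} → ¬ ¬ x ≈ y → x ≈ y

module HermitianPlane (F : ConjugationDomain) where
  open import Data.Integer using (+_)
  open ConjugationDomain F

  private
    scalar-≟ : ∀ a b → Maybe (scalar a ≈ scalar b)
    scalar-≟ a b with a ℤ.≟ b
    ... | yes refl = just ≈-refl
    ... | no _ = nothing

  open Algebra.Solver.Ring ℤ.+-*-rawRing (fromCommutativeRing ring) fromℤ scalar-≟
    using (solve; _:=_; _:+_; _:*_; _:-_; :-_; con)

  open Relation.Binary.Reasoning.Setoid setoid

  private
    ⊗-congˡ : ∀ {x y z} → y ≈ z → x ⊗ y ≈ x ⊗ z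
    ⊗-congˡ = ⊗-cong ≈-refl

    ⊗-congʳ : ∀ {x y z} → y ≈ z → y ⊗ x ≈ z ⊗ x
    ⊗-congʳ e = ⊗-cong e ≈-refl

    ⊝-cong : ∀ {x y u v} → x ≈ y → u ≈ v → x ⊝ u ≈ y ⊝ v
    ⊝-cong e f = ⊕-cong e (⊖-cong f)

  ⊝≈O⇒≈ : ∀ {x y} → x ⊝ y ≈ O → x ≈ y
  ⊝≈O⇒≈ {x} {y} e = begin
    x           ≈⟨ solve 2 (λ x y → x := y :+ (x :- y)) ≈-refl x y ⟩
    y ⊕ (x ⊝ y) ≈⟨ ⊕-cong ≈-refl e ⟩
    y ⊕ O       ≈⟨ solve 1 (λ y → y :+ con ℤ.0ℤ := y) ≈-refl y ⟩
    y           ∎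

  ≈⇒⊝≈O : ∀ {x y} → x ≈ y → x ⊝ y ≈ O
  ≈⇒⊝≈O {x} {y} e = begin
    x ⊝ y ≈⟨ ⊝-cong e ≈-refl ⟩
    y ⊝ y ≈⟨ solve 1 (λ y → y :- y := con ℤ.0ℤ) ≈-refl y ⟩
    O     ∎

  ⊗-≈O : ∀ {x y} → y ≈ O → x ⊗ y ≈ O
  ⊗-≈O {x} e = ≈-trans (⊗-congˡ e) (solve 1 (λ x → x :* con ℤ.0ℤ := con ℤ.0ℤ) ≈-refl x)

  ≉⇒⊝≉O : ∀ {x y} → ¬ x ≈ y → ¬ x ⊝ y ≈ O
  ≉⇒⊝≉O x≉y e = x≉y (⊝≈O⇒≈ e)

  ⊗-cancel-O : ∀ {x y} → ¬ x ≈ O → x ⊗ y ≈ O → y ≈ O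
  ⊗-cancel-O x≉O xy≈O = ≈-stable (λ y≉O → ⊗-≉O x≉O y≉O xy≈O)

  ⊗-cancelˡ : ∀ {x y z} → ¬ x ≈ O → x ⊗ y ≈ x ⊗ z → y ≈ z
  ⊗-cancelˡ {x} {y} {z} x≉O e = ⊝≈O⇒≈ (⊗-cancel-O x≉O (begin
    x ⊗ (y ⊝ z)   ≈⟨ solve 3 (λ x y z → x :* (y :- z) := x :* y :- x :* z) ≈-refl x y z ⟩
    x ⊗ y ⊝ x ⊗ z ≈⟨ ≈⇒⊝≈O e ⟩
    O ∎))

  conj-⊝ : ∀ x y → conj (x ⊝ y) ≈ conj x ⊝ conj y
  conj-⊝ x y = ≈-trans (conj-⊕ x (⊖ y)) (⊕-cong ≈-refl (conj-⊖ y))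

  conj-O : conj O ≈ O
  conj-O = begin
    conj O       ≈⟨ conj-cong (≈-sym (≈⇒⊝≈O ≈-refl)) ⟩
    conj (O ⊝ O) ≈⟨ conj-⊝ O O ⟩
    conj O ⊝ conj O ≈⟨ ≈⇒⊝≈O ≈-refl ⟩
    O ∎

  conj-≉O : ∀ {x} → ¬ x ≈ O → ¬ conj x ≈ O
  conj-≉O {x} x≉O e = x≉O (begin
    x             ≈⟨ conj-involutive x ⟨
    conj (conj x) ≈⟨ conj-cong e ⟩
    conj O        ≈⟨ conj-O ⟩
    O             ∎)

  -- The point (x : y : 1), isotropic for the Hermitian form h below.
  record Point : Set where
    constructor point
    field
      x y : E
      isotropic : y ⊕ conj y ≈ two ⊗ (x ⊗ conj x)
  open Point

  -- Vertical lines are left out. Every line then has a slope, and lines through a common point are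
  -- told apart by their slopes.
  record Line : Set where
    constructor line
    field slope intercept : E
  open Line

  infix 4 _on_
  _on_ : Point → Line → Set
  P on l = y P ≈ slope l ⊗ x P ⊕ intercept l

  h : Point → Point → E
  h P Q = two ⊗ (x P ⊗ conj (x Q)) ⊝ (y P ⊕ conj (y Q))

  two-points⇒slope≈ : ∀ {P Q l l′} → P on l → Q on l → P on l′ → Q on l′ →
    ¬ x P ≈ x Q → slope l ≈ slope l′
  two-points⇒slope≈ {P} {Q} {l} {l′} p q p′ q′ P≉Q = ⊗-cancelˡ (≉⇒⊝≉O P≉Q) (begin
    (x P ⊝ x Q) ⊗ slope l  ≈⟨ eq (x P) (x Q) (slope l) (intercept l) ⟩
    (slope l ⊗ x P ⊕ intercept l) ⊝ (slope l ⊗ x Q ⊕ intercept l) ≈⟨ ⊝-cong p q ⟨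
    y P ⊝ y Q ≈⟨ ⊝-cong p′ q′ ⟩
    (slope l′ ⊗ x P ⊕ intercept l′) ⊝ (slope l′ ⊗ x Q ⊕ intercept l′) ≈⟨ eq (x P) (x Q) (slope l′) (intercept l′) ⟨
    (x P ⊝ x Q) ⊗ slope l′ ∎)
    where
    eq : ∀ a b m c → (a ⊝ b) ⊗ m ≈ (m ⊗ a ⊕ c) ⊝ (m ⊗ b ⊕ c)
    eq = solve 4 (λ a b m c → (a :- b) :* m := (m :* a :+ c) :- (m :* b :+ c)) ≈-refl

  same-slope⇒intercept≈ : ∀ {P l l′} → P on l → P on l′ → slope l ≈ slope l′ →
    intercept l ≈ intercept l′
  same-slope⇒intercept≈ {P} {l} {l′} p p′ e = begin
    intercept l                ≈⟨ eq (slope l ⊗ x P) (intercept l) ⟩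
    slope l ⊗ x P ⊕ intercept l ⊝ slope l ⊗ x P    ≈⟨ ⊝-cong (≈-trans (≈-sym p) p′) (⊗-congʳ e) ⟩
    slope l′ ⊗ x P ⊕ intercept l′ ⊝ slope l′ ⊗ x P ≈⟨ eq (slope l′ ⊗ x P) (intercept l′) ⟨
    intercept l′ ∎
    where
    eq : ∀ a c → c ≈ a ⊕ c ⊝ a
    eq = solve 2 (λ a c → c := a :+ c :- a) ≈-refl

  h-isotropic : ∀ P → h P P ≈ O
  h-isotropic P = ≈⇒⊝≈O (≈-sym (isotropic P))

  conj-two : conj two ≈ two
  conj-two = begin
    conj two ≈⟨ conj-cong two≈ ⟩
    conj (one ⊕ one) ≈⟨ conj-⊕ one one ⟩
    conj one ⊕ conj one ≈⟨ ⊕-cong conj-one conj-one ⟩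
    one ⊕ one ≈⟨ two≈ ⟨
    two ∎
    where
    one : E
    one = CommutativeRing.1# ring
    two≈ : two ≈ one ⊕ one
    two≈ = ≈-trans (_-Raw-AlmostCommutative⟶_.+-homo fromℤ ℤ.1ℤ ℤ.1ℤ)
      (⊕-cong (_-Raw-AlmostCommutative⟶_.1-homo fromℤ) (_-Raw-AlmostCommutative⟶_.1-homo fromℤ))
    conj-one : conj one ≈ one
    conj-one = begin
      conj one ≈⟨ CommutativeRing.*-identityʳ ring (conj one) ⟨
      conj one ⊗ one ≈⟨ ⊗-congˡ (conj-involutive one) ⟨
      conj one ⊗ conj (conj one) ≈⟨ conj-⊗ one (conj one) ⟨
      conj (one ⊗ conj one) ≈⟨ conj-cong (CommutativeRing.*-identityˡ ring (conj one)) ⟩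
      conj (conj one) ≈⟨ conj-involutive one ⟩
      one ∎

  conj-h : ∀ P Q → conj (h P Q) ≈ h Q P
  conj-h P Q = begin
    conj (h P Q) ≈⟨ conj-⊝ _ _ ⟩
    conj (two ⊗ (x P ⊗ conj (x Q))) ⊝ conj (y P ⊕ conj (y Q))
      ≈⟨ ⊝-cong (≈-trans (conj-⊗ _ _) (⊗-cong conj-two (≈-trans (conj-⊗ _ _) (⊗-congˡ (conj-involutive _)))))
                (≈-trans (conj-⊕ _ _) (⊕-cong ≈-refl (conj-involutive _))) ⟩
    two ⊗ (conj (x P) ⊗ x Q) ⊝ (conj (y P) ⊕ y Q)
      ≈⟨ ⊝-cong (⊗-congˡ (CommutativeRing.*-comm ring _ _)) (CommutativeRing.+-comm ring _ _) ⟩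
    h Q P ∎

  h-on-line : ∀ {l P Q} → P on l → Q on l →
    h P Q ≈ two ⊗ (x P ⊗ conj (x Q)) ⊝ slope l ⊗ x P ⊝ conj (slope l) ⊗ conj (x Q) ⊝ (intercept l ⊕ conj (intercept l))
  h-on-line {l} {P} {Q} p q = begin
    h P Q ≈⟨ ⊝-cong ≈-refl (⊕-cong p (≈-trans (conj-cong q) (≈-trans (conj-⊕ _ _) (⊕-cong (conj-⊗ _ _) ≈-refl)))) ⟩
    two ⊗ (x P ⊗ conj (x Q)) ⊝ ((slope l ⊗ x P ⊕ intercept l) ⊕ (conj (slope l) ⊗ conj (x Q) ⊕ conj (intercept l)))
      ≈⟨ solve 5 (λ t a b c d → t :- ((a :+ b) :+ (c :+ d)) := t :- a :- c :- (b :+ d)) ≈-refl _ _ _ _ _ ⟩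
    _ ∎

  -- D is an affine combination of A and B, so its isotropy makes the corresponding mixed term vanish.
  collinear⇒imaginary : ∀ {l A B D} → A on l → B on l → D on l →
    (x D ⊝ x B) ⊗ conj (x A ⊝ x D) ⊗ h A B ≈ ⊖ (conj (x D ⊝ x B) ⊗ (x A ⊝ x D) ⊗ h B A)
  collinear⇒imaginary {l} {A} {B} {D} a b d = begin
    (x D ⊝ x B) ⊗ conj (x A ⊝ x D) ⊗ h A B
      ≈⟨ ⊗-cong (⊗-congˡ (conj-⊝ _ _)) (h-on-line {l} {A} {B} a b) ⟩
    _ ≈⟨ identity (x A) (x B) (x D) (conj (x A)) (conj (x B)) (conj (x D)) (slope l) (conj (slope l)) (intercept l ⊕ conj (intercept l)) ⟩
    _ ≈⟨ ⊕-cong (⊖-cong (⊗-cong (⊗-congʳ (conj-⊝ _ _)) (h-on-line {l} {B} {A} b a)))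
           (⊝-cong (⊝-cong (⊗-congˡ (h-on-line {l} {D} {D} d d)) (⊗-congˡ (h-on-line {l} {A} {A} a a))) (⊗-congˡ (h-on-line {l} {B} {B} b b))) ⟨
    ⊖ (conj (x D ⊝ x B) ⊗ (x A ⊝ x D) ⊗ h B A) ⊕ (_ ⊗ h D D ⊝ _ ⊗ h A A ⊝ _ ⊗ h B B)
      ≈⟨ ⊕-cong ≈-refl (⊝-cong (⊝-cong (⊗-≈O (h-isotropic D)) (⊗-≈O (h-isotropic A))) (⊗-≈O (h-isotropic B))) ⟩
    ⊖ (conj (x D ⊝ x B) ⊗ (x A ⊝ x D) ⊗ h B A) ⊕ (O ⊝ O ⊝ O)
      ≈⟨ solve 1 (λ a → a :+ (con ℤ.0ℤ :- con ℤ.0ℤ :- con ℤ.0ℤ) := a) ≈-refl _ ⟩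
    ⊖ (conj (x D ⊝ x B) ⊗ (x A ⊝ x D) ⊗ h B A) ∎
    where
    identity : ∀ a b d ā b̄ d̄ m m̄ s →
      (d ⊝ b) ⊗ (ā ⊝ d̄) ⊗ (two ⊗ (a ⊗ b̄) ⊝ m ⊗ a ⊝ m̄ ⊗ b̄ ⊝ s) ≈
      ⊖ ((d̄ ⊝ b̄) ⊗ (a ⊝ d) ⊗ (two ⊗ (b ⊗ ā) ⊝ m ⊗ b ⊝ m̄ ⊗ ā ⊝ s)) ⊕
      (((a ⊝ b) ⊗ (ā ⊝ b̄)) ⊗ (two ⊗ (d ⊗ d̄) ⊝ m ⊗ d ⊝ m̄ ⊗ d̄ ⊝ s) ⊝
       ((d ⊝ b) ⊗ (d̄ ⊝ b̄)) ⊗ (two ⊗ (a ⊗ ā) ⊝ m ⊗ a ⊝ m̄ ⊗ ā ⊝ s) ⊝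
       ((a ⊝ d) ⊗ (ā ⊝ d̄)) ⊗ (two ⊗ (b ⊗ b̄) ⊝ m ⊗ b ⊝ m̄ ⊗ b̄ ⊝ s))
    identity = solve 9 (λ a b d ā b̄ d̄ m m̄ s → let two = con (+ 2) in
      (d :- b) :* (ā :- d̄) :* (two :* (a :* b̄) :- m :* a :- m̄ :* b̄ :- s) :=
      :- ((d̄ :- b̄) :* (a :- d) :* (two :* (b :* ā) :- m :* b :- m̄ :* ā :- s)) :+
      (((a :- b) :* (ā :- b̄)) :* (two :* (d :* d̄) :- m :* d :- m̄ :* d̄ :- s) :-
       ((d :- b) :* (d̄ :- b̄)) :* (two :* (a :* ā) :- m :* a :- m̄ :* ā :- s) :-
       ((a :- d) :* (ā :- d̄)) :* (two :* (b :* b̄) :- m :* b :- m̄ :* b̄ :- s))) ≈-refl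

  -- Subtract `h Q Q ≈ O` and use that both points are on `l`. This reduces the determinant `Δ` of a
  -- triangle to differences of abscissas and slopes.
  h-difference : ∀ {l P Q} → P on l → Q on l → h P Q ≈ (x P ⊝ x Q) ⊗ (two ⊗ conj (x Q) ⊝ slope l)
  h-difference {l} {P} {Q} p q = begin
    h P Q ≈⟨ solve 4 (λ a b̄ u v → a :- (u :+ v) := a :- (u :+ v) :- (b̄ :- b̄)) ≈-refl _ (y Q ⊕ conj (y Q)) _ _ ⟩
    h P Q ⊝ ((y Q ⊕ conj (y Q)) ⊝ (y Q ⊕ conj (y Q)))
      ≈⟨ ⊝-cong ≈-refl (⊝-cong (isotropic Q) ≈-refl) ⟩
    two ⊗ (x P ⊗ conj (x Q)) ⊝ (y P ⊕ conj (y Q)) ⊝ (two ⊗ (x Q ⊗ conj (x Q)) ⊝ (y Q ⊕ conj (y Q)))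
      ≈⟨ ⊝-cong (⊝-cong ≈-refl (⊕-cong p ≈-refl)) (⊝-cong ≈-refl (⊕-cong q ≈-refl)) ⟩
    two ⊗ (x P ⊗ conj (x Q)) ⊝ (slope l ⊗ x P ⊕ intercept l ⊕ conj (y Q)) ⊝
      (two ⊗ (x Q ⊗ conj (x Q)) ⊝ (slope l ⊗ x Q ⊕ intercept l ⊕ conj (y Q)))
      ≈⟨ solve 6 (λ a b b̄ m c ȳ → con (+ 2) :* (a :* b̄) :- (m :* a :+ c :+ ȳ) :-
           (con (+ 2) :* (b :* b̄) :- (m :* b :+ c :+ ȳ)) := (a :- b) :* (con (+ 2) :* b̄ :- m))
           ≈-refl (x P) (x Q) (conj (x Q)) (slope l) (intercept l) (conj (y Q)) ⟩
    (x P ⊝ x Q) ⊗ (two ⊗ conj (x Q) ⊝ slope l) ∎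

  h-symmetric-part : ∀ P Q → h P Q ≈ ⊖ (two ⊗ (x P ⊝ x Q) ⊗ (conj (x P) ⊝ conj (x Q))) ⊝ h Q P
  h-symmetric-part P Q = begin
    h P Q ≈⟨ solve 8 (λ p q p̄ q̄ u v ū v̄ →
              con (+ 2) :* (p :* q̄) :- (u :+ v̄) :=
              (:- (con (+ 2) :* (p :- q) :* (p̄ :- q̄)) :- (con (+ 2) :* (q :* p̄) :- (v :+ ū))) :+
              (con (+ 2) :* (p :* p̄) :- (u :+ ū)) :+ (con (+ 2) :* (q :* q̄) :- (v :+ v̄)))
              ≈-refl (x P) (x Q) (conj (x P)) (conj (x Q)) (y P) (y Q) (conj (y P)) (conj (y Q)) ⟩
    ⊖ (two ⊗ (x P ⊝ x Q) ⊗ (conj (x P) ⊝ conj (x Q))) ⊝ h Q P ⊕ h P P ⊕ h Q Q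
      ≈⟨ ⊕-cong (⊕-cong ≈-refl (h-isotropic P)) (h-isotropic Q) ⟩
    ⊖ (two ⊗ (x P ⊝ x Q) ⊗ (conj (x P) ⊝ conj (x Q))) ⊝ h Q P ⊕ O ⊕ O
      ≈⟨ solve 1 (λ a → a :+ con ℤ.0ℤ :+ con ℤ.0ℤ := a) ≈-refl _ ⟩
    ⊖ (two ⊗ (x P ⊝ x Q) ⊗ (conj (x P) ⊝ conj (x Q))) ⊝ h Q P ∎

  -- Like `h-symmetric-part`, this comes from adding vanishing values of `h`. The two express all
  -- six values of `h` on a triangle `A B V` through `h A B` and `h V B`, so that the Gram
  -- determinant becomes a polynomial identity.
  h-cocycle : ∀ P Q R → h P R ≈ h P Q ⊝ h R Q ⊝ two ⊗ (x P ⊝ x R) ⊗ (conj (x Q) ⊝ conj (x R))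
  h-cocycle P Q R = begin
    h P R ≈⟨ solve 8 (λ p r q̄ r̄ u v w̄ v̄ →
              con (+ 2) :* (p :* r̄) :- (u :+ v̄) :=
              ((con (+ 2) :* (p :* q̄) :- (u :+ w̄)) :- (con (+ 2) :* (r :* q̄) :- (v :+ w̄)) :-
                con (+ 2) :* (p :- r) :* (q̄ :- r̄)) :+ (con (+ 2) :* (r :* r̄) :- (v :+ v̄)))
              ≈-refl (x P) (x R) (conj (x Q)) (conj (x R)) (y P) (y R) (conj (y Q)) (conj (y R)) ⟩
    _ ⊕ h R R ≈⟨ ⊕-cong ≈-refl (h-isotropic R) ⟩
    _ ⊕ O     ≈⟨ solve 1 (λ a → a :+ con ℤ.0ℤ := a) ≈-refl _ ⟩
    h P Q ⊝ h R Q ⊝ two ⊗ (x P ⊝ x R) ⊗ (conj (x Q) ⊝ conj (x R)) ∎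

  -- The left side is the Gram determinant of the isotropic triangle A B V, the right side
  -- -2 det · conj det for the matrix of the coordinates of A, B, V.
  gram-determinant : ∀ A B V →
    h A B ⊗ h B V ⊗ h V A ⊕ h B A ⊗ h V B ⊗ h A V ≈
    ⊖ (two ⊗ ((x A ⊝ x B) ⊗ h V B ⊕ (x B ⊝ x V) ⊗ h A B) ⊗
       ((conj (x A) ⊝ conj (x B)) ⊗ h B V ⊕ (conj (x B) ⊝ conj (x V)) ⊗ h B A))
  gram-determinant A B V = begin
    h A B ⊗ h B V ⊗ h V A ⊕ h B A ⊗ h V B ⊗ h A V
      ≈⟨ ⊕-cong (⊗-cong (⊗-congˡ (h-symmetric-part B V)) (h-cocycle V B A))
                (⊗-cong (⊗-congʳ (h-symmetric-part B A)) (h-cocycle A B V)) ⟩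
    _ ≈⟨ identity (x A) (x B) (x V) (conj (x A)) (conj (x B)) (conj (x V)) (h A B) (h V B) ⟩
    _ ≈⟨ ⊖-cong (⊗-congˡ (⊕-cong (⊗-congˡ (h-symmetric-part B V)) (⊗-congˡ (h-symmetric-part B A)))) ⟨
    _ ∎
    where
    identity : ∀ a b c ā b̄ c̄ p r →
      p ⊗ (⊖ (two ⊗ (b ⊝ c) ⊗ (b̄ ⊝ c̄)) ⊝ r) ⊗ (r ⊝ p ⊝ two ⊗ (c ⊝ a) ⊗ (b̄ ⊝ ā)) ⊕
      (⊖ (two ⊗ (b ⊝ a) ⊗ (b̄ ⊝ ā)) ⊝ p) ⊗ r ⊗ (p ⊝ r ⊝ two ⊗ (a ⊝ c) ⊗ (b̄ ⊝ c̄)) ≈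
      ⊖ (two ⊗ ((a ⊝ b) ⊗ r ⊕ (b ⊝ c) ⊗ p) ⊗
        ((ā ⊝ b̄) ⊗ (⊖ (two ⊗ (b ⊝ c) ⊗ (b̄ ⊝ c̄)) ⊝ r) ⊕ (b̄ ⊝ c̄) ⊗ (⊖ (two ⊗ (b ⊝ a) ⊗ (b̄ ⊝ ā)) ⊝ p)))
    identity = solve 8 (λ a b c ā b̄ c̄ p r → let two = con (+ 2) in
      p :* (:- (two :* (b :- c) :* (b̄ :- c̄)) :- r) :* (r :- p :- two :* (c :- a) :* (b̄ :- ā)) :+
      (:- (two :* (b :- a) :* (b̄ :- ā)) :- p) :* r :* (p :- r :- two :* (a :- c) :* (b̄ :- c̄)) :=
      :- (two :* ((a :- b) :* r :+ (b :- c) :* p) :*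
        ((ā :- b̄) :* (:- (two :* (b :- c) :* (b̄ :- c̄)) :- r) :+ (b̄ :- c̄) :* (:- (two :* (b :- a) :* (b̄ :- ā)) :- p)))) ≈-refl

  -- Evaluating the equation of l′ along l: the value is proportional to the distance from l ∩ l′.
  private
    menelaus-term : ∀ {l l′ D P} → D on l → D on l′ → P on l →
      (slope l ⊝ slope l′) ⊗ (x P ⊝ x D) ≈ y P ⊝ slope l′ ⊗ x P ⊝ intercept l′
    menelaus-term {l} {l′} {D} {P} d d′ p = begin
      (slope l ⊝ slope l′) ⊗ (x P ⊝ x D)
        ≈⟨ solve 6 (λ m m′ c c′ p d → (m :- m′) :* (p :- d) :=
             (m :* p :+ c) :- m′ :* p :- c′ :- ((m :* d :+ c) :- (m′ :* d :+ c′)))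
             ≈-refl (slope l) (slope l′) (intercept l) (intercept l′) (x P) (x D) ⟩
      (slope l ⊗ x P ⊕ intercept l) ⊝ slope l′ ⊗ x P ⊝ intercept l′ ⊝
        ((slope l ⊗ x D ⊕ intercept l) ⊝ (slope l′ ⊗ x D ⊕ intercept l′))
        ≈⟨ ⊝-cong (⊝-cong (⊝-cong p ≈-refl) ≈-refl) (⊝-cong d d′) ⟨
      y P ⊝ slope l′ ⊗ x P ⊝ intercept l′ ⊝ (y D ⊝ y D)
        ≈⟨ solve 4 (λ a b c d → a :- b :- c :- (d :- d) := a :- b :- c) ≈-refl _ _ _ _ ⟩
      y P ⊝ slope l′ ⊗ x P ⊝ intercept l′ ∎

  -- Each vertex of the triangle lies on two of its sides, so the value of the equation of `l₄`
  -- there has two expressions. In the product of the three equalities the slope differences are the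
  -- same on both sides and cancel.
  menelaus : ∀ {l₁ l₂ l₃ l₄ A B V D G F} →
    A on l₁ → B on l₁ → D on l₁ → A on l₂ → V on l₂ → G on l₂ → B on l₃ → V on l₃ → F on l₃ →
    D on l₄ → G on l₄ → F on l₄ →
    ¬ slope l₁ ≈ slope l₄ → ¬ slope l₂ ≈ slope l₄ → ¬ slope l₃ ≈ slope l₄ →
    (x D ⊝ x B) ⊗ (x F ⊝ x V) ⊗ (x A ⊝ x G) ≈ ⊖ ((x A ⊝ x D) ⊗ (x B ⊝ x F) ⊗ (x G ⊝ x V))
  menelaus {l₁} {l₂} {l₃} {l₄} {A} {B} {V} {D} {G} {F} a₁ b₁ d₁ a₂ c₂ e₂ b₃ c₃ f₃ d₄ e₄ f₄ m₁ m₂ m₃ =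
    ⊗-cancelˡ (⊗-≉O (⊗-≉O (≉⇒⊝≉O m₁) (≉⇒⊝≉O m₂)) (≉⇒⊝≉O m₃)) (begin
      (n₁ ⊗ n₂ ⊗ n₃) ⊗ ((x D ⊝ x B) ⊗ (x F ⊝ x V) ⊗ (x A ⊝ x G))
        ≈⟨ solve 9 (λ n₁ n₂ n₃ a b c d e f → (n₁ :* n₂ :* n₃) :* ((d :- b) :* (f :- c) :* (a :- e)) :=
             (n₁ :* (b :- d)) :* (n₃ :* (c :- f)) :* (n₂ :* (a :- e)))
             ≈-refl n₁ n₂ n₃ (x A) (x B) (x V) (x D) (x G) (x F) ⟩
      (n₁ ⊗ (x B ⊝ x D)) ⊗ (n₃ ⊗ (x V ⊝ x F)) ⊗ (n₂ ⊗ (x A ⊝ x G))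
        ≈⟨ ⊗-cong (⊗-cong (at {l₁} {l₃} {B} {D} {F} b₁ d₁ d₄ b₃ f₃ f₄) (at {l₃} {l₂} {V} {F} {G} c₃ f₃ f₄ c₂ e₂ e₄)) (at {l₂} {l₁} {A} {G} {D} a₂ e₂ e₄ a₁ d₁ d₄) ⟩
      (n₃ ⊗ (x B ⊝ x F)) ⊗ (n₂ ⊗ (x V ⊝ x G)) ⊗ (n₁ ⊗ (x A ⊝ x D))
        ≈⟨ solve 9 (λ n₁ n₂ n₃ a b c d e f → (n₃ :* (b :- f)) :* (n₂ :* (c :- e)) :* (n₁ :* (a :- d)) :=
             (n₁ :* n₂ :* n₃) :* (:- ((a :- d) :* (b :- f) :* (e :- c))))
             ≈-refl n₁ n₂ n₃ (x A) (x B) (x V) (x D) (x G) (x F) ⟩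
      (n₁ ⊗ n₂ ⊗ n₃) ⊗ ⊖ ((x A ⊝ x D) ⊗ (x B ⊝ x F) ⊗ (x G ⊝ x V)) ∎)
    where
    n₁ = slope l₁ ⊝ slope l₄
    n₂ = slope l₂ ⊝ slope l₄
    n₃ = slope l₃ ⊝ slope l₄
    at : ∀ {l l′ P Q R} → P on l → Q on l → Q on l₄ → P on l′ → R on l′ → R on l₄ →
      (slope l ⊝ slope l₄) ⊗ (x P ⊝ x Q) ≈ (slope l′ ⊝ slope l₄) ⊗ (x P ⊝ x R)
    at {l} {l′} {P} {Q} {R} p q q₄ p′ r r₄ =
      ≈-trans (menelaus-term {l} {l₄} {Q} {P} q q₄ p) (≈-sym (menelaus-term {l′} {l₄} {R} {P} r r₄ p′))

  -- O'Nan's theorem. By Menelaus the triple product S of h around the triangle A B V is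
  -- purely imaginary, whereas the Gram determinant S + conj S of a proper triangle is nonzero.
  no-O'Nan-configuration : ∀ {l₁ l₂ l₃ l₄ A B V D G F} →
    A on l₁ → B on l₁ → D on l₁ → A on l₂ → V on l₂ → G on l₂ → B on l₃ → V on l₃ → F on l₃ →
    D on l₄ → G on l₄ → F on l₄ →
    ¬ slope l₁ ≈ slope l₄ → ¬ slope l₂ ≈ slope l₄ → ¬ slope l₃ ≈ slope l₄ → ¬ slope l₃ ≈ slope l₁ →
    ¬ x A ≈ x B → ¬ x B ≈ x V → ¬ x A ≈ x D → ¬ x B ≈ x F → ¬ x G ≈ x V → ⊥
  no-O'Nan-configuration {l₁} {l₂} {l₃} {l₄} {A} {B} {V} {D} {G} {F}
    a₁ b₁ d₁ a₂ c₂ e₂ b₃ c₃ f₃ d₄ e₄ f₄ m₁ m₂ m₃ m₁₃ A≉B B≉V A≉D B≉F G≉V =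
    ⊗-≉O (⊗-≉O two≉O Δ≉O) conjΔ≉O (begin
      two ⊗ Δ ⊗ ((conj (x A) ⊝ conj (x B)) ⊗ h B V ⊕ (conj (x B) ⊝ conj (x V)) ⊗ h B A)
        ≈⟨ solve 1 (λ a → a := :- (:- a)) ≈-refl _ ⟩
      ⊖ (⊖ (two ⊗ Δ ⊗ ((conj (x A) ⊝ conj (x B)) ⊗ h B V ⊕ (conj (x B) ⊝ conj (x V)) ⊗ h B A)))
        ≈⟨ ⊖-cong (gram-determinant A B V) ⟨
      ⊖ (S ⊕ S̄) ≈⟨ ⊖-cong S+S̄≈O ⟩
      ⊖ O ≈⟨ solve 0 (:- con ℤ.0ℤ := con ℤ.0ℤ) ≈-refl ⟩
      O ∎)
    where
    Δ S S̄ W : E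
    Δ = (x A ⊝ x B) ⊗ h V B ⊕ (x B ⊝ x V) ⊗ h A B
    S = h A B ⊗ h B V ⊗ h V A
    S̄ = h B A ⊗ h V B ⊗ h A V
    W = (x A ⊝ x D) ⊗ (x B ⊝ x F) ⊗ (x G ⊝ x V)

    Δ≉O : ¬ Δ ≈ O
    Δ≉O e = ⊗-≉O (⊗-≉O (≉⇒⊝≉O A≉B) (≉⇒⊝≉O B≉V)) (≉⇒⊝≉O m₁₃) (begin
      (x A ⊝ x B) ⊗ (x B ⊝ x V) ⊗ (slope l₃ ⊝ slope l₁)
        ≈⟨ solve 6 (λ a b c b̄ m₁ m₃ → (a :- b) :* (b :- c) :* (m₃ :- m₁) :=
             (a :- b) :* ((c :- b) :* (con (+ 2) :* b̄ :- m₃)) :+ (b :- c) :* ((a :- b) :* (con (+ 2) :* b̄ :- m₁)))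
             ≈-refl (x A) (x B) (x V) (conj (x B)) (slope l₁) (slope l₃) ⟩
      _ ≈⟨ ⊕-cong (⊗-congˡ (h-difference {l₃} {V} {B} c₃ b₃)) (⊗-congˡ (h-difference {l₁} {A} {B} a₁ b₁)) ⟨
      Δ ≈⟨ e ⟩
      O ∎)

    conjΔ≉O : ¬ (conj (x A) ⊝ conj (x B)) ⊗ h B V ⊕ (conj (x B) ⊝ conj (x V)) ⊗ h B A ≈ O
    conjΔ≉O e = conj-≉O Δ≉O (begin
      conj Δ ≈⟨ ≈-trans (conj-⊕ _ _) (⊕-cong (conj-⊗ _ _) (conj-⊗ _ _)) ⟩
      conj (x A ⊝ x B) ⊗ conj (h V B) ⊕ conj (x B ⊝ x V) ⊗ conj (h A B)
        ≈⟨ ⊕-cong (⊗-cong (conj-⊝ _ _) (conj-h V B)) (⊗-cong (conj-⊝ _ _) (conj-h A B)) ⟩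
      _ ≈⟨ e ⟩
      O ∎)

    W≉O : ¬ W ≈ O
    W≉O = ⊗-≉O (⊗-≉O (≉⇒⊝≉O A≉D) (≉⇒⊝≉O B≉F)) (≉⇒⊝≉O G≉V)

    M : (x D ⊝ x B) ⊗ (x F ⊝ x V) ⊗ (x A ⊝ x G) ≈ ⊖ W
    M = menelaus {l₁} {l₂} {l₃} {l₄} {A} {B} {V} {D} {G} {F} a₁ b₁ d₁ a₂ c₂ e₂ b₃ c₃ f₃ d₄ e₄ f₄ m₁ m₂ m₃

    conj³ : ∀ u v w → conj (u ⊗ v ⊗ w) ≈ conj u ⊗ conj v ⊗ conj w
    conj³ u v w = ≈-trans (conj-⊗ _ _) (⊗-congʳ (conj-⊗ u v))

    -- The three mixed terms multiply up to W ⊗ conj W ⊗ S = - W ⊗ conj W ⊗ S̄.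
    WW̄S : ⊖ W ⊗ conj W ⊗ S ≈ W ⊗ conj W ⊗ S̄
    WW̄S = begin
      ⊖ W ⊗ conj W ⊗ S ≈⟨ ⊗-congʳ (⊗-cong (≈-sym M) (conj³ _ _ _)) ⟩
      ((x D ⊝ x B) ⊗ (x F ⊝ x V) ⊗ (x A ⊝ x G)) ⊗ (conj (x A ⊝ x D) ⊗ conj (x B ⊝ x F) ⊗ conj (x G ⊝ x V)) ⊗ S
        ≈⟨ solve 9 (λ a b c d e f p q r →
             (a :* b :* c) :* (d :* e :* f) :* (p :* q :* r) :=
             (a :* d :* p) :* (b :* e :* q) :* (f :* c :* r)) ≈-refl _ _ _ _ _ _ _ _ _ ⟩
      ((x D ⊝ x B) ⊗ conj (x A ⊝ x D) ⊗ h A B) ⊗ ((x F ⊝ x V) ⊗ conj (x B ⊝ x F) ⊗ h B V) ⊗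
        (conj (x G ⊝ x V) ⊗ (x A ⊝ x G) ⊗ h V A)
        ≈⟨ ⊗-cong (⊗-cong (collinear⇒imaginary {l₁} {A} {B} {D} a₁ b₁ d₁) (collinear⇒imaginary {l₃} {B} {V} {F} b₃ c₃ f₃))
             (begin
               _ ≈⟨ solve 1 (λ a → a := :- (:- a)) ≈-refl _ ⟩
               ⊖ (⊖ (conj (x G ⊝ x V) ⊗ (x A ⊝ x G) ⊗ h V A)) ≈⟨ ⊖-cong (collinear⇒imaginary {l₂} {A} {V} {G} a₂ c₂ e₂) ⟨
               ⊖ ((x G ⊝ x V) ⊗ conj (x A ⊝ x G) ⊗ h A V) ∎) ⟩
      ⊖ (conj (x D ⊝ x B) ⊗ (x A ⊝ x D) ⊗ h B A) ⊗ ⊖ (conj (x F ⊝ x V) ⊗ (x B ⊝ x F) ⊗ h V B) ⊗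
        ⊖ ((x G ⊝ x V) ⊗ conj (x A ⊝ x G) ⊗ h A V)
        ≈⟨ solve 9 (λ a b c d e f p q r →
             (:- (a :* d :* p)) :* (:- (b :* e :* q)) :* (:- (f :* c :* r)) :=
             (d :* e :* f) :* (:- (a :* b :* c)) :* (p :* q :* r)) ≈-refl _ _ _ _ _ _ _ _ _ ⟩
      W ⊗ ⊖ (conj (x D ⊝ x B) ⊗ conj (x F ⊝ x V) ⊗ conj (x A ⊝ x G)) ⊗ S̄
        ≈⟨ ⊗-congʳ (⊗-congˡ (begin
             ⊖ (conj (x D ⊝ x B) ⊗ conj (x F ⊝ x V) ⊗ conj (x A ⊝ x G)) ≈⟨ ⊖-cong (conj³ _ _ _) ⟨
             ⊖ conj ((x D ⊝ x B) ⊗ (x F ⊝ x V) ⊗ (x A ⊝ x G)) ≈⟨ ⊖-cong (≈-trans (conj-cong M) (conj-⊖ W)) ⟩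
             ⊖ (⊖ conj W) ≈⟨ solve 1 (λ a → :- (:- a) := a) ≈-refl _ ⟩
             conj W ∎)) ⟩
      W ⊗ conj W ⊗ S̄ ∎

    S+S̄≈O : S ⊕ S̄ ≈ O
    S+S̄≈O = ⊗-cancel-O (⊗-≉O W≉O (conj-≉O W≉O)) (begin
      W ⊗ conj W ⊗ (S ⊕ S̄) ≈⟨ solve 4 (λ w w̄ s s̄ → w :* w̄ :* (s :+ s̄) := w :* w̄ :* s̄ :- (:- w) :* w̄ :* s) ≈-refl W (conj W) S S̄ ⟩
      W ⊗ conj W ⊗ S̄ ⊝ ⊖ W ⊗ conj W ⊗ S ≈⟨ ≈⇒⊝≈O (≈-sym WW̄S) ⟩
      O ∎)

-- The field with q² elements and the unital in coordinates

module Plane (q : ℕ) (δ : ℤ) where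
  open import Data.Integer using (+_)

  -- Elements `re + im √δ` with integer coordinates, to be compared modulo `q`. For a prime `q` and
  -- a nonsquare `δ` this is the field with `q²` elements, and its ring laws are identities between
  -- integers.
  record E : Set where
    constructor _+√_
    field re im : ℤ
  open E public

  infix 4 _≈_
  record _≈_ (x y : E) : Set where
    constructor _&_
    field
      re≈ : + q ℤ.∣ re x ℤ.- re y
      im≈ : + q ℤ.∣ im x ℤ.- im y
  open _≈_ public

  infixl 6 _⊕_ _⊝_
  infixl 7 _⊗_
  infix 8 ⊖_
  _⊕_ _⊗_ _⊝_ : E → E → E
  (a +√ b) ⊕ (c +√ e) = (a ℤ.+ c) +√ (b ℤ.+ e)
  (a +√ b) ⊗ (c +√ e) = (a ℤ.* c ℤ.+ δ ℤ.* (b ℤ.* e)) +√ (a ℤ.* e ℤ.+ b ℤ.* c)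
  ⊖_ conj : E → E
  ⊖ (a +√ b) = (ℤ.- a) +√ (ℤ.- b)
  conj (a +√ b) = a +√ (ℤ.- b)
  x ⊝ y = x ⊕ ⊖ y

  scalar : ℤ → E
  scalar a = a +√ ℤ.0ℤ

  private
    ∣-subst : ∀ {x y} → x ≡ y → + q ℤ.∣ x → + q ℤ.∣ y
    ∣-subst = subst (+ q ℤ.∣_)

    ∣0 : ∀ x → + q ℤ.∣ x ℤ.- x
    ∣0 x = ∣-subst (sym (ℤ.+-inverseʳ x)) (divides ℤ.0ℤ refl)

    ≡⇒∣ : ∀ {x y} → x ≡ y → + q ℤ.∣ x ℤ.- y
    ≡⇒∣ {x} refl = ∣0 x

  ≈-refl : ∀ {x} → x ≈ x
  ≈-refl {a +√ b} = ∣0 a & ∣0 b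

  ≈-sym : ∀ {x y} → x ≈ y → y ≈ x
  ≈-sym {a +√ b} {c +√ e} (p & r) =
    ∣-subst (eq a c) (ℤ.∣m⇒∣-m p) & ∣-subst (eq b e) (ℤ.∣m⇒∣-m r)
    where
    eq : ∀ x y → ℤ.- (x ℤ.- y) ≡ y ℤ.- x
    eq = solveℤ-∀

  ≈-trans : ∀ {x y z} → x ≈ y → y ≈ z → x ≈ z
  ≈-trans {a +√ b} {c +√ e} {f +√ g} (p & r) (p′ & r′) =
    ∣-subst (eq a c f) (ℤ.∣m∣n⇒∣m+n p p′) & ∣-subst (eq b e g) (ℤ.∣m∣n⇒∣m+n r r′)
    where
    eq : ∀ x y z → (x ℤ.- y) ℤ.+ (y ℤ.- z) ≡ x ℤ.- z
    eq = solveℤ-∀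

  ⊕-cong : ∀ {x y u v} → x ≈ y → u ≈ v → x ⊕ u ≈ y ⊕ v
  ⊕-cong {a +√ b} {c +√ e} {f +√ g} {h +√ i} (p & r) (p′ & r′) =
    ∣-subst (eq a c f h) (ℤ.∣m∣n⇒∣m+n p p′) & ∣-subst (eq b e g i) (ℤ.∣m∣n⇒∣m+n r r′)
    where
    eq : ∀ x y z w → (x ℤ.- y) ℤ.+ (z ℤ.- w) ≡ (x ℤ.+ z) ℤ.- (y ℤ.+ w)
    eq = solveℤ-∀

  ⊖-cong : ∀ {x y} → x ≈ y → ⊖ x ≈ ⊖ y
  ⊖-cong {a +√ b} {c +√ e} (p & r) =
    ∣-subst (eq a c) (ℤ.∣m⇒∣-m p) & ∣-subst (eq b e) (ℤ.∣m⇒∣-m r)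
    where
    eq : ∀ x y → ℤ.- (x ℤ.- y) ≡ (ℤ.- x) ℤ.- (ℤ.- y)
    eq = solveℤ-∀

  conj-cong : ∀ {x y} → x ≈ y → conj x ≈ conj y
  conj-cong {a +√ b} {c +√ e} (p & r) = p & ∣-subst (eq b e) (ℤ.∣m⇒∣-m r)
    where
    eq : ∀ x y → ℤ.- (x ℤ.- y) ≡ (ℤ.- x) ℤ.- (ℤ.- y)
    eq = solveℤ-∀

  ⊗-cong : ∀ {x y u v} → x ≈ y → u ≈ v → x ⊗ u ≈ y ⊗ v
  ⊗-cong {a +√ b} {c +√ e} {f +√ g} {h +√ i} (p & r) (p′ & r′) =
    ∣-subst (eq₁ δ a b c e f g h i)
      (ℤ.∣m∣n⇒∣m+n (ℤ.∣m∣n⇒∣m+n (ℤ.∣m⇒∣m*n f p) (ℤ.∣n⇒∣m*n c p′))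
        (ℤ.∣m∣n⇒∣m+n (ℤ.∣n⇒∣m*n (δ ℤ.* g) r) (ℤ.∣n⇒∣m*n (δ ℤ.* e) r′))) &
    ∣-subst (eq₂ a b c e f g h i)
      (ℤ.∣m∣n⇒∣m+n (ℤ.∣m∣n⇒∣m+n (ℤ.∣m⇒∣m*n g p) (ℤ.∣n⇒∣m*n c r′))
        (ℤ.∣m∣n⇒∣m+n (ℤ.∣m⇒∣m*n f r) (ℤ.∣n⇒∣m*n e p′)))
    where
    eq₁ : ∀ δ a b c e f g h i →
      ((a ℤ.- c) ℤ.* f ℤ.+ c ℤ.* (f ℤ.- h)) ℤ.+ (δ ℤ.* g ℤ.* (b ℤ.- e) ℤ.+ δ ℤ.* e ℤ.* (g ℤ.- i)) ≡
      (a ℤ.* f ℤ.+ δ ℤ.* (b ℤ.* g)) ℤ.- (c ℤ.* h ℤ.+ δ ℤ.* (e ℤ.* i))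
    eq₁ = solveℤ-∀
    eq₂ : ∀ a b c e f g h i →
      ((a ℤ.- c) ℤ.* g ℤ.+ c ℤ.* (g ℤ.- i)) ℤ.+ ((b ℤ.- e) ℤ.* f ℤ.+ e ℤ.* (f ℤ.- h)) ≡
      (a ℤ.* g ℤ.+ b ℤ.* f) ℤ.- (c ℤ.* i ℤ.+ e ℤ.* h)
    eq₂ = solveℤ-∀

  ⊗-assoc : ∀ x y z → (x ⊗ y) ⊗ z ≈ x ⊗ (y ⊗ z)
  ⊗-assoc (a +√ b) (c +√ e) (f +√ g) = ≡⇒∣ (eq₁ δ a b c e f g) & ≡⇒∣ (eq₂ δ a b c e f g)
    where
    eq₁ : ∀ δ a b c e f g →
      (a ℤ.* c ℤ.+ δ ℤ.* (b ℤ.* e)) ℤ.* f ℤ.+ δ ℤ.* ((a ℤ.* e ℤ.+ b ℤ.* c) ℤ.* g) ≡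
      a ℤ.* (c ℤ.* f ℤ.+ δ ℤ.* (e ℤ.* g)) ℤ.+ δ ℤ.* (b ℤ.* (c ℤ.* g ℤ.+ e ℤ.* f))
    eq₁ = solveℤ-∀
    eq₂ : ∀ δ a b c e f g →
      (a ℤ.* c ℤ.+ δ ℤ.* (b ℤ.* e)) ℤ.* g ℤ.+ (a ℤ.* e ℤ.+ b ℤ.* c) ℤ.* f ≡
      a ℤ.* (c ℤ.* g ℤ.+ e ℤ.* f) ℤ.+ b ℤ.* (c ℤ.* f ℤ.+ δ ℤ.* (e ℤ.* g))
    eq₂ = solveℤ-∀

  ⊗-comm : ∀ x y → x ⊗ y ≈ y ⊗ x
  ⊗-comm (a +√ b) (c +√ e) = ≡⇒∣ (eq₁ δ a b c e) & ≡⇒∣ (eq₂ a b c e)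
    where
    eq₁ : ∀ δ a b c e → a ℤ.* c ℤ.+ δ ℤ.* (b ℤ.* e) ≡ c ℤ.* a ℤ.+ δ ℤ.* (e ℤ.* b)
    eq₁ = solveℤ-∀
    eq₂ : ∀ a b c e → a ℤ.* e ℤ.+ b ℤ.* c ≡ c ℤ.* b ℤ.+ e ℤ.* a
    eq₂ = solveℤ-∀

  ⊗-identityˡ : ∀ x → scalar ℤ.1ℤ ⊗ x ≈ x
  ⊗-identityˡ (a +√ b) = ≡⇒∣ (eq₁ δ a b) & ≡⇒∣ (eq₂ a b)
    where
    eq₁ : ∀ δ a b → ℤ.1ℤ ℤ.* a ℤ.+ δ ℤ.* (ℤ.0ℤ ℤ.* b) ≡ a
    eq₁ = solveℤ-∀
    eq₂ : ∀ a b → ℤ.1ℤ ℤ.* b ℤ.+ ℤ.0ℤ ℤ.* a ≡ b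
    eq₂ = solveℤ-∀

  ⊗-distribˡ : ∀ x y z → x ⊗ (y ⊕ z) ≈ x ⊗ y ⊕ x ⊗ z
  ⊗-distribˡ (a +√ b) (c +√ e) (f +√ g) = ≡⇒∣ (eq₁ δ a b c e f g) & ≡⇒∣ (eq₂ a b c e f g)
    where
    eq₁ : ∀ δ a b c e f g → a ℤ.* (c ℤ.+ f) ℤ.+ δ ℤ.* (b ℤ.* (e ℤ.+ g)) ≡
      (a ℤ.* c ℤ.+ δ ℤ.* (b ℤ.* e)) ℤ.+ (a ℤ.* f ℤ.+ δ ℤ.* (b ℤ.* g))
    eq₁ = solveℤ-∀
    eq₂ : ∀ a b c e f g → a ℤ.* (e ℤ.+ g) ℤ.+ b ℤ.* (c ℤ.+ f) ≡
      (a ℤ.* e ℤ.+ b ℤ.* c) ℤ.+ (a ℤ.* g ℤ.+ b ℤ.* f)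
    eq₂ = solveℤ-∀

  E-commutativeRing : CommutativeRing 0ℓ 0ℓ
  E-commutativeRing = record
    { Carrier = E ; _≈_ = _≈_ ; _+_ = _⊕_ ; _*_ = _⊗_ ; -_ = ⊖_
    ; 0# = scalar ℤ.0ℤ ; 1# = scalar ℤ.1ℤ
    ; isCommutativeRing = record
      { isRing = record
        { +-isAbelianGroup = record
          { isGroup = record
            { isMonoid = record
              { isSemigroup = record
                { isMagma = record
                  { isEquivalence = record { refl = ≈-refl ; sym = ≈-sym ; trans = ≈-trans }
                  ; ∙-cong = ⊕-cong }
                ; assoc = λ x y z → ≡⇒∣ (ℤ.+-assoc (re x) (re y) (re z)) & ≡⇒∣ (ℤ.+-assoc (im x) (im y) (im z)) }
              ; identity = (λ x → ≡⇒∣ (ℤ.+-identityˡ (re x)) & ≡⇒∣ (ℤ.+-identityˡ (im x)))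
                         , (λ x → ≡⇒∣ (ℤ.+-identityʳ (re x)) & ≡⇒∣ (ℤ.+-identityʳ (im x))) }
            ; inverse = (λ x → ≡⇒∣ (ℤ.+-inverseˡ (re x)) & ≡⇒∣ (ℤ.+-inverseˡ (im x)))
                      , (λ x → ≡⇒∣ (ℤ.+-inverseʳ (re x)) & ≡⇒∣ (ℤ.+-inverseʳ (im x)))
            ; ⁻¹-cong = ⊖-cong }
          ; comm = λ x y → ≡⇒∣ (ℤ.+-comm (re x) (re y)) & ≡⇒∣ (ℤ.+-comm (im x) (im y)) }
        ; *-cong = ⊗-cong
        ; *-assoc = ⊗-assoc
        ; *-identity = ⊗-identityˡ
                     , (λ x → ≈-trans (⊗-comm x (scalar ℤ.1ℤ)) (⊗-identityˡ x))
        ; distrib = ⊗-distribˡ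
                  , (λ x y z → ≈-trans (⊗-comm (y ⊕ z) x)
                      (≈-trans (⊗-distribˡ x y z) (⊕-cong (⊗-comm x y) (⊗-comm x z)))) }
      ; *-comm = ⊗-comm } }

  scalar-homomorphism : ℤ.+-*-rawRing -Raw-AlmostCommutative⟶ fromCommutativeRing E-commutativeRing
  scalar-homomorphism = record
    { ⟦_⟧ = scalar
    ; +-homo = λ _ _ → ≈-refl
    ; *-homo = λ a b → ≡⇒∣ (eq₁ δ a b) & ≡⇒∣ (eq₂ a b)
    ; -‿homo = λ _ → ≈-refl
    ; 0-homo = ≈-refl
    ; 1-homo = ≈-refl }
    where
    eq₁ : ∀ δ a b → a ℤ.* b ≡ a ℤ.* b ℤ.+ δ ℤ.* (ℤ.0ℤ ℤ.* ℤ.0ℤ)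
    eq₁ = solveℤ-∀
    eq₂ : ∀ a b → ℤ.0ℤ ≡ a ℤ.* ℤ.0ℤ ℤ.+ ℤ.0ℤ ℤ.* b
    eq₂ = solveℤ-∀

  norm : E → ℤ
  norm (a +√ b) = a ℤ.* a ℤ.- δ ℤ.* (b ℤ.* b)

  module _ (q-prime : Prime q) (δ-nonsquare : ∀ a → ¬ + q ℤ.∣ a ℤ.* a ℤ.- δ) where

    euclid : ∀ a b → + q ℤ.∣ a ℤ.* b → + q ℤ.∣ a ⊎ + q ℤ.∣ b
    euclid a b d with euclidsLemma ℤ.∣ a ∣ ℤ.∣ b ∣ q-prime (subst (q ℕ.∣_) (ℤ.abs-* a b) (ℤ.∣⇒∣ᵤ d))
    ... | inj₁ p = inj₁ (ℤ.∣ᵤ⇒∣ p)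
    ... | inj₂ p = inj₂ (ℤ.∣ᵤ⇒∣ p)

    inverse : ∀ b → ¬ + q ℤ.∣ b → ∃ λ i → + q ℤ.∣ b ℤ.* i ℤ.- ℤ.1ℤ
    inverse (+ m) q∤b with coprime-Bézout coprime
      where
      coprime : Coprime m q
      coprime {d} (d∣m , d∣q) with prime⇒irreducible q-prime d∣q
      ... | inj₁ d≡1  = d≡1
      ... | inj₂ refl = contradiction (ℤ.∣ᵤ⇒∣ d∣m) q∤b
    ... | Bézout.+- x y eq = + x , divides (+ y) (begin
      + m ℤ.* + x ℤ.- ℤ.1ℤ               ≡⟨ cong (ℤ._- ℤ.1ℤ) (trans (ℤ.*-comm (+ m) (+ x)) (sym (ℤ.pos-* x m))) ⟩
      + (x * m) ℤ.- ℤ.1ℤ                 ≡⟨ cong (λ n → + n ℤ.- ℤ.1ℤ) eq ⟨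
      ℤ.1ℤ ℤ.+ + (y * q) ℤ.- ℤ.1ℤ        ≡⟨ cancel (+ (y * q)) ⟩
      + (y * q)                          ≡⟨ ℤ.pos-* y q ⟩
      + y ℤ.* + q                        ∎)
      where
      open ≡-Reasoning
      cancel : ∀ z → ℤ.1ℤ ℤ.+ z ℤ.- ℤ.1ℤ ≡ z
      cancel = solveℤ-∀
    ... | Bézout.-+ x y eq = ℤ.- (+ x) , divides (ℤ.- (+ y)) (begin
      + m ℤ.* ℤ.- (+ x) ℤ.- ℤ.1ℤ         ≡⟨ regroup (+ m) (+ x) ⟩
      ℤ.- (ℤ.1ℤ ℤ.+ + x ℤ.* + m)         ≡⟨ cong (λ n → ℤ.- (ℤ.1ℤ ℤ.+ n)) (ℤ.pos-* x m) ⟨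
      ℤ.- (+ (1 + x * m))                ≡⟨ cong (λ n → ℤ.- (+ n)) eq ⟩
      ℤ.- (+ (y * q))                    ≡⟨ cong ℤ.-_ (ℤ.pos-* y q) ⟩
      ℤ.- (+ y ℤ.* + q)                  ≡⟨ ℤ.neg-distribˡ-* (+ y) (+ q) ⟩
      ℤ.- (+ y) ℤ.* + q                  ∎)
      where
      open ≡-Reasoning
      regroup : ∀ m x → m ℤ.* ℤ.- x ℤ.- ℤ.1ℤ ≡ ℤ.- (ℤ.1ℤ ℤ.+ x ℤ.* m)
      regroup = solveℤ-∀
    inverse (ℤ.-[1+ n ]) q∤b =
      let i , d = inverse (+ suc n) (λ d → q∤b (ℤ.∣m⇒∣-m d))
      in ℤ.- i , ∣-subst (cong (ℤ._- ℤ.1ℤ) (swap (+ suc n) i)) d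
      where
      swap : ∀ m i → m ℤ.* i ≡ ℤ.- m ℤ.* ℤ.- i
      swap = solveℤ-∀

    -- If im z were invertible, (re z / im z)² would be δ.
    norm≡0⇒ : ∀ z → + q ℤ.∣ norm z → + q ℤ.∣ re z × + q ℤ.∣ im z
    norm≡0⇒ (a +√ b) d with + q ℤ.∣? b
    ... | yes q∣b = q∣a , q∣b
      where
      q∣a² : + q ℤ.∣ a ℤ.* a
      q∣a² = ∣-subst (eq a (δ ℤ.* (b ℤ.* b))) (ℤ.∣m∣n⇒∣m+n d (ℤ.∣n⇒∣m*n δ (ℤ.∣m⇒∣m*n b q∣b)))
        where
        eq : ∀ x y → (x ℤ.* x ℤ.- y) ℤ.+ y ≡ x ℤ.* x
        eq = solveℤ-∀
      q∣a : + q ℤ.∣ a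
      q∣a = [ id , id ]′ (euclid a a q∣a²)
    ... | no q∤b = let i , h = inverse b q∤b in ⊥-elim (δ-nonsquare (a ℤ.* i)
      (∣-subst (eq a b i δ) (ℤ.∣m∣n⇒∣m+n (ℤ.∣n⇒∣m*n (i ℤ.* i) d) (ℤ.∣m⇒∣m*n (δ ℤ.* (b ℤ.* i ℤ.+ ℤ.1ℤ)) h))))
      where
      eq : ∀ a b i δ → i ℤ.* i ℤ.* (a ℤ.* a ℤ.- δ ℤ.* (b ℤ.* b)) ℤ.+ (b ℤ.* i ℤ.- ℤ.1ℤ) ℤ.* (δ ℤ.* (b ℤ.* i ℤ.+ ℤ.1ℤ)) ≡
        a ℤ.* i ℤ.* (a ℤ.* i) ℤ.- δ
      eq = solveℤ-∀

    private
      minus-0 : ∀ {a} → + q ℤ.∣ a ℤ.- ℤ.0ℤ → + q ℤ.∣ a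
      minus-0 {a} = ∣-subst (ℤ.+-identityʳ a)

      ≈0-intro : ∀ {z} → + q ℤ.∣ re z × + q ℤ.∣ im z → z ≈ scalar ℤ.0ℤ
      ≈0-intro {a +√ b} (p , r) = ∣-subst (sym (ℤ.+-identityʳ a)) p & ∣-subst (sym (ℤ.+-identityʳ b)) r

    -- The norm is multiplicative and, by `norm≡0⇒`, divisible by `q` only at zero. Euclid's lemma
    -- is applied to the product of the two norms.
    ⊗-nonzero : ∀ {x y} → ¬ x ≈ scalar ℤ.0ℤ → ¬ y ≈ scalar ℤ.0ℤ → ¬ x ⊗ y ≈ scalar ℤ.0ℤ
    ⊗-nonzero {x@(a +√ b)} {y@(c +√ e)} x≉0 y≉0 (p & r) =
      [ (λ h → x≉0 (≈0-intro (norm≡0⇒ x h))) , (λ h → y≉0 (≈0-intro (norm≡0⇒ y h))) ]′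
        (euclid (norm x) (norm y) (∣-subst (eq a b c e δ)
          (ℤ.∣m∣n⇒∣m-n (ℤ.∣m⇒∣m*n (re (x ⊗ y)) (minus-0 {re (x ⊗ y)} p)) (ℤ.∣n⇒∣m*n δ (ℤ.∣m⇒∣m*n (im (x ⊗ y)) (minus-0 {im (x ⊗ y)} r))))))
      where
      eq : ∀ a b c e δ →
        (a ℤ.* c ℤ.+ δ ℤ.* (b ℤ.* e)) ℤ.* (a ℤ.* c ℤ.+ δ ℤ.* (b ℤ.* e)) ℤ.-
          δ ℤ.* ((a ℤ.* e ℤ.+ b ℤ.* c) ℤ.* (a ℤ.* e ℤ.+ b ℤ.* c)) ≡
        (a ℤ.* a ℤ.- δ ℤ.* (b ℤ.* b)) ℤ.* (c ℤ.* c ℤ.- δ ℤ.* (e ℤ.* e))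
      eq = solveℤ-∀

    conj-⊕ : ∀ x y → conj (x ⊕ y) ≈ conj x ⊕ conj y
    conj-⊕ (a +√ b) (c +√ e) = ∣0 (a ℤ.+ c) & ≡⇒∣ (ℤ.neg-distrib-+ b e)

    conj-⊗ : ∀ x y → conj (x ⊗ y) ≈ conj x ⊗ conj y
    conj-⊗ (a +√ b) (c +√ e) = ≡⇒∣ (eq₁ δ a b c e) & ≡⇒∣ (eq₂ a b c e)
      where
      eq₁ : ∀ δ a b c e → a ℤ.* c ℤ.+ δ ℤ.* (b ℤ.* e) ≡ a ℤ.* c ℤ.+ δ ℤ.* (ℤ.- b ℤ.* ℤ.- e)
      eq₁ = solveℤ-∀
      eq₂ : ∀ a b c e → ℤ.- (a ℤ.* e ℤ.+ b ℤ.* c) ≡ a ℤ.* ℤ.- e ℤ.+ ℤ.- b ℤ.* c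
      eq₂ = solveℤ-∀

    module _ (q∤2 : ¬ + q ℤ.∣ + 2) where

      E-conjugationDomain : ConjugationDomain
      E-conjugationDomain = record
        { ring = E-commutativeRing
        ; fromℤ = scalar-homomorphism
        ; conj = conj
        ; conj-cong = conj-cong
        ; conj-⊕ = conj-⊕
        ; conj-⊗ = conj-⊗
        ; conj-⊖ = λ _ → ≈-refl
        ; conj-involutive = λ { (a +√ b) → ∣0 a & ≡⇒∣ (ℤ.neg-involutive b) }
        ; ⊗-≉O = ⊗-nonzero
        ; two≉O = λ { (p & _) → q∤2 p }
        ; ≈-stable = ≈-stable
        }
        where
        ≈-stable : ∀ {x y} → ¬ ¬ x ≈ y → x ≈ y
        ≈-stable {x} {y} h with + q ℤ.∣? (re x ℤ.- re y) | + q ℤ.∣? (im x ℤ.- im y)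
        ... | yes p | yes r = p & r
        ... | no ¬p | _     = ⊥-elim (h (λ { (p & _) → ¬p p }))
        ... | yes _ | no ¬r = ⊥-elim (h (λ { (_ & r) → ¬r r }))

      private module H = HermitianPlane E-conjugationDomain

      Incident : ℤ × ℤ × ℤ → ℤ × ℤ × ℤ × ℤ → Set
      Incident (x₀ , x₁ , y) (u₀ , u₁ , c , k) =
        + q ℤ.∣ norm ((x₀ ℤ.- u₀) +√ (x₁ ℤ.- u₁)) ℤ.- k × + q ℤ.∣ y ℤ.- (c ℤ.+ (u₀ ℤ.* x₁ ℤ.- u₁ ℤ.* x₀))

      -- The unital in coordinates: the affine isotropic points are (x , N x + 2√δ y), and the line
      -- through them with slope 2ū meets the unital over the circle N (x - u) = k.
      unitalPoint : ℤ × ℤ × ℤ → H.Point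
      unitalPoint (x₀ , x₁ , y) = H.point (x₀ +√ x₁) (norm (x₀ +√ x₁) +√ (+ 2 ℤ.* y))
        (≡⇒∣ (eq₁ x₀ x₁ δ) & ≡⇒∣ (eq₂ x₀ x₁ y δ))
        where
        eq₁ : ∀ x₀ x₁ δ → let n = x₀ ℤ.* x₀ ℤ.- δ ℤ.* (x₁ ℤ.* x₁) in
          n ℤ.+ n ≡ + 2 ℤ.* (x₀ ℤ.* x₀ ℤ.+ δ ℤ.* (x₁ ℤ.* ℤ.- x₁)) ℤ.+ δ ℤ.* (ℤ.0ℤ ℤ.* (x₀ ℤ.* ℤ.- x₁ ℤ.+ x₁ ℤ.* x₀))
        eq₁ = solveℤ-∀
        eq₂ : ∀ x₀ x₁ y δ → + 2 ℤ.* y ℤ.+ ℤ.- (+ 2 ℤ.* y) ≡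
          + 2 ℤ.* (x₀ ℤ.* ℤ.- x₁ ℤ.+ x₁ ℤ.* x₀) ℤ.+ ℤ.0ℤ ℤ.* (x₀ ℤ.* x₀ ℤ.+ δ ℤ.* (x₁ ℤ.* ℤ.- x₁))
        eq₂ = solveℤ-∀

      unitalLine : ℤ × ℤ × ℤ × ℤ → H.Line
      unitalLine (u₀ , u₁ , c , k) = H.line ((+ 2 ℤ.* u₀) +√ (ℤ.- (+ 2 ℤ.* u₁))) ((k ℤ.- norm (u₀ +√ u₁)) +√ (+ 2 ℤ.* c))

      incident⇒on : ∀ P l → Incident P l → unitalPoint P H.on unitalLine l
      incident⇒on (x₀ , x₁ , y) (u₀ , u₁ , c , k) (d₁ , d₂) =
        ∣-subst (eq₁ x₀ x₁ u₀ u₁ k δ) d₁ & ∣-subst (eq₂ x₀ x₁ y u₀ u₁ c) (ℤ.∣n⇒∣m*n (+ 2) d₂)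
        where
        eq₁ : ∀ x₀ x₁ u₀ u₁ k δ →
          ((x₀ ℤ.- u₀) ℤ.* (x₀ ℤ.- u₀) ℤ.- δ ℤ.* ((x₁ ℤ.- u₁) ℤ.* (x₁ ℤ.- u₁))) ℤ.- k ≡
          (x₀ ℤ.* x₀ ℤ.- δ ℤ.* (x₁ ℤ.* x₁)) ℤ.-
            ((+ 2 ℤ.* u₀) ℤ.* x₀ ℤ.+ δ ℤ.* (ℤ.- (+ 2 ℤ.* u₁) ℤ.* x₁) ℤ.+ (k ℤ.- (u₀ ℤ.* u₀ ℤ.- δ ℤ.* (u₁ ℤ.* u₁))))
        eq₁ = solveℤ-∀
        eq₂ : ∀ x₀ x₁ y u₀ u₁ c →
          + 2 ℤ.* (y ℤ.- (c ℤ.+ (u₀ ℤ.* x₁ ℤ.- u₁ ℤ.* x₀))) ≡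
          + 2 ℤ.* y ℤ.- ((+ 2 ℤ.* u₀) ℤ.* x₁ ℤ.+ ℤ.- (+ 2 ℤ.* u₁) ℤ.* x₀ ℤ.+ + 2 ℤ.* c)
        eq₂ = solveℤ-∀

      infix 4 _≡₃_ _≡₄_
      _≡₃_ : ℤ × ℤ × ℤ → ℤ × ℤ × ℤ → Set
      (x₀ , x₁ , y) ≡₃ (x₀′ , x₁′ , y′) = + q ℤ.∣ x₀ ℤ.- x₀′ × + q ℤ.∣ x₁ ℤ.- x₁′ × + q ℤ.∣ y ℤ.- y′

      _≡₄_ : ℤ × ℤ × ℤ × ℤ → ℤ × ℤ × ℤ × ℤ → Set
      (u₀ , u₁ , c , k) ≡₄ (u₀′ , u₁′ , c′ , k′) =
        + q ℤ.∣ u₀ ℤ.- u₀′ × + q ℤ.∣ u₁ ℤ.- u₁′ × + q ℤ.∣ c ℤ.- c′ × + q ℤ.∣ k ℤ.- k′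

      halve : ∀ {a} → + q ℤ.∣ + 2 ℤ.* a → + q ℤ.∣ a
      halve {a} d = [ (λ h → ⊥-elim (q∤2 h)) , id ]′ (euclid (+ 2) a d)

      -- On a given line the third coordinate is an affine function of the first two.
      same-x⇒≡₃ : ∀ P Q l → Incident P l → Incident Q l → H.Point.x (unitalPoint P) ≈ H.Point.x (unitalPoint Q) → P ≡₃ Q
      same-x⇒≡₃ (x₀ , x₁ , y) (x₀′ , x₁′ , y′) (u₀ , u₁ , c , k) (_ , d) (_ , d′) (p & r) = p , r ,
        ∣-subst (eq x₀ x₁ x₀′ x₁′ y y′ u₀ u₁ c)
          (ℤ.∣m∣n⇒∣m+n (ℤ.∣m∣n⇒∣m-n d d′) (ℤ.∣m∣n⇒∣m-n (ℤ.∣n⇒∣m*n u₀ r) (ℤ.∣n⇒∣m*n u₁ p)))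
        where
        eq : ∀ x₀ x₁ x₀′ x₁′ y y′ u₀ u₁ c →
          ((y ℤ.- (c ℤ.+ (u₀ ℤ.* x₁ ℤ.- u₁ ℤ.* x₀))) ℤ.- (y′ ℤ.- (c ℤ.+ (u₀ ℤ.* x₁′ ℤ.- u₁ ℤ.* x₀′)))) ℤ.+
            (u₀ ℤ.* (x₁ ℤ.- x₁′) ℤ.- u₁ ℤ.* (x₀ ℤ.- x₀′)) ≡ y ℤ.- y′
        eq = solveℤ-∀

      -- Since `q` does not divide two, the slope determines the centre `(u₀ , u₁)`. The common
      -- point then fixes the intercept, from which `c` and `k` can be read off once the centre is
      -- known.
      same-slope⇒≡₄ : ∀ P l l′ → Incident P l → Incident P l′ → H.Line.slope (unitalLine l) ≈ H.Line.slope (unitalLine l′) → l ≡₄ l′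
      same-slope⇒≡₄ P@(x₀ , x₁ , y) l@(u₀ , u₁ , c , k) l′@(u₀′ , u₁′ , c′ , k′) h h′ e@(s₀ & s₁)
        = let i₀ & i₁ = H.same-slope⇒intercept≈ {unitalPoint P} {unitalLine l} {unitalLine l′} (incident⇒on P l h) (incident⇒on P l′ h′) e in
          d₀ , d₁ , halve (∣-subst (eq₁ c c′) i₁) , ∣-subst (eq₂ u₀ u₀′ u₁ u₁′ k k′ δ)
          (ℤ.∣m∣n⇒∣m+n i₀ (ℤ.∣m∣n⇒∣m-n (ℤ.∣m⇒∣m*n (u₀ ℤ.+ u₀′) d₀) (ℤ.∣n⇒∣m*n δ (ℤ.∣m⇒∣m*n (u₁ ℤ.+ u₁′) d₁))))
        where
        eq₁ : ∀ a b → + 2 ℤ.* a ℤ.- + 2 ℤ.* b ≡ + 2 ℤ.* (a ℤ.- b)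
        eq₁ = solveℤ-∀
        eq₃ : ∀ a b → ℤ.- (ℤ.- (+ 2 ℤ.* a) ℤ.- ℤ.- (+ 2 ℤ.* b)) ≡ + 2 ℤ.* (a ℤ.- b)
        eq₃ = solveℤ-∀
        d₀ : + q ℤ.∣ u₀ ℤ.- u₀′
        d₀ = halve (∣-subst (eq₁ u₀ u₀′) s₀)
        d₁ : + q ℤ.∣ u₁ ℤ.- u₁′
        d₁ = halve (∣-subst (eq₃ u₁ u₁′) (ℤ.∣m⇒∣-m s₁))
        eq₂ : ∀ u₀ u₀′ u₁ u₁′ k k′ δ →
          ((k ℤ.- (u₀ ℤ.* u₀ ℤ.- δ ℤ.* (u₁ ℤ.* u₁))) ℤ.- (k′ ℤ.- (u₀′ ℤ.* u₀′ ℤ.- δ ℤ.* (u₁′ ℤ.* u₁′)))) ℤ.+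
            ((u₀ ℤ.- u₀′) ℤ.* (u₀ ℤ.+ u₀′) ℤ.- δ ℤ.* ((u₁ ℤ.- u₁′) ℤ.* (u₁ ℤ.+ u₁′))) ≡ k ℤ.- k′
        eq₂ = solveℤ-∀

      two-points⇒≡₄ : ∀ P Q l l′ → Incident P l → Incident Q l → Incident P l′ → Incident Q l′ → ¬ P ≡₃ Q → l ≡₄ l′
      two-points⇒≡₄ P Q l l′ p r p′ r′ P≢Q = same-slope⇒≡₄ P l l′ p p′
        (H.two-points⇒slope≈ {unitalPoint P} {unitalPoint Q} {unitalLine l} {unitalLine l′}
          (incident⇒on P l p) (incident⇒on Q l r) (incident⇒on P l′ p′) (incident⇒on Q l′ r′)
          (λ e → P≢Q (same-x⇒≡₃ P Q l p r e)))

      unital-O'Nan-free : ∀ l₁ l₂ l₃ l₄ A B V D G F →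
        Incident A l₁ → Incident B l₁ → Incident D l₁ → Incident A l₂ → Incident V l₂ → Incident G l₂ →
        Incident B l₃ → Incident V l₃ → Incident F l₃ → Incident D l₄ → Incident G l₄ → Incident F l₄ →
        ¬ l₁ ≡₄ l₄ → ¬ l₂ ≡₄ l₄ → ¬ l₃ ≡₄ l₄ → ¬ l₃ ≡₄ l₁ →
        ¬ A ≡₃ B → ¬ B ≡₃ V → ¬ A ≡₃ D → ¬ B ≡₃ F → ¬ G ≡₃ V → ⊥
      unital-O'Nan-free l₁ l₂ l₃ l₄ A B V D G F a₁ b₁ d₁ a₂ c₂ g₂ b₃ c₃ f₃ d₄ g₄ f₄ n₁ n₂ n₃ n₁₃ A≢B B≢V A≢D B≢F G≢V =
        H.no-O'Nan-configuration {unitalLine l₁} {unitalLine l₂} {unitalLine l₃} {unitalLine l₄}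
          {unitalPoint A} {unitalPoint B} {unitalPoint V} {unitalPoint D} {unitalPoint G} {unitalPoint F}
          (incident⇒on A l₁ a₁) (incident⇒on B l₁ b₁) (incident⇒on D l₁ d₁)
          (incident⇒on A l₂ a₂) (incident⇒on V l₂ c₂) (incident⇒on G l₂ g₂)
          (incident⇒on B l₃ b₃) (incident⇒on V l₃ c₃) (incident⇒on F l₃ f₃)
          (incident⇒on D l₄ d₄) (incident⇒on G l₄ g₄) (incident⇒on F l₄ f₄)
          (λ e → n₁ (same-slope⇒≡₄ D l₁ l₄ d₁ d₄ e)) (λ e → n₂ (same-slope⇒≡₄ G l₂ l₄ g₂ g₄ e))
          (λ e → n₃ (same-slope⇒≡₄ F l₃ l₄ f₃ f₄ e)) (λ e → n₁₃ (same-slope⇒≡₄ B l₃ l₁ b₃ b₁ e))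
          (λ e → A≢B (same-x⇒≡₃ A B l₁ a₁ b₁ e)) (λ e → B≢V (same-x⇒≡₃ B V l₃ b₃ c₃ e))
          (λ e → A≢D (same-x⇒≡₃ A D l₁ a₁ d₁ e)) (λ e → B≢F (same-x⇒≡₃ B F l₃ b₃ f₃ e))
          (λ e → G≢V (same-x⇒≡₃ G V l₂ g₂ c₂ e))

-- Counting the points and lines of the unital

∑-↑ : ∀ m {n} (f : Fin (m + n) → ℕ) →
  ∑ (allFin (m + n)) f ≡ ∑ (allFin m) (λ i → f (i Fin.↑ˡ n)) + ∑ (allFin n) (λ j → f (m Fin.↑ʳ j))
∑-↑ zero f    = refl
∑-↑ (suc m) {n} f = begin
  ∑ (allFin (suc m + n)) f ≡⟨ trans (∑-suc f) (cong (f zero +_) (∑-↑ m (f ∘ suc))) ⟩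
  f zero + (∑ (allFin m) (λ i → f (suc (i Fin.↑ˡ n))) + R) ≡⟨ +-assoc (f zero) _ R ⟨
  f zero + ∑ (allFin m) (λ i → f (suc (i Fin.↑ˡ n))) + R ≡⟨ cong (_+ R) (∑-suc (λ i → f (i Fin.↑ˡ n))) ⟨
  ∑ (allFin (suc m)) (λ i → f (i Fin.↑ˡ n)) + R ∎
  where
  open ≡-Reasoning
  R : ℕ
  R = ∑ (allFin n) (λ j → f (suc m Fin.↑ʳ j))

∑-combine : ∀ m {n} (f : Fin (m * n) → ℕ) →
  ∑ (allFin (m * n)) f ≡ ∑ (allFin m) (λ i → ∑ (allFin n) (λ j → f (combine i j)))
∑-combine zero f        = refl
∑-combine (suc m) {n} f = begin
  ∑ (allFin (n + m * n)) f ≡⟨ ∑-↑ n f ⟩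
  ∑ (allFin n) (λ j → f (j Fin.↑ˡ (m * n))) + ∑ (allFin (m * n)) (λ z → f (n Fin.↑ʳ z))
    ≡⟨ cong (∑ (allFin n) (λ j → f (j Fin.↑ˡ (m * n))) +_) (∑-combine m (λ z → f (n Fin.↑ʳ z))) ⟩
  _ ≡⟨ ∑-suc {m} (λ i → ∑ (allFin n) (λ j → f (combine {suc m} {n} i j))) ⟨
  ∑ (allFin (suc m)) (λ i → ∑ (allFin n) (λ j → f (combine {suc m} {n} i j))) ∎
  where open ≡-Reasoning

-- `f` names the only candidate for a second element. On a circle it sends a coordinate to its
-- negative.
#≤2 : ∀ {n} (a : Fin n → Bool) (f : Fin n → Fin n) →
  (∀ i j → a i ≡ true → a j ≡ true → i ≡ j ⊎ f i ≡ j) → # a ≤ 2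
#≤2 {n} a f h with findᵇ a
... | inj₂ none    = ≤-trans (≤-reflexive (#-none none)) z≤n
... | inj₁ (i , p) = begin
  # a                                                  ≤⟨ ∑-mono (allFin n) term ⟩
  ∑ (allFin n) (λ j → 𝟙 (i == j) + 𝟙 (f i == j))       ≡⟨ ∑-+ (allFin n) _ _ ⟩
  # (i ==_) + # (f i ==_)                              ≡⟨ cong₂ _+_ (#-== i) (#-== (f i)) ⟩
  2                                                    ∎
  where
  open ≤-Reasoning
  term : ∀ j → 𝟙 (a j) ≤ 𝟙 (i == j) + 𝟙 (f i == j)
  term j with a j in e
  ... | false = z≤n
  ... | true  with h i j p e
  ...   | inj₁ refl rewrite ==-refl i = m≤m+n 1 _
  ...   | inj₂ refl rewrite ==-refl (f i) = m≤n+m 1 _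

module Residues (q : ℕ) .{{_ : NonZero q}} where
  open import Data.Integer using (+_)

  ⟦_⟧ : Fin q → ℤ
  ⟦ i ⟧ = + toℕ i

  reduce : ℤ → Fin q
  reduce z = fromℕ< (ℤ.n%ℕd<d z q)

  ⟦reduce⟧ : ∀ z → + q ℤ.∣ ⟦ reduce z ⟧ ℤ.- z
  ⟦reduce⟧ z = divides (ℤ.- (z ℤ./ℕ q)) (begin
    ⟦ reduce z ⟧ ℤ.- z ≡⟨ cong₂ (λ m w → + m ℤ.- w) (Fin.toℕ-fromℕ< (ℤ.n%ℕd<d z q)) (ℤ.a≡a%ℕn+[a/ℕn]*n z q) ⟩
    + r ℤ.- (+ r ℤ.+ (z ℤ./ℕ q) ℤ.* + q) ≡⟨ eq (+ r) (z ℤ./ℕ q) (+ q) ⟩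
    ℤ.- (z ℤ./ℕ q) ℤ.* + q ∎)
    where
    open ≡-Reasoning
    r : ℕ
    r = z ℤ.%ℕ q
    eq : ∀ r d q → r ℤ.- (r ℤ.+ d ℤ.* q) ≡ ℤ.- d ℤ.* q
    eq = solveℤ-∀

  ⟦⟧-injective : ∀ i j → + q ℤ.∣ ⟦ i ⟧ ℤ.- ⟦ j ⟧ → i ≡ j
  ⟦⟧-injective i j d with ≤-total (toℕ i) (toℕ j)
  ... | inj₁ i≤j = Fin.toℕ-injective (≤-antisym i≤j (below i j (subst (ℕ._∣_ q) (ℤ.∣⊖∣-≤ i≤j) (subst (λ z → q ℕ.∣ ℤ.∣ z ∣) (ℤ.m-n≡m⊖n (toℕ i) (toℕ j)) (ℤ.∣⇒∣ᵤ d)))))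
    where
    below : ∀ i j → q ℕ.∣ toℕ j ∸ toℕ i → toℕ j ≤ toℕ i
    below i j h with toℕ j ∸ toℕ i in e
    ... | zero  = m∸n≡0⇒m≤n e
    ... | suc m = contradiction (ℕ.∣⇒≤ h) (<⇒≱ (≤-<-trans (≤-trans (≤-reflexive (sym e)) (m∸n≤m (toℕ j) (toℕ i))) (Fin.toℕ<n j)))
  ... | inj₂ j≤i = sym (⟦⟧-injective-≤ j≤i)
    where
    ⟦⟧-injective-≤ : toℕ j ≤ toℕ i → j ≡ i
    ⟦⟧-injective-≤ j≤i = Fin.toℕ-injective (≤-antisym j≤i (below (subst (λ z → q ℕ.∣ ℤ.∣ z ∣) (trans (ℤ.m-n≡m⊖n (toℕ i) (toℕ j)) (ℤ.⊖-≥ j≤i)) (ℤ.∣⇒∣ᵤ d))))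
      where
      below : q ℕ.∣ toℕ i ∸ toℕ j → toℕ i ≤ toℕ j
      below h with toℕ i ∸ toℕ j in e
      ... | zero  = m∸n≡0⇒m≤n e
      ... | suc m = contradiction (ℕ.∣⇒≤ h) (<⇒≱ (≤-<-trans (≤-trans (≤-reflexive (sym e)) (m∸n≤m (toℕ i) (toℕ j))) (Fin.toℕ<n i)))

-- In O'Nan-free the points are a = l₁ ∩ l₂, b = l₁ ∩ l₃, d = l₁ ∩ l₄, v = l₂ ∩ l₃, g = l₂ ∩ l₄, f = l₃ ∩ l₄.
record Design (q j : ℕ) : Set where
  field
    N : ℕ
    q⁴≤4N : q * (q * (q * q)) ≤ 4 * N
    N≤q⁴ : N ≤ q * (q * (q * q))
    inc : Fin (q * (q * q)) → Fin N → Bool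
    degree : ∀ l → # (λ p → inc p l) ≡ 8 * j
    linear : ∀ p p′ l l′ → inc p l ≡ true → inc p l′ ≡ true → inc p′ l ≡ true → inc p′ l′ ≡ true → l ≢ l′ → p ≡ p′
    O'Nan-free : ∀ l₁ l₂ l₃ l₄ a b v d g f →
      inc a l₁ ≡ true → inc b l₁ ≡ true → inc d l₁ ≡ true → inc a l₂ ≡ true → inc v l₂ ≡ true → inc g l₂ ≡ true →
      inc b l₃ ≡ true → inc v l₃ ≡ true → inc f l₃ ≡ true → inc d l₄ ≡ true → inc g l₄ ≡ true → inc f l₄ ≡ true →
      l₁ ≢ l₄ → l₂ ≢ l₄ → l₃ ≢ l₄ → l₃ ≢ l₁ → a ≢ b → b ≢ v → a ≢ d → b ≢ f → g ≢ v → ⊥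

module UnitalDesign where
  open import Data.Integer using (+_)

  -- Since (-1)² = 1², the q residues have square roots among 0, …, q-2 only.
  nonsquare : ∀ q .{{_ : NonZero q}} → 2 < q → ∃ λ δ → ∀ a → ¬ + q ℤ.∣ a ℤ.* a ℤ.- δ
  nonsquare q 2<q = ⟦ e ⟧ , λ a d → let r , h = root a in
    ¬rooted (r , subst (+ q ℤ.∣_) (eq (a ℤ.* a) (+ toℕ r ℤ.* + toℕ r) ⟦ e ⟧) (ℤ.∣m∣n⇒∣m-n d h))
    where
    open Residues q
    m : ℕ
    m = pred q
    1+m≡q : suc m ≡ q
    1+m≡q = suc-pred q
    1<m : 1 < m
    1<m = s≤s⁻¹ (subst (2 <_) (sym 1+m≡q) 2<q)
    Rooted : Fin q → Set
    Rooted e = ∃ λ (r : Fin m) → + q ℤ.∣ + toℕ r ℤ.* + toℕ r ℤ.- ⟦ e ⟧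
    rooted? : ∀ e → Dec (Rooted e)
    rooted? e = Fin.any? (λ r → + q ℤ.∣? (+ toℕ r ℤ.* + toℕ r ℤ.- ⟦ e ⟧))
    not-all-rooted : ¬ (∀ e → Rooted e)
    not-all-rooted h =
      let e , e′ , e<e′ , same = Fin.pigeonhole (≤-reflexive 1+m≡q) (proj₁ ∘ h)
      in <⇒≢ e<e′ (cong toℕ (⟦⟧-injective e e′
        (subst (+ q ℤ.∣_) (eq₀ (+ toℕ (proj₁ (h e)) ℤ.* + toℕ (proj₁ (h e))) ⟦ e ⟧ ⟦ e′ ⟧)
          (ℤ.∣m∣n⇒∣m-n (subst (λ r → + q ℤ.∣ + toℕ r ℤ.* + toℕ r ℤ.- ⟦ e′ ⟧) (sym same) (proj₂ (h e′))) (proj₂ (h e))))))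
      where
      eq₀ : ∀ s e f → (s ℤ.- f) ℤ.- (s ℤ.- e) ≡ e ℤ.- f
      eq₀ = solveℤ-∀
    witness : ∃ λ e → ¬ Rooted e
    witness = Fin.¬∀⟶∃¬ q Rooted rooted? not-all-rooted
    e : Fin q
    e = proj₁ witness
    ¬rooted : ¬ Rooted e
    ¬rooted = proj₂ witness
    eq : ∀ s t e → (s ℤ.- e) ℤ.- (s ℤ.- t) ≡ t ℤ.- e
    eq = solveℤ-∀
    squares : ∀ a b → + q ℤ.∣ b ℤ.- a → + q ℤ.∣ a ℤ.* a ℤ.- b ℤ.* b
    squares a b d = subst (+ q ℤ.∣_) (eq′ a b) (ℤ.∣n⇒∣m*n (ℤ.- (a ℤ.+ b)) d)
      where
      eq′ : ∀ a b → ℤ.- (a ℤ.+ b) ℤ.* (b ℤ.- a) ≡ a ℤ.* a ℤ.- b ℤ.* b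
      eq′ = solveℤ-∀
    root : ∀ a → ∃ λ (r : Fin m) → + q ℤ.∣ a ℤ.* a ℤ.- + toℕ r ℤ.* + toℕ r
    root a = case toℕ (reduce a) <? m of λ
      { (yes r<m) → fromℕ< r<m , subst (λ n → + q ℤ.∣ a ℤ.* a ℤ.- + n ℤ.* + n) (sym (Fin.toℕ-fromℕ< r<m)) (squares a ⟦ reduce a ⟧ (⟦reduce⟧ a))
      ; (no r≮m)  → fromℕ< 1<m , subst (λ n → + q ℤ.∣ a ℤ.* a ℤ.- + n ℤ.* + n) (sym (Fin.toℕ-fromℕ< 1<m))
          (subst (+ q ℤ.∣_) (eq₁ a) (squares (ℤ.- a) ℤ.1ℤ (subst (+ q ℤ.∣_) (eq₂ a (+ m))
            (ℤ.∣m∣n⇒∣m-n (subst (λ n → + q ℤ.∣ + n) (sym 1+m≡q) ℤ.∣-refl)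
              (subst (λ n → + q ℤ.∣ + n ℤ.- a) (r≡m r≮m) (⟦reduce⟧ a)))))) }
      where
      r≡m : ¬ toℕ (reduce a) < m → toℕ (reduce a) ≡ m
      r≡m r≮m = ≤-antisym (s≤s⁻¹ (subst (toℕ (reduce a) <_) (sym 1+m≡q) (Fin.toℕ<n (reduce a)))) (≮⇒≥ r≮m)
      eq₁ : ∀ a → ℤ.- a ℤ.* ℤ.- a ℤ.- ℤ.1ℤ ℤ.* ℤ.1ℤ ≡ a ℤ.* a ℤ.- ℤ.1ℤ ℤ.* ℤ.1ℤ
      eq₁ = solveℤ-∀
      eq₂ : ∀ a m → (ℤ.1ℤ ℤ.+ m) ℤ.- (m ℤ.- a) ≡ ℤ.1ℤ ℤ.- ℤ.- a
      eq₂ = solveℤ-∀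

  -- Only the radii `k` whose circle has at least `8 * j` points are kept. The `q` circles about the
  -- origin cover the plane and none has more than `2 * q` points, so with `8 * j ≤ q / 2` at least
  -- a quarter of the radii survive. This replaces the exact count of points on a circle.
  unital-design : ∀ q j .{{_ : NonZero q}} → Prime q → 2 < q → 16 * j ≤ q → Design q j
  unital-design q j q-prime 2<q 16j≤q = record
    { N = q * (q * (q * g))
    ; q⁴≤4N = ≤-trans (*-monoʳ-≤ q (*-monoʳ-≤ q (*-monoʳ-≤ q q≤4g))) (≤-reflexive (pull q g))
    ; N≤q⁴ = *-monoʳ-≤ q (*-monoʳ-≤ q (*-monoʳ-≤ q (#≤n good)))
    ; inc = inc
    ; degree = λ l → #-truncate (8 * j) (λ p → onᵇ p l) (enough l)
    ; linear = λ p p′ l l′ h₁ h₂ h₃ h₄ l≢l′ → case p Fin.≟ p′ of λ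
        { (yes e) → e
        ; (no p≢p′) → contradiction (decodeLine-injective l l′ (two-points⇒≡₄ (point p) (point p′) (line l) (line l′)
            (incident p l h₁) (incident p′ l h₃) (incident p l′ h₂) (incident p′ l′ h₄) (p≢p′ ∘ decodePoint-injective p p′))) l≢l′ }
    ; O'Nan-free = λ l₁ l₂ l₃ l₄ a b v d g f a₁ b₁ d₁ a₂ v₂ g₂ b₃ v₃ f₃ d₄ g₄ f₄ n₁ n₂ n₃ n₁₃ a≢b b≢v a≢d b≢f g≢v →
        unital-O'Nan-free (line l₁) (line l₂) (line l₃) (line l₄) (point a) (point b) (point v) (point d) (point g) (point f)
          (incident a l₁ a₁) (incident b l₁ b₁) (incident d l₁ d₁) (incident a l₂ a₂) (incident v l₂ v₂) (incident g l₂ g₂)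
          (incident b l₃ b₃) (incident v l₃ v₃) (incident f l₃ f₃) (incident d l₄ d₄) (incident g l₄ g₄) (incident f l₄ f₄)
          (n₁ ∘ decodeLine-injective l₁ l₄) (n₂ ∘ decodeLine-injective l₂ l₄) (n₃ ∘ decodeLine-injective l₃ l₄) (n₁₃ ∘ decodeLine-injective l₃ l₁)
          (a≢b ∘ decodePoint-injective a b) (b≢v ∘ decodePoint-injective b v) (a≢d ∘ decodePoint-injective a d)
          (b≢f ∘ decodePoint-injective b f) (g≢v ∘ decodePoint-injective g v)
    }
    where
    pull : ∀ q g → q * (q * (q * (4 * g))) ≡ 4 * (q * (q * (q * g)))
    pull = solve-∀
    δ : ℤ
    δ = proj₁ (nonsquare q 2<q)
    δ-nonsquare : ∀ a → ¬ + q ℤ.∣ a ℤ.* a ℤ.- δ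
    δ-nonsquare = proj₂ (nonsquare q 2<q)
    q∤2 : ¬ + q ℤ.∣ + 2
    q∤2 d = <⇒≱ 2<q (ℕ.∣⇒≤ (ℤ.∣⇒∣ᵤ d))
    open Residues q
    open Plane q δ hiding (two-points⇒≡₄; unital-O'Nan-free)
    Inc : ℤ × ℤ × ℤ → ℤ × ℤ × ℤ × ℤ → Set
    Inc = Incident q-prime δ-nonsquare q∤2
    two-points⇒≡₄ = Plane.two-points⇒≡₄ q δ q-prime δ-nonsquare q∤2
    unital-O'Nan-free = Plane.unital-O'Nan-free q δ q-prime δ-nonsquare q∤2
    _≡ₚ_ : ℤ × ℤ × ℤ → ℤ × ℤ × ℤ → Set
    _≡ₚ_ = Plane._≡₃_ q δ q-prime δ-nonsquare q∤2
    _≡ₗ_ : ℤ × ℤ × ℤ × ℤ → ℤ × ℤ × ℤ × ℤ → Set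
    _≡ₗ_ = Plane._≡₄_ q δ q-prime δ-nonsquare q∤2

    onCircle : Fin q → Fin q → Fin q → Bool
    onCircle k i i′ = does (+ q ℤ.∣? (norm (⟦ i ⟧ +√ ⟦ i′ ⟧) ℤ.- ⟦ k ⟧))

    fibre : Fin q → Fin (q * q) → Bool
    fibre k z = onCircle k (proj₁ (remQuot {q} q z)) (proj₂ (remQuot {q} q z))

    good : Fin q → Bool
    good k = 8 * j ≤ᵇ # (fibre k)

    g : ℕ
    g = # good
    radius : Fin g → Fin q
    radius = proj₁ (select good)

    onCircle-elim : ∀ k i i′ → onCircle k i i′ ≡ true → + q ℤ.∣ norm (⟦ i ⟧ +√ ⟦ i′ ⟧) ℤ.- ⟦ k ⟧
    onCircle-elim k i i′ = does-true (+ q ℤ.∣? (norm (⟦ i ⟧ +√ ⟦ i′ ⟧) ℤ.- ⟦ k ⟧))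

    -- Two solutions `a`, `b` in a row satisfy `δ (a - b) (a + b) ≡ 0`. Here `q` cannot divide `δ`,
    -- which would then be congruent to the square of zero.
    row≤2 : ∀ k i → # (onCircle k i) ≤ 2
    row≤2 k i = #≤2 (onCircle k i) (λ i′ → reduce (ℤ.- ⟦ i′ ⟧)) λ i₁ i₂ h₁ h₂ →
      [ (λ q∣δ → contradiction (subst (+ q ℤ.∣_) (eq₀ δ) (ℤ.∣m⇒∣-m q∣δ)) (δ-nonsquare ℤ.0ℤ))
      , (λ d → [ (λ d → inj₁ (⟦⟧-injective i₁ i₂ d))
               , (λ d → inj₂ (⟦⟧-injective _ i₂ (subst (+ q ℤ.∣_) (eq₂ ⟦ reduce (ℤ.- ⟦ i₁ ⟧) ⟧ ⟦ i₁ ⟧ ⟦ i₂ ⟧) (ℤ.∣m∣n⇒∣m-n (⟦reduce⟧ (ℤ.- ⟦ i₁ ⟧)) d)))) ]′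
               (euclid q-prime δ-nonsquare (⟦ i₁ ⟧ ℤ.- ⟦ i₂ ⟧) (⟦ i₁ ⟧ ℤ.+ ⟦ i₂ ⟧) d)) ]′
      (euclid q-prime δ-nonsquare δ ((⟦ i₁ ⟧ ℤ.- ⟦ i₂ ⟧) ℤ.* (⟦ i₁ ⟧ ℤ.+ ⟦ i₂ ⟧))
        (subst (+ q ℤ.∣_) (eq₁ ⟦ i ⟧ ⟦ i₁ ⟧ ⟦ i₂ ⟧ ⟦ k ⟧ δ) (ℤ.∣m∣n⇒∣m-n (onCircle-elim k i i₂ h₂) (onCircle-elim k i i₁ h₁))))
      where
      eq₀ : ∀ d → ℤ.- d ≡ ℤ.0ℤ ℤ.* ℤ.0ℤ ℤ.- d
      eq₀ = solveℤ-∀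
      eq₁ : ∀ i a b k d → (i ℤ.* i ℤ.- d ℤ.* (b ℤ.* b) ℤ.- k) ℤ.- (i ℤ.* i ℤ.- d ℤ.* (a ℤ.* a) ℤ.- k) ≡ d ℤ.* ((a ℤ.- b) ℤ.* (a ℤ.+ b))
      eq₁ = solveℤ-∀
      eq₂ : ∀ r a b → (r ℤ.- ℤ.- a) ℤ.- (a ℤ.+ b) ≡ r ℤ.- b
      eq₂ = solveℤ-∀

    fibre≤ : ∀ k → # (fibre k) ≤ q * 2
    fibre≤ k = begin
      # (fibre k) ≡⟨ ∑-combine q (𝟙 ∘ fibre k) ⟩
      ∑ (allFin q) (λ i → ∑ (allFin q) (λ i′ → 𝟙 (fibre k (combine i i′))))
        ≡⟨ ∑-cong (allFin q) (λ i → ∑-cong (allFin q) (λ i′ → cong (λ z → 𝟙 (onCircle k (proj₁ z) (proj₂ z))) (Fin.remQuot-combine i i′))) ⟩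
      ∑ (allFin q) (λ i → # (onCircle k i)) ≤⟨ ∑-mono (allFin q) (row≤2 k) ⟩
      ∑ (allFin q) (λ i → 2) ≡⟨ ∑-allFin-const q 2 ⟩
      q * 2 ∎
      where open ≤-Reasoning

    q²≤∑fibre : q * q ≤ ∑ (allFin q) (λ k → # (fibre k))
    q²≤∑fibre = begin
      q * q ≡⟨ trans (∑-allFin-const (q * q) 1) (*-identityʳ (q * q)) ⟨
      ∑ (allFin (q * q)) (λ z → 1) ≤⟨ ∑-mono (allFin (q * q)) some ⟩
      ∑ (allFin (q * q)) (λ z → # (λ k → fibre k z)) ≡⟨ ∑-comm (allFin (q * q)) (allFin q) _ ⟩
      ∑ (allFin q) (λ k → # (fibre k)) ∎
      where
      open ≤-Reasoning
      some : ∀ z → 1 ≤ # (λ k → fibre k z)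
      some z = ≤-trans (≤-reflexive (cong 𝟙 (sym (dec-true (+ q ℤ.∣? _) d)))) (∑-term (λ k → 𝟙 (fibre k z)) (reduce n))
        where
        n : ℤ
        n = norm (⟦ proj₁ (remQuot {q} q z) ⟧ +√ ⟦ proj₂ (remQuot {q} q z) ⟧)
        d : + q ℤ.∣ n ℤ.- ⟦ reduce n ⟧
        d = subst (+ q ℤ.∣_) (eq ⟦ reduce n ⟧ n) (ℤ.∣m⇒∣-m (⟦reduce⟧ n))
          where
          eq : ∀ a b → ℤ.- (a ℤ.- b) ≡ b ℤ.- a
          eq = solveℤ-∀

    q≤4g : q ≤ 4 * g
    q≤4g = *-cancelʳ-≤ q (4 * g) q (+-cancelʳ-≤ (q * q) _ _ (begin
      q * q + q * q ≤⟨ +-mono-≤ q²≤ q²≤ ⟩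
      (g * (q * 2) + q * (8 * j)) + (g * (q * 2) + q * (8 * j)) ≡⟨ eq g q j ⟩
      4 * g * q + q * (16 * j) ≤⟨ +-monoʳ-≤ (4 * g * q) (*-monoʳ-≤ q 16j≤q) ⟩
      4 * g * q + q * q ∎))
      where
      open ≤-Reasoning
      eq : ∀ g q j → (g * (q * 2) + q * (8 * j)) + (g * (q * 2) + q * (8 * j)) ≡ 4 * g * q + q * (16 * j)
      eq = solve-∀
      threshold : ∀ m {n u} → n ≤ u → n ≤ 𝟙 (m ≤ᵇ n) * u + m
      threshold m {n} {u} n≤u with m ≤ᵇ n in e
      ... | true  = ≤-trans n≤u (≤-trans (≤-reflexive (sym (*-identityˡ u))) (m≤m+n _ m))
      ... | false = <⇒≤ (≰⇒> (λ h → subst T e (≤⇒≤ᵇ h)))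
      q²≤ : q * q ≤ g * (q * 2) + q * (8 * j)
      q²≤ = begin
        q * q ≤⟨ q²≤∑fibre ⟩
        ∑ (allFin q) (λ k → # (fibre k)) ≤⟨ ∑-mono (allFin q) (λ k → threshold (8 * j) (fibre≤ k)) ⟩
        ∑ (allFin q) (λ k → 𝟙 (good k) * (q * 2) + 8 * j) ≡⟨ ∑-+ (allFin q) _ _ ⟩
        ∑ (allFin q) (λ k → 𝟙 (good k) * (q * 2)) + ∑ (allFin q) (λ k → 8 * j)
          ≡⟨ cong₂ _+_ (∑-*ʳ (allFin q) (q * 2) _) (∑-allFin-const q (8 * j)) ⟩
        g * (q * 2) + q * (8 * j) ∎

    decodePoint : Fin (q * (q * q)) → Fin q × Fin q × Fin q
    decodePoint p = let i , r = remQuot {q} (q * q) p in i , remQuot {q} q r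

    point : Fin (q * (q * q)) → ℤ × ℤ × ℤ
    point p = let i , i′ , i″ = decodePoint p in ⟦ i ⟧ , ⟦ i′ ⟧ , ⟦ i″ ⟧

    decodeLine : Fin (q * (q * (q * g))) → Fin q × Fin q × Fin q × Fin g
    decodeLine l = let i , r = remQuot {q} (q * (q * g)) l ; i′ , r′ = remQuot {q} (q * g) r in i , i′ , remQuot {q} g r′

    line : Fin (q * (q * (q * g))) → ℤ × ℤ × ℤ × ℤ
    line l = let i , i′ , i″ , k = decodeLine l in ⟦ i ⟧ , ⟦ i′ ⟧ , ⟦ i″ ⟧ , ⟦ radius k ⟧

    remQuot-injective : ∀ {m} n (x y : Fin (m * n)) → proj₁ (remQuot {m} n x) ≡ proj₁ (remQuot {m} n y) →
      proj₂ (remQuot {m} n x) ≡ proj₂ (remQuot {m} n y) → x ≡ y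
    remQuot-injective {m} n x y e f = trans (sym (Fin.combine-remQuot {m} n x)) (trans (cong₂ combine e f) (Fin.combine-remQuot {m} n y))

    decodePoint-injective : ∀ p p′ → point p ≡ₚ point p′ → p ≡ p′
    decodePoint-injective p p′ (d , d′ , d″) = remQuot-injective (q * q) p p′ (⟦⟧-injective _ _ d)
      (remQuot-injective q _ _ (⟦⟧-injective _ _ d′) (⟦⟧-injective _ _ d″))

    decodeLine-injective : ∀ l l′ → line l ≡ₗ line l′ → l ≡ l′
    decodeLine-injective l l′ (d , d′ , d″ , dk) = remQuot-injective (q * (q * g)) l l′ (⟦⟧-injective _ _ d)
      (remQuot-injective (q * g) _ _ (⟦⟧-injective _ _ d′)
        (remQuot-injective g _ _ (⟦⟧-injective _ _ d″) (proj₁ (proj₂ (select good)) (⟦⟧-injective _ _ dk))))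

    inc? : ∀ P l → Dec (Inc P l)
    inc? (x₀ , x₁ , y) (u₀ , u₁ , c , k) = (+ q ℤ.∣? _) ×-dec (+ q ℤ.∣? _)

    onᵇ : Fin (q * (q * q)) → Fin (q * (q * (q * g))) → Bool
    onᵇ p l = does (inc? (point p) (line l))

    inc : Fin (q * (q * q)) → Fin (q * (q * (q * g))) → Bool
    inc p l = truncate (8 * j) (λ p → onᵇ p l) p

    incident : ∀ p l → inc p l ≡ true → Inc (point p) (line l)
    incident p l h = does-true (inc? (point p) (line l)) (truncate-sound (8 * j) (λ p → onᵇ p l) p h)

    -- Translate the circle from the origin to the centre `(u₀ , u₁)`. Over each of its points the
    -- linear equation supplies the third coordinate.
    enough : ∀ l → 8 * j ≤ # (λ p → onᵇ p l)
    enough l = ≤-trans (≤ᵇ⇒≤ (8 * j) _ (subst T (sym (proj₂ (proj₂ (select good)) (proj₂ (proj₂ (proj₂ (decodeLine l)))))) tt))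
      (#-injection f f-injective f-incident)
      where
      u₀ u₁ c k : ℤ
      u₀ = proj₁ (line l)
      u₁ = proj₁ (proj₂ (line l))
      c  = proj₁ (proj₂ (proj₂ (line l)))
      k  = proj₂ (proj₂ (proj₂ (line l)))
      x₀ x₁ : Fin (q * q) → Fin q
      x₀ z = reduce (⟦ proj₁ (remQuot {q} q z) ⟧ ℤ.+ u₀)
      x₁ z = reduce (⟦ proj₂ (remQuot {q} q z) ⟧ ℤ.+ u₁)
      y : Fin (q * q) → ℤ
      y z = c ℤ.+ (u₀ ℤ.* ⟦ x₁ z ⟧ ℤ.- u₁ ℤ.* ⟦ x₀ z ⟧)
      f : Fin (q * q) → Fin (q * (q * q))
      f z = combine (x₀ z) (combine (x₁ z) (reduce (y z)))

      shift-injective : ∀ i i′ u → reduce (⟦ i ⟧ ℤ.+ u) ≡ reduce (⟦ i′ ⟧ ℤ.+ u) → i ≡ i′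
      shift-injective i i′ u e = ⟦⟧-injective i i′ (subst (+ q ℤ.∣_) (eq ⟦ i ⟧ ⟦ i′ ⟧ u ⟦ reduce (⟦ i ⟧ ℤ.+ u) ⟧)
        (ℤ.∣m∣n⇒∣m-n (subst (λ r → + q ℤ.∣ ⟦ r ⟧ ℤ.- (⟦ i′ ⟧ ℤ.+ u)) (sym e) (⟦reduce⟧ (⟦ i′ ⟧ ℤ.+ u))) (⟦reduce⟧ (⟦ i ⟧ ℤ.+ u))))
        where
        eq : ∀ a b u r → (r ℤ.- (b ℤ.+ u)) ℤ.- (r ℤ.- (a ℤ.+ u)) ≡ a ℤ.- b
        eq = solveℤ-∀

      f-injective : Injective _≡_ _≡_ f
      f-injective {z} {z′} e =
        let e₀ , e′ = Fin.combine-injective (x₀ z) _ (x₀ z′) _ e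
            e₁ , _  = Fin.combine-injective (x₁ z) _ (x₁ z′) _ e′
        in remQuot-injective q z z′ (shift-injective _ _ u₀ e₀) (shift-injective _ _ u₁ e₁)

      point-f : ∀ z → point (f z) ≡ (⟦ x₀ z ⟧ , ⟦ x₁ z ⟧ , ⟦ reduce (y z) ⟧)
      point-f z = cong (λ { (i , i′ , i″) → ⟦ i ⟧ , ⟦ i′ ⟧ , ⟦ i″ ⟧ })
        (trans (cong (λ r → proj₁ r , remQuot {q} q (proj₂ r)) (Fin.remQuot-combine {q} (x₀ z) (combine (x₁ z) (reduce (y z)))))
               (cong (x₀ z ,_) (Fin.remQuot-combine {q} (x₁ z) (reduce (y z)))))

      f-incident : ∀ z → fibre (radius (proj₂ (proj₂ (proj₂ (decodeLine l))))) z ≡ true → onᵇ (f z) l ≡ true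
      f-incident z h = dec-true (inc? (point (f z)) (line l)) (subst (λ P → Inc P (line l)) (sym (point-f z))
        ( subst (+ q ℤ.∣_) (eq ⟦ x₀ z ⟧ ⟦ x₁ z ⟧ u₀ u₁ z₀ z₁ k δ)
            (ℤ.∣m∣n⇒∣m+n (onCircle-elim (radius (proj₂ (proj₂ (proj₂ (decodeLine l))))) (proj₁ (remQuot {q} q z)) (proj₂ (remQuot {q} q z)) h) (ℤ.∣m∣n⇒∣m-n
              (ℤ.∣m⇒∣m*n (⟦ x₀ z ⟧ ℤ.- u₀ ℤ.+ z₀) (⟦reduce⟧ (z₀ ℤ.+ u₀)))
              (ℤ.∣n⇒∣m*n δ (ℤ.∣m⇒∣m*n (⟦ x₁ z ⟧ ℤ.- u₁ ℤ.+ z₁) (⟦reduce⟧ (z₁ ℤ.+ u₁))))))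
        , ⟦reduce⟧ (y z)))
        where
        z₀ z₁ : ℤ
        z₀ = ⟦ proj₁ (remQuot {q} q z) ⟧
        z₁ = ⟦ proj₂ (remQuot {q} q z) ⟧
        eq : ∀ x₀ x₁ u₀ u₁ z₀ z₁ k δ →
          (z₀ ℤ.* z₀ ℤ.- δ ℤ.* (z₁ ℤ.* z₁) ℤ.- k) ℤ.+
            ((x₀ ℤ.- (z₀ ℤ.+ u₀)) ℤ.* (x₀ ℤ.- u₀ ℤ.+ z₀) ℤ.- δ ℤ.* ((x₁ ℤ.- (z₁ ℤ.+ u₁)) ℤ.* (x₁ ℤ.- u₁ ℤ.+ z₁))) ≡
          ((x₀ ℤ.- u₀) ℤ.* (x₀ ℤ.- u₀) ℤ.- δ ℤ.* ((x₁ ℤ.- u₁) ℤ.* (x₁ ℤ.- u₁))) ℤ.- k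
        eq = solveℤ-∀

-- The graph of a design and its independent tuples

module _ {q j} (D : Design q j) where
  open Design D
  open Bipartitions inc

  -- Three pairwise adjacent lines through one point would need three pairwise different colours
  -- there, so four pairwise adjacent lines meet in six points: an O'Nan configuration.
  K₄-free : ∀ b (g : Fin 4 → Fin N) → ¬ (∀ i k → i ≢ k → edge b (g i) (g k) ≡ true)
  K₄-free b g h = O'Nan-free (l 0F) (l 1F) (l 2F) (l 3F) (proj₁ e₀₁) (proj₁ e₀₂) (proj₁ e₁₂) (proj₁ e₀₃) (proj₁ e₁₃) (proj₁ e₂₃)
    (left e₀₁) (left e₀₂) (left e₀₃) (right e₀₁) (left e₁₂) (left e₁₃) (right e₀₂) (right e₁₂) (left e₂₃) (right e₀₃) (right e₁₃) (right e₂₃)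
    (distinct e₀₃) (distinct e₁₃) (distinct e₂₃) (distinct (flip e₀₂))
    (fork e₀₁ e₀₂ e₁₂) (fork (flip e₀₂) (flip e₁₂) e₀₁) (fork e₀₁ e₀₃ e₁₃) (fork (flip e₀₂) e₂₃ e₀₃) (fork e₁₃ e₁₂ (flip e₂₃))
    where
    0F 1F 2F 3F : Fin 4
    0F = zero
    1F = suc zero
    2F = suc (suc zero)
    3F = suc (suc (suc zero))
    l : Fin 4 → Fin N
    l = g
    Edge : Fin N → Fin N → Set
    Edge u v = ∃ λ p → edgeAt b p u v ≡ true
    e : ∀ i k → i ≢ k → Edge (g i) (g k)
    e i k i≢k = edge-elim b (g i) (g k) (h i k i≢k)
    e₀₁ = e 0F 1F (λ ())
    e₀₂ = e 0F 2F (λ ())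
    e₀₃ = e 0F 3F (λ ())
    e₁₂ = e 1F 2F (λ ())
    e₁₃ = e 1F 3F (λ ())
    e₂₃ = e 2F 3F (λ ())
    flip : ∀ {u v} → Edge u v → Edge v u
    flip {u} {v} (p , x) = p , trans (edgeAt-sym b p v u) x
    left : ∀ {u v} (x : Edge u v) → inc (proj₁ x) u ≡ true
    left {u} {v} (p , x) = proj₁ (edgeAt-elim b p u v x)
    right : ∀ {u v} (x : Edge u v) → inc (proj₁ x) v ≡ true
    right {u} {v} (p , x) = proj₁ (proj₂ (edgeAt-elim b p u v x))
    colours : ∀ {u v} (x : Edge u v) → colour b (proj₁ x) u xor colour b (proj₁ x) v ≡ true
    colours {u} {v} (p , x) = proj₂ (proj₂ (edgeAt-elim b p u v x))
    distinct : ∀ {u v} → Edge u v → u ≢ v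
    distinct {u} x refl = case trans (sym (colours x)) (Bool.xor-same (colour b (proj₁ x) u)) of λ ()
    three : ∀ c₁ c₂ c₃ → c₁ xor c₂ ≡ true → c₁ xor c₃ ≡ true → c₂ xor c₃ ≡ true → ⊥
    three true false false _ _ ()
    three true true _ ()
    three true false true _ ()
    three false true true _ _ ()
    three false false _ ()
    three false true false _ ()
    fork : ∀ {u v w} (x : Edge u v) (y : Edge u w) → Edge v w → proj₁ x ≢ proj₁ y
    fork {u} {v} {w} x y z x≡y = three (colour b p u) (colour b p v) (colour b p w) (colours x)
      (subst (λ r → colour b r u xor colour b r w ≡ true) (sym x≡y) (colours y))
      (subst (λ r → colour b r v xor colour b r w ≡ true) (sym p≡z) (colours z))
      where
      p : Fin (q * (q * q))
      p = proj₁ x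
      p≡z : p ≡ proj₁ z
      p≡z = linear p (proj₁ z) v w (right x) (subst (λ r → inc r w ≡ true) (sym x≡y) (right y)) (left z) (right z) (distinct z)

-- Bernoulli's inequality `1 + n / x ≤ (1 + 1 / x) ^ n` without denominators.
+^≤*suc^ : ∀ x n → (x + n) * x ^ n ≤ x * suc x ^ n
+^≤*suc^ x zero    = ≤-reflexive (cong (_* 1) (+-identityʳ x))
+^≤*suc^ x (suc n) = begin
  (x + suc n) * (x * x ^ n)     ≤⟨ m≤m+n _ (n * x ^ n) ⟩
  (x + suc n) * (x * x ^ n) + n * x ^ n ≡⟨ eq₁ x n (x ^ n) ⟩
  suc x * ((x + n) * x ^ n)     ≤⟨ *-monoʳ-≤ (suc x) (+^≤*suc^ x n) ⟩
  suc x * (x * suc x ^ n)       ≡⟨ eq₂ x (suc x ^ n) ⟩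
  x * suc x ^ suc n             ∎
  where
  open ≤-Reasoning
  eq₁ : ∀ x n y → (x + (1 + n)) * (x * y) + n * y ≡ (1 + x) * ((x + n) * y)
  eq₁ = solve-∀
  eq₂ : ∀ x y → (1 + x) * (x * y) ≡ x * ((1 + x) * y)
  eq₂ = solve-∀

2*^≤suc^ : ∀ x → 2 * x ^ suc x ≤ suc x ^ suc x
2*^≤suc^ zero = z≤n
2*^≤suc^ x@(suc _) = *-cancelˡ-≤ x (begin
  x * (2 * x ^ suc x)     ≡⟨ eq x (x ^ suc x) ⟩
  (x + x) * x ^ suc x     ≤⟨ *-monoˡ-≤ (x ^ suc x) (+-monoʳ-≤ x (n≤1+n x)) ⟩
  (x + suc x) * x ^ suc x ≤⟨ +^≤*suc^ x (suc x) ⟩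
  x * suc x ^ suc x       ∎)
  where
  open ≤-Reasoning
  eq : ∀ x y → x * (2 * y) ≡ (x + x) * y
  eq = solve-∀

-- Each block of `suc x` factors `x / suc x` is at most one half. With `x = β` it tells how many
-- uses of a dense vertex shrink the candidates by `2 ^ h`.
halvings : ∀ x h → 2 ^ h * x ^ (suc x * h) ≤ suc x ^ (suc x * h)
halvings x h = begin
  2 ^ h * x ^ (suc x * h)   ≡⟨ cong (2 ^ h *_) (^-*-assoc x (suc x) h) ⟨
  2 ^ h * (x ^ suc x) ^ h   ≡⟨ ^-distribʳ-* 2 (x ^ suc x) h ⟨
  (2 * x ^ suc x) ^ h       ≤⟨ ^-monoˡ-≤ h (2*^≤suc^ x) ⟩
  (suc x ^ suc x) ^ h       ≡⟨ ^-*-assoc (suc x) (suc x) h ⟩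
  suc x ^ (suc x * h)       ∎
  where open ≤-Reasoning

module _ {q j} (D : Design q j) .{{q≢0 : NonZero q}} .{{_ : NonZero j}} (q≤128j : q ≤ 128 * j) (large-j : 2 * Design.N D < 2 ^ j) where
  open Design D
  open Bipartitions inc

  private
    r β : ℕ
    -- There are `q³` points. With `q ≤ 128 * j` these values give `q³ ≤ j * r` for the union bound
    -- and `q³ ≤ (1 + β) * j²` for the density.
    r = 128 * (q * q)
    β = pred (128 * 128 * q)
    instance
      r≢0 : NonZero r
      r≢0 = m*n≢0 128 (q * q) {{_}} {{m*n≢0 q q}}
    1+β : suc β ≡ 128 * 128 * q
    1+β = suc-pred (128 * 128 * q) {{m*n≢0 (128 * 128) q}}

    q³≤jr : q * (q * q) ≤ j * r
    q³≤jr = ≤-trans (*-monoˡ-≤ (q * q) q≤128j) (≤-reflexive (eq 128 j (q * q)))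
      where
      eq : ∀ c j x → c * j * x ≡ j * (c * x)
      eq = solve-∀

    q³≤ : q * (q * q) ≤ suc β * (j * j)
    q³≤ = ≤-trans (*-monoʳ-≤ q (*-mono-≤ q≤128j q≤128j)) (≤-reflexive (trans (eq q 128 j) (cong (_* (j * j)) (sym 1+β))))
      where
      eq : ∀ q c j → q * (c * j * (c * j)) ≡ c * c * q * (j * j)
      eq = solve-∀

  -- From at most `q⁴` candidates, `(1 + β) * h` uses of a dense vertex leave at most
  -- `q⁴ / 2 ^ h ≤ r`; this is the number `k` of uses in `tuples-bound`. The bipartitions are fixed
  -- before `h` and `t`.
  independent-tuples : ∃ λ b → ∀ h t → q * q ≤ 2 ^ h →
    tuples (λ u v → not (edge b u v)) t everything ≤ (1 + N * t) ^ (128 * 128 * q * h) * r ^ t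
  independent-tuples =
    let b , balanced = balanced-colouring j degree r q³≤jr large-j
        R : Fin N → Fin N → Bool
        R u v = not (edge b u v)
    in b , λ h t q²≤2^h → subst (λ k → tuples R t everything ≤ (1 + N * t) ^ (k * h) * r ^ t) 1+β
      (tuples-bound R (λ u v → cong not (edge-sym b u v)) r (suc β) β
        (λ a r≤#a → balanced⇒dense j degree linear a b β q³≤ (balanced a r≤#a))
        (suc β * h) t everything (begin
          # {N} everything * β ^ (suc β * h) ≤⟨ *-monoˡ-≤ (β ^ (suc β * h)) (begin
            # {N} everything       ≤⟨ #≤n {N} everything ⟩
            N                      ≤⟨ N≤q⁴ ⟩
            q * (q * (q * q))      ≡⟨ *-assoc q q (q * q) ⟨
            q * q * (q * q)        ≤⟨ *-mono-≤ (m≤n*m (q * q) 128) q²≤2^h ⟩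
            r * 2 ^ h              ∎) ⟩
          r * 2 ^ h * β ^ (suc β * h)        ≡⟨ *-assoc r (2 ^ h) _ ⟩
          r * (2 ^ h * β ^ (suc β * h))      ≤⟨ *-monoʳ-≤ r (halvings β h) ⟩
          r * suc β ^ (suc β * h)            ∎))
    where open ≤-Reasoning

  -- The condition on `q` makes the number of choices, a power of `1 + N * t ≤ 2 ^ (5 * ℓ)`, at most
  -- `2 ^ t`, which leaves at most `(2 * r) ^ t` independent tuples. The constant 1024 is `4 * 256`,
  -- from `q⁴ ≤ 4 * N` and `2 * r = 256 * q²`.
  design⇒cliques : ∀ {n} (G : Graph n) t ℓ d → t < 2 ^ ℓ → q < 2 ^ ℓ →
    128 * 128 * q * (2 * ℓ) * (5 * ℓ) ≤ t → 1024 * d ≤ q * q → IsRamsey 4 t G → d ^ t ≤ cliqueCount G t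
  design⇒cliques G t ℓ d t<2^ℓ q<2^ℓ small-q d-small ramsey =
    *-cancelʳ-≤ (d ^ t) (cliqueCount G t) ((2 * r) ^ t) {{m^n≢0 (2 * r) t {{m*n≢0 2 r}}}} (begin
      d ^ t * (2 * r) ^ t    ≡⟨ ^-distribʳ-* d (2 * r) t ⟨
      (d * (2 * r)) ^ t      ≤⟨ ^-monoˡ-≤ t d*2r≤N ⟩
      N ^ t                  ≤⟨ ramsey⇒power≤ (edge b) (edge-sym b) (K₄-free D b) G t {{N≢0}} ramsey ⟩
      cliqueCount G t * tuples (λ u v → not (edge b u v)) t everything
        ≤⟨ *-monoʳ-≤ (cliqueCount G t) (proj₂ independent-tuples (2 * ℓ) t q²≤) ⟩
      cliqueCount G t * ((1 + N * t) ^ (128 * 128 * q * (2 * ℓ)) * r ^ t)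
        ≤⟨ *-monoʳ-≤ (cliqueCount G t) (*-monoˡ-≤ (r ^ t) choices≤2^t) ⟩
      cliqueCount G t * (2 ^ t * r ^ t)
        ≡⟨ cong (cliqueCount G t *_) (^-distribʳ-* 2 r t) ⟨
      cliqueCount G t * (2 * r) ^ t ∎)
    where
    open ≤-Reasoning
    b : Colouring
    b = proj₁ independent-tuples
    q≤ : q ≤ 2 ^ ℓ
    q≤ = <⇒≤ q<2^ℓ
    q²≤ : q * q ≤ 2 ^ (2 * ℓ)
    q²≤ = ≤-trans (*-mono-≤ q≤ q≤) (≤-reflexive (trans (sym (^-distribˡ-+-* 2 ℓ ℓ)) (cong (λ x → 2 ^ (ℓ + x)) (sym (+-identityʳ ℓ)))))
    d*2r≤N : d * (2 * r) ≤ N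
    d*2r≤N = *-cancelˡ-≤ 4 (begin
      4 * (d * (2 * (128 * (q * q)))) ≡⟨ eq d (q * q) ⟩
      1024 * d * (q * q)     ≤⟨ *-monoˡ-≤ (q * q) d-small ⟩
      q * q * (q * q)        ≡⟨ *-assoc q q (q * q) ⟩
      q * (q * (q * q))      ≤⟨ q⁴≤4N ⟩
      4 * N                  ∎)
      where
      eq : ∀ d x → 4 * (d * (2 * (128 * x))) ≡ 1024 * d * x
      eq = solve-∀
    N≢0 : NonZero N
    N≢0 = >-nonZero (*-cancelˡ-< 4 0 N (≤-trans (>-nonZero⁻¹ (q * (q * (q * q))) {{m*n≢0 q (q * (q * q)) {{q≢0}} {{m*n≢0 q (q * q) {{q≢0}} {{m*n≢0 q q}}}}}}) q⁴≤4N))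
    choice≤ : 1 + N * t ≤ 2 ^ (5 * ℓ)
    choice≤ = begin
      1 + N * t                   ≤⟨ +-mono-≤ (>-nonZero⁻¹ (2 ^ (4 * ℓ)) {{m^n≢0 2 (4 * ℓ)}}) (*-monoˡ-≤ t (≤-trans N≤q⁴ q⁴≤)) ⟩
      2 ^ (4 * ℓ) + 2 ^ (4 * ℓ) * t ≡⟨ *-suc (2 ^ (4 * ℓ)) t ⟨
      2 ^ (4 * ℓ) * suc t         ≤⟨ *-monoʳ-≤ (2 ^ (4 * ℓ)) t<2^ℓ ⟩
      2 ^ (4 * ℓ) * 2 ^ ℓ         ≡⟨ ^-distribˡ-+-* 2 (4 * ℓ) ℓ ⟨
      2 ^ (4 * ℓ + ℓ)             ≡⟨ cong (2 ^_) (+-comm (4 * ℓ) ℓ) ⟩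
      2 ^ (5 * ℓ)                 ∎
      where
      q⁴≤ : q * (q * (q * q)) ≤ 2 ^ (4 * ℓ)
      q⁴≤ = ≤-trans (*-mono-≤ q≤ (*-mono-≤ q≤ (*-mono-≤ q≤ q≤))) (≤-reflexive
        (trans (eq (2 ^ ℓ)) (trans (^-*-assoc 2 ℓ 4) (cong (2 ^_) (*-comm ℓ 4)))))
        where
        eq : ∀ x → x * (x * (x * x)) ≡ x * (x * (x * (x * 1)))
        eq = solve-∀
    choices≤2^t : (1 + N * t) ^ (128 * 128 * q * (2 * ℓ)) ≤ 2 ^ t
    choices≤2^t = begin
      (1 + N * t) ^ (128 * 128 * q * (2 * ℓ))    ≤⟨ ^-monoˡ-≤ (128 * 128 * q * (2 * ℓ)) choice≤ ⟩
      (2 ^ (5 * ℓ)) ^ (128 * 128 * q * (2 * ℓ))  ≡⟨ ^-*-assoc 2 (5 * ℓ) _ ⟩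
      2 ^ (5 * ℓ * (128 * 128 * q * (2 * ℓ)))    ≡⟨ cong (2 ^_) (*-comm (5 * ℓ) (128 * 128 * q * (2 * ℓ))) ⟩
      2 ^ (128 * 128 * q * (2 * ℓ) * (5 * ℓ))    ≤⟨ ^-monoʳ-≤ 2 small-q ⟩
      2 ^ t                                      ∎

-- Primes in dyadic intervals

nCk≤2^n : ∀ n k → n C k ≤ 2 ^ n
nCk≤2^n zero zero       = ≤-refl
nCk≤2^n zero (suc k)    = ≤-trans (≤-reflexive (k>n⇒nCk≡0 {0} {suc k} z<s)) z≤n
nCk≤2^n (suc n) zero    = m^n>0 2 (suc n)
nCk≤2^n (suc n) (suc k) = begin
  suc n C suc k         ≡⟨ nCk+nC[k+1]≡[n+1]C[k+1] n k ⟨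
  n C k + n C suc k     ≤⟨ +-mono-≤ (nCk≤2^n n k) (nCk≤2^n n (suc k)) ⟩
  2 ^ n + 2 ^ n         ≡⟨ cong (2 ^ n +_) (+-identityʳ (2 ^ n)) ⟨
  2 ^ suc n             ∎
  where open ≤-Reasoning

C-absorption : ∀ n k → suc k * (suc n C suc k) ≡ suc n * (n C k)
C-absorption n zero = trans (*-identityˡ _) (trans (nC1≡n (suc n)) (sym (*-identityʳ (suc n))))
C-absorption zero (suc k) = trans (cong (suc (suc k) *_) (k>n⇒nCk≡0 {1} {suc (suc k)} (s<s z<s)))
  (trans (*-zeroʳ (suc (suc k))) (sym (trans (*-identityˡ _) (k>n⇒nCk≡0 {0} {suc k} z<s))))
C-absorption (suc n) (suc k) = begin
  suc (suc k) * (suc (suc n) C suc (suc k))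
    ≡⟨ cong (suc (suc k) *_) (nCk+nC[k+1]≡[n+1]C[k+1] (suc n) (suc k)) ⟨
  suc (suc k) * (c + suc n C suc (suc k))
    ≡⟨ *-distribˡ-+ (suc (suc k)) c _ ⟩
  (c + suc k * c) + suc (suc k) * (suc n C suc (suc k))
    ≡⟨ cong₂ (λ x y → (c + x) + y) (C-absorption n k) (C-absorption n (suc k)) ⟩
  (c + suc n * (n C k)) + suc n * (n C suc k)
    ≡⟨ trans (+-assoc c _ _) (cong (c +_) (trans (sym (*-distribˡ-+ (suc n) (n C k) _)) (cong (suc n *_) (nCk+nC[k+1]≡[n+1]C[k+1] n k)))) ⟩
  suc (suc n) * c ∎
  where
  open ≡-Reasoning
  c : ℕ
  c = suc n C suc k

C-row-step : ∀ k e → suc k * ((k + e) C suc k) ≡ e * ((k + e) C k)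
C-row-step k e = +-cancelˡ-≡ (suc k * c) _ _ (begin
  suc k * c + suc k * ((k + e) C suc k) ≡⟨ *-distribˡ-+ (suc k) c _ ⟨
  suc k * (c + (k + e) C suc k)         ≡⟨ cong (suc k *_) (nCk+nC[k+1]≡[n+1]C[k+1] (k + e) k) ⟩
  suc k * (suc (k + e) C suc k)         ≡⟨ C-absorption (k + e) k ⟩
  suc (k + e) * c                       ≡⟨ *-distribʳ-+ c (suc k) e ⟩
  suc k * c + e * c                     ∎)
  where
  open ≡-Reasoning
  c : ℕ
  c = (k + e) C k

2^n≤2nCn : ∀ n → 2 ^ n ≤ (n + n) C n
2^n≤2nCn zero    = ≤-refl
2^n≤2nCn (suc n) = begin
  2 ^ n + (2 ^ n + 0)                      ≡⟨ cong (2 ^ n +_) (+-identityʳ (2 ^ n)) ⟩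
  2 ^ n + 2 ^ n                            ≤⟨ +-mono-≤ (2^n≤2nCn n) (2^n≤2nCn n) ⟩
  (n + n) C n + (n + n) C n                ≤⟨ +-mono-≤ (below n) above ⟩
  suc (n + n) C n + suc (n + n) C suc n    ≡⟨ nCk+nC[k+1]≡[n+1]C[k+1] (suc (n + n)) n ⟩
  suc (suc (n + n)) C suc n                ≡⟨ cong (λ m → suc m C suc n) (+-suc n n) ⟨
  (suc n + suc n) C suc n                  ∎
  where
  open ≤-Reasoning
  above : (n + n) C n ≤ suc (n + n) C suc n
  above = ≤-trans (m≤m+n _ _) (≤-reflexive (nCk+nC[k+1]≡[n+1]C[k+1] (n + n) n))
  below : ∀ n → (n + n) C n ≤ suc (n + n) C n
  below zero    = ≤-refl
  below (suc n) = ≤-trans (m≤n+m _ _) (≤-reflexive (nCk+nC[k+1]≡[n+1]C[k+1] (suc n + suc n) n))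

-- Leibniz's harmonic triangle 1/(k·C(n,k)): each entry is a difference of two entries further up,
-- so a common multiple of 1, …, n clears all the denominators in its first n rows.
k*nCk∣ : ∀ d k n → k < n → (∀ i → 1 ≤ i → i ≤ n → i ∣ d) → suc k * (n C suc k) ∣ d
k*nCk∣ d zero n k<n h = subst (_∣ d) (sym (trans (*-identityˡ _) (nC1≡n n))) (h n k<n ≤-refl)
k*nCk∣ d (suc k) (suc m) (s≤s k<m) h
  with k*nCk∣ d k (suc m) (m≤n⇒m≤1+n k<m) h | k*nCk∣ d k m k<m (λ i 1≤i i≤m → h i 1≤i (m≤n⇒m≤1+n i≤m)) | m≤n⇒∃[o]m+o≡n (<⇒≤ k<m)
... | divides x d≡x | divides y d≡y | e , refl =
  ∣m+n∣m⇒∣n (subst (Q ∣_) key (n∣m*n y)) (n∣m*n x)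
  where
  open ≡-Reasoning
  w Q : ℕ
  w = (k + e) C k
  Q = suc (suc k) * (suc (k + e) C suc (suc k))
  jQ : suc k * Q ≡ suc (k + e) * (e * w)
  jQ = begin
    suc k * Q                              ≡⟨ cong (suc k *_) (C-absorption (k + e) (suc k)) ⟩
    suc k * (suc (k + e) * ((k + e) C suc k)) ≡⟨ eq (suc k) (suc (k + e)) _ ⟩
    suc (k + e) * (suc k * ((k + e) C suc k)) ≡⟨ cong (suc (k + e) *_) (C-row-step k e) ⟩
    suc (k + e) * (e * w)                  ∎
    where
    eq : ∀ a b c → a * (b * c) ≡ b * (a * c)
    eq = solve-∀
  d₁ : d ≡ x * (suc (k + e) * w)
  d₁ = trans d≡x (cong (x *_) (C-absorption (k + e) k))
  d₂ : d ≡ y * (e * w)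
  d₂ = trans d≡y (cong (y *_) (C-row-step k e))
  key : y * Q ≡ x * Q + d
  key = *-cancelˡ-≡ _ _ (suc k) (begin
    suc k * (y * Q)                        ≡⟨ eq₁ (suc k) y Q ⟩
    y * (suc k * Q)                        ≡⟨ cong (y *_) jQ ⟩
    y * (suc (k + e) * (e * w))            ≡⟨ eq₁ y (suc (k + e)) (e * w) ⟩
    suc (k + e) * (y * (e * w))            ≡⟨ cong (suc (k + e) *_) d₂ ⟨
    suc (k + e) * d                        ≡⟨ *-distribʳ-+ d (suc k) e ⟩
    suc k * d + e * d                      ≡⟨ cong (λ z → suc k * d + e * z) d₁ ⟩
    suc k * d + e * (x * (suc (k + e) * w)) ≡⟨ cong (suc k * d +_) (eq₂ e x (suc (k + e)) w) ⟩
    suc k * d + x * (suc (k + e) * (e * w)) ≡⟨ cong (λ z → suc k * d + x * z) jQ ⟨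
    suc k * d + x * (suc k * Q)            ≡⟨ eq₃ (suc k) d x Q ⟩
    suc k * (x * Q + d)                    ∎)
    where
    eq₁ : ∀ a b c → a * (b * c) ≡ b * (a * c)
    eq₁ = solve-∀
    eq₂ : ∀ e x m w → e * (x * (m * w)) ≡ x * (m * (e * w))
    eq₂ = solve-∀
    eq₃ : ∀ a d x q → a * d + x * (a * q) ≡ a * (x * q + d)
    eq₃ = solve-∀

-- The middle of row `n + n` in the harmonic triangle: even `n` times the binomial coefficient
-- divides `d`.
2nCn≤common-multiple : ∀ d n → .{{NonZero d}} → 0 < n → (∀ i → 1 ≤ i → i ≤ n + n → i ∣ d) → (n + n) C n ≤ d
2nCn≤common-multiple d (suc n) _ h = ∣⇒≤ (∣-trans (n∣m*n (suc n)) (k*nCk∣ d n (suc n + suc n) (s≤s (m≤m+n n _)) h))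

prime∣!⇒≤ : ∀ {p} n → Prime p → p ∣ n ! → p ≤ n
prime∣!⇒≤ {p} zero p-prime h = contradiction (∣1⇒≡1 h) (nonTrivial⇒≢1 {{prime⇒nonTrivial p-prime}})
prime∣!⇒≤ (suc n) p-prime h with euclidsLemma (suc n) (n !) p-prime h
... | inj₁ p∣ = ∣⇒≤ p∣
... | inj₂ p∣ = m≤n⇒m≤1+n (prime∣!⇒≤ n p-prime p∣)

m∣n! : ∀ {m n} → 1 ≤ m → m ≤ n → m ∣ n !
m∣n! {suc m} 1≤m m≤n = ∣-trans (m∣m*n (m !)) (m≤n⇒m!∣n! m≤n)

-- `p` divides `(n + n) !`, which is the binomial coefficient times `n ! * n !`, and being larger
-- than `n` it divides neither factorial.
prime∣2nCn : ∀ {p} n → Prime p → n < p → p ≤ n + n → p ∣ (n + n) C n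
prime∣2nCn {p} n p-prime n<p p≤2n
  with euclidsLemma ((n + n) C n) (n ! * n !) p-prime
    (subst (p ∣_) (sym C*!) (m∣n! (≤-trans (s≤s z≤n) n<p) p≤2n))
  where
  instance
    _ = n !* n !≢0
  C*! : ((n + n) C n) * (n ! * n !) ≡ (n + n) !
  C*! = trans (cong (_* (n ! * n !)) (trans (nCk≡n!/k![n-k]! (m≤m+n n n)) (/-congʳ {{_}} {{_}} (cong (λ k → n ! * k !) (m+n∸m≡n n n)))))
    (m/n*n≡m (subst (λ k → n ! * k ! ∣ (n + n) !) (m+n∸m≡n n n) (k![n∸k]!∣n! (m≤m+n n n))))
... | inj₁ h = h
... | inj₂ h with euclidsLemma (n !) (n !) p-prime h
...   | inj₁ h′ = contradiction (prime∣!⇒≤ n p-prime h′) (<⇒≱ n<p)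
...   | inj₂ h′ = contradiction (prime∣!⇒≤ n p-prime h′) (<⇒≱ n<p)

-- A stand-in for the product of the primes up to `2 ^ e`: the primes between `2 ^ i` and
-- `2 ^ suc i` divide the factor with index `i`, and the exponents of the factors form a geometric
-- sum, so that the product is at most `4 ^ (2 ^ e)`.
centralProduct : ℕ → ℕ
centralProduct zero    = 1
centralProduct (suc e) = ((2 ^ e + 2 ^ e) C 2 ^ e) * centralProduct e

2^[1+n]≡ : ∀ n → 2 ^ suc n ≡ 2 ^ n + 2 ^ n
2^[1+n]≡ n = cong (2 ^ n +_) (+-identityʳ (2 ^ n))

centralProduct≤ : ∀ e → centralProduct e ≤ 2 ^ (2 ^ e + 2 ^ e)
centralProduct≤ zero    = ≤ᵇ⇒≤ 1 4 tt
centralProduct≤ (suc e) = begin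
  ((2 ^ e + 2 ^ e) C 2 ^ e) * centralProduct e     ≤⟨ *-mono-≤ (nCk≤2^n (2 ^ e + 2 ^ e) (2 ^ e)) (centralProduct≤ e) ⟩
  2 ^ (2 ^ e + 2 ^ e) * 2 ^ (2 ^ e + 2 ^ e)        ≡⟨ ^-distribˡ-+-* 2 (2 ^ e + 2 ^ e) _ ⟨
  2 ^ ((2 ^ e + 2 ^ e) + (2 ^ e + 2 ^ e))          ≡⟨ cong (λ x → 2 ^ (x + x)) (2^[1+n]≡ e) ⟨
  2 ^ (2 ^ suc e + 2 ^ suc e)                      ∎
  where open ≤-Reasoning

centralProduct≢0 : ∀ e → NonZero (centralProduct e)
centralProduct≢0 zero    = _
centralProduct≢0 (suc e) = m*n≢0 _ _ {{>-nonZero (≤-trans (m^n>0 2 (2 ^ e)) (2^n≤2nCn (2 ^ e)))}} {{centralProduct≢0 e}}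

prime∣centralProduct : ∀ {p} e → Prime p → p ≤ 2 ^ e → p ∣ centralProduct e
prime∣centralProduct {p} zero p-prime p≤ = contradiction p≤ (<⇒≱ (nonTrivial⇒n>1 p {{prime⇒nonTrivial p-prime}}))
prime∣centralProduct {p} (suc e) p-prime p≤ with p ≤? 2 ^ e
... | yes p≤2^e = ∣n⇒∣m*n ((2 ^ e + 2 ^ e) C 2 ^ e) (prime∣centralProduct e p-prime p≤2^e)
... | no  p≰2^e = ∣m⇒∣m*n (centralProduct e) (prime∣2nCn (2 ^ e) p-prime (≰⇒> p≰2^e) (subst (p ≤_) (2^[1+n]≡ e) p≤))

-- Multiply the prime factors until the product exceeds s: this cuts j into three factors ≤ s.
smooth∣!³ : ∀ s u ps → 1 ≤ u → u ≤ s → All Prime ps → All (_≤ s) ps → u * product ps ≤ s * s →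
  u * product ps ∣ s ! * (s ! * s !)
smooth∣!³ s u [] 1≤u u≤s _ _ _ = subst (_∣ s ! * (s ! * s !)) (sym (*-identityʳ u)) (∣m⇒∣m*n _ (m∣n! 1≤u u≤s))
smooth∣!³ s u (p ∷ ps) 1≤u u≤s (p-prime ∷ primes) (p≤s ∷ smalls) h with u * p ≤? s
... | yes up≤s = subst (_∣ s ! * (s ! * s !)) (*-assoc u p (product ps))
  (smooth∣!³ s (u * p) ps (*-mono-≤ 1≤u (prime>0 p-prime)) up≤s primes smalls (subst (_≤ s * s) (sym (*-assoc u p (product ps))) h))
  where
  prime>0 : ∀ {p} → Prime p → 1 ≤ p
  prime>0 {p} p-prime = >-nonZero⁻¹ p {{prime⇒nonZero p-prime}}
... | no up≰s = *-pres-∣ (m∣n! 1≤u u≤s) (*-pres-∣ (m∣n! (>-nonZero⁻¹ p {{prime⇒nonZero p-prime}}) p≤s)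
    (m∣n! (productOfPrimes≥1 primes) (≮⇒≥ λ s<w → <⇒≱ (*-mono-< (n<1+n s) (n<1+n s)) (begin
      suc s * suc s       ≤⟨ *-mono-≤ (≰⇒> up≰s) s<w ⟩
      u * p * product ps  ≡⟨ *-assoc u p (product ps) ⟩
      u * (p * product ps) ≤⟨ h ⟩
      s * s               ∎))))
  where open ≤-Reasoning

-- If all prime factors of `j` are at most `s`, `smooth∣!³` applies. Otherwise split off a prime
-- `p > s`: the cofactor is at most `s` and divides `s !`, and `p`, being at most `2 ^ e`, divides
-- the central product.
∣!³*centralProduct : ∀ s e → (∀ p → Prime p → 2 ^ e < p → ¬ p ≤ s * s) →
  ∀ j → 1 ≤ j → j ≤ s * s → j ∣ s ! * (s ! * s !) * centralProduct e
∣!³*centralProduct s e no-primes j@(suc _) 1≤j j≤ss with factorise j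
... | record { factors = ps ; isFactorisation = j≡ ; factorsPrime = primes } with All.all? (_≤? s) ps
...   | yes smalls = ∣m⇒∣m*n (centralProduct e) (subst (_∣ s ! * (s ! * s !)) (trans (*-identityˡ (product ps)) (sym j≡))
  (smooth∣!³ s 1 ps ≤-refl (s≥1 s j≤ss) primes smalls (subst (_≤ s * s) (trans j≡ (sym (*-identityˡ _))) j≤ss)))
  where
  s≥1 : ∀ s → j ≤ s * s → 1 ≤ s
  s≥1 (suc s) _ = s≤s z≤n
...   | no ¬smalls with find (All.¬All⇒Any¬ (_≤? s) ps ¬smalls)
...     | p , p∈ps , p≰s with subst (p ∣_) (sym j≡) (∈⇒∣product p∈ps)
...       | p∣j@(divides j′ j≡j′p) = subst (_∣ s ! * (s ! * s !) * centralProduct e) (sym j≡j′p)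
  (*-pres-∣ (∣m⇒∣m*n (s ! * s !) (m∣n! j′≥1 j′≤s))
    (prime∣centralProduct e p-prime (≮⇒≥ λ 2^e<p → no-primes p p-prime 2^e<p (≤-trans (∣⇒≤ p∣j) j≤ss))))
  where
  open ≤-Reasoning
  p-prime : Prime p
  p-prime = All.lookup primes p∈ps
  j′≥1 : 1 ≤ j′
  j′≥1 = n≢0⇒n>0 λ { refl → case j≡j′p of λ () }
  j′≤s : j′ ≤ s
  j′≤s = ≮⇒≥ λ s<j′ → <⇒≱ (*-mono-< (n<1+n s) (n<1+n s)) (begin
    suc s * suc s ≤⟨ *-mono-≤ s<j′ (≰⇒> p≰s) ⟩
    j′ * p        ≡⟨ j≡j′p ⟨
    j             ≤⟨ j≤ss ⟩
    s * s         ∎)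

n!≤n^n : ∀ n → n ! ≤ n ^ n
n!≤n^n zero    = ≤-refl
n!≤n^n (suc n) = *-monoʳ-≤ (suc n) (≤-trans (n!≤n^n n) (^-monoˡ-≤ n (n≤1+n n)))

-- The margin for `prime-between`, with `k = 5 + i`. At `k = 4` the inequality still fails, which is
-- why the exponents start at five.
3[2+k]<2^k : ∀ i → 3 * (7 + i) < 2 ^ (5 + i)
3[2+k]<2^k zero    = ≤ᵇ⇒≤ 22 32 tt
3[2+k]<2^k (suc i) = begin-strict
  3 * (7 + suc i)           ≡⟨ eq i ⟩
  3 * (7 + i) + 3           <⟨ +-mono-<-≤ (3[2+k]<2^k i) (≤-trans (≤-trans (m≤m+n 3 29) (^-monoʳ-≤ 2 (m≤m+n 5 i))) (m≤m+n _ 0)) ⟩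
  2 ^ (5 + suc i)           ∎
  where
  open ≤-Reasoning
  eq : ∀ i → 3 * (7 + (1 + i)) ≡ 3 * (7 + i) + 3
  eq = solve-∀

-- Without such a prime, `d` would be a common multiple of `1, …, s²`, hence at least `2 ^ n` with
-- `n = s² / 2 = 8 * x²`. But `s ! ≤ 2 ^ (f * s)` with `s = 4 * x`, and the central product is at
-- most `2 ^ (4 * x²)`, so `d` has exponent at most `12 * f * x + 4 * x²`, which is smaller as
-- `3 * f < x`. The ends of the interval have ratio eight.
prime-between : ∀ i → ∃ λ p → Prime p × 2 ^ (5 + i) * (2 * 2 ^ (5 + i)) < p × p ≤ 2 * (2 * 2 ^ (5 + i)) * (2 * (2 * 2 ^ (5 + i)))
prime-between i with anyUpTo? (λ p → prime? p ×-dec (2 ^ (5 + i + suc (5 + i)) <? p)) (suc (2 ^ (2 + (5 + i)) * 2 ^ (2 + (5 + i))))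
... | yes (p , p< , p-prime , <p) = p , p-prime , subst (_< p) (^-distribˡ-+-* 2 (5 + i) (suc (5 + i))) <p , s≤s⁻¹ p<
... | no none = contradiction too-small (<⇒≱ (^-monoʳ-< 2 (s<s z<s) exponents))
  where
  open ≤-Reasoning
  k f e s x n d : ℕ
  k = 5 + i
  f = 2 + k
  e = k + suc k
  s = 2 ^ f
  x = 2 ^ k
  n = 4 * 2 ^ e
  d = s ! * (s ! * s !) * centralProduct e
  2^e≡ : 2 ^ e ≡ x * (2 * x)
  2^e≡ = ^-distribˡ-+-* 2 k (suc k)
  n+n≡ss : n + n ≡ s * s
  n+n≡ss = trans (cong (λ z → 4 * z + 4 * z) 2^e≡) (eq x)
    where
    eq : ∀ x → 4 * (x * (2 * x)) + 4 * (x * (2 * x)) ≡ 2 * (2 * x) * (2 * (2 * x))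
    eq = solve-∀
  exponents : (f * s + (f * s + f * s)) + (2 ^ e + 2 ^ e) < n
  exponents = begin-strict
    (f * s + (f * s + f * s)) + (2 ^ e + 2 ^ e) ≡⟨ cong (λ z → (f * s + (f * s + f * s)) + (z + z)) 2^e≡ ⟩
    (f * s + (f * s + f * s)) + (x * (2 * x) + x * (2 * x)) ≡⟨ eq f x ⟩
    3 * f * (4 * x) + 4 * (x * x) <⟨ +-monoˡ-< (4 * (x * x)) (*-monoˡ-< (4 * x) {{m*n≢0 4 x {{_}} {{m^n≢0 2 k}}}} (3[2+k]<2^k i)) ⟩
    x * (4 * x) + 4 * (x * x) ≡⟨ eq′ x ⟩
    4 * (x * (2 * x)) ≡⟨ cong (4 *_) 2^e≡ ⟨
    n ∎
    where
    eq : ∀ f x → (f * (2 * (2 * x)) + (f * (2 * (2 * x)) + f * (2 * (2 * x)))) + (x * (2 * x) + x * (2 * x)) ≡ 3 * f * (4 * x) + 4 * (x * x)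
    eq = solve-∀
    eq′ : ∀ x → x * (4 * x) + 4 * (x * x) ≡ 4 * (x * (2 * x))
    eq′ = solve-∀
  s!≤ : s ! ≤ 2 ^ (f * s)
  s!≤ = ≤-trans (n!≤n^n s) (≤-reflexive (^-*-assoc 2 f s))
  too-small : 2 ^ n ≤ 2 ^ ((f * s + (f * s + f * s)) + (2 ^ e + 2 ^ e))
  too-small = begin
    2 ^ n       ≤⟨ 2^n≤2nCn n ⟩
    (n + n) C n ≤⟨ 2nCn≤common-multiple d n {{m*n≢0 _ _ {{m*n≢0 _ _ {{s !≢0}} {{s !* s !≢0}}}} {{centralProduct≢0 e}}}}
                     (≤-trans (m^n>0 2 e) (m≤n*m (2 ^ e) 4))
                     (λ j 1≤j j≤2n → ∣!³*centralProduct s e (λ p p-prime <p p≤ → none (p , s≤s p≤ , p-prime , <p)) j 1≤j (subst (j ≤_) n+n≡ss j≤2n)) ⟩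
    d           ≤⟨ *-mono-≤ (*-mono-≤ s!≤ (*-mono-≤ s!≤ s!≤)) (centralProduct≤ e) ⟩
    2 ^ (f * s) * (2 ^ (f * s) * 2 ^ (f * s)) * 2 ^ (2 ^ e + 2 ^ e)
      ≡⟨ cong (λ z → 2 ^ (f * s) * z * 2 ^ (2 ^ e + 2 ^ e)) (^-distribˡ-+-* 2 (f * s) (f * s)) ⟨
    2 ^ (f * s) * 2 ^ (f * s + f * s) * 2 ^ (2 ^ e + 2 ^ e)
      ≡⟨ cong (_* 2 ^ (2 ^ e + 2 ^ e)) (^-distribˡ-+-* 2 (f * s) (f * s + f * s)) ⟨
    2 ^ (f * s + (f * s + f * s)) * 2 ^ (2 ^ e + 2 ^ e)
      ≡⟨ ^-distribˡ-+-* 2 (f * s + (f * s + f * s)) (2 ^ e + 2 ^ e) ⟨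
    2 ^ ((f * s + (f * s + f * s)) + (2 ^ e + 2 ^ e)) ∎

-- Ramsey numbers and asymptotics

module _ {n} (χ : Fin n → Fin n → Bool) (χ-sym : ∀ i j → χ i j ≡ χ j i) where

  record CliqueWithin (c : Bool) (k : ℕ) (a : Fin n → Bool) : Set where
    field
      vertex : Fin k → Fin n
      within : ∀ i → a (vertex i) ≡ true
      distinct : ∀ i j → i ≢ j → vertex i ≢ vertex j
      coloured : ∀ i j → i ≢ j → χ (vertex i) (vertex j) ≡ c

  neighbours : Bool → (Fin n → Bool) → Fin n → Fin n → Bool
  neighbours c a v u = (a ∖ v) u ∧ does (χ v u Bool.≟ c)

  private
    extend : ∀ {c k a v} → a v ≡ true → CliqueWithin c k (neighbours c a v) → CliqueWithin c (suc k) a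
    extend {c} {k} {a} {v} av Q = record
      { vertex = vertex
      ; within = λ { zero → av ; (suc i) → proj₁ (new i) }
      ; distinct = λ { zero zero 0≢0 → contradiction refl 0≢0
                     ; zero (suc j) _ → proj₁ (proj₂ (new j))
                     ; (suc i) zero _ → proj₁ (proj₂ (new i)) ∘ sym
                     ; (suc i) (suc j) i≢j → CliqueWithin.distinct Q i j (i≢j ∘ cong suc) }
      ; coloured = λ { zero zero 0≢0 → contradiction refl 0≢0
                     ; zero (suc j) _ → proj₂ (proj₂ (new j))
                     ; (suc i) zero _ → trans (χ-sym _ _) (proj₂ (proj₂ (new i)))
                     ; (suc i) (suc j) i≢j → CliqueWithin.coloured Q i j (i≢j ∘ cong suc) }
      }
      where
      vertex : Fin (suc k) → Fin n
      vertex zero    = v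
      vertex (suc i) = CliqueWithin.vertex Q i
      new : ∀ i → let u = CliqueWithin.vertex Q i in a u ≡ true × v ≢ u × χ v u ≡ c
      new i = let u = CliqueWithin.vertex Q i
                  x , y = ∧-true {(a ∖ v) u} (CliqueWithin.within Q i)
                  z , w = ∖⁻ {a = a} {v} {u} x
              in z , w , does-true (χ v u Bool.≟ c) y

  -- The Erdős-Szekeres recursion with the cruder bound `t ^ s`: since `(1 + t) ^ suc s` is at least
  -- `(1 + t) ^ s + t ^ suc s`, a vertex has enough red or enough blue neighbours. The red clique
  -- has order `suc s`, so `s = 3` gives `t ^ 3` for `K₄`.
  ramsey-bound : ∀ s t a → t ^ s ≤ # a → CliqueWithin true (suc s) a ⊎ CliqueWithin false t a
  ramsey-bound s zero a h = inj₂ (record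
    { vertex = λ () ; within = λ () ; distinct = λ () ; coloured = λ () })
  ramsey-bound zero (suc t) a h with findᵇ a
  ... | inj₂ none     = contradiction (subst (1 ≤_) (#-none none) h) λ ()
  ... | inj₁ (v , av) = inj₁ (record
    { vertex = λ _ → v ; within = λ _ → av
    ; distinct = λ { zero zero 0≢0 → contradiction refl 0≢0 } ; coloured = λ { zero zero 0≢0 → contradiction refl 0≢0 } })
  ramsey-bound (suc s) (suc t) a h with findᵇ a
  ... | inj₂ none     = contradiction (≤-trans (m^n>0 (suc t) (suc s)) (subst (suc t ^ suc s ≤_) (#-none none) h)) λ ()
  ... | inj₁ (v , av) = case suc t ^ s ≤? # red of λ
    { (yes enough) → case ramsey-bound s (suc t) red enough of λ
        { (inj₁ Q) → inj₁ (extend av Q)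
        ; (inj₂ Q) → inj₂ (record { CliqueWithin Q using (vertex; distinct; coloured)
            ; within = λ i → proj₁ (∖⁻ {a = a} {v} (proj₁ (∧-true {(a ∖ v) (CliqueWithin.vertex Q i)} (CliqueWithin.within Q i)))) }) }
    ; (no few) → case ramsey-bound (suc s) t blue (blue-enough (≰⇒> few)) of λ
        { (inj₁ Q) → inj₁ (record { CliqueWithin Q using (vertex; distinct; coloured)
            ; within = λ i → proj₁ (∖⁻ {a = a} {v} (proj₁ (∧-true {(a ∖ v) (CliqueWithin.vertex Q i)} (CliqueWithin.within Q i)))) })
        ; (inj₂ Q) → inj₂ (extend av Q) } }
    where
    open ≤-Reasoning
    red blue : Fin n → Bool
    red  = neighbours true a v
    blue = neighbours false a v
    red+blue : # red + # blue ≡ # (a ∖ v)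
    red+blue = trans (sym (∑-+ (allFin n) _ _)) (∑-cong (allFin n) (λ u → split ((a ∖ v) u) (χ v u)))
      where
      split : ∀ x c → 𝟙 (x ∧ does (c Bool.≟ true)) + 𝟙 (x ∧ does (c Bool.≟ false)) ≡ 𝟙 x
      split true true   = refl
      split true false  = refl
      split false c     = refl
    blue-enough : # red < suc t ^ s → t ^ suc s ≤ # blue
    blue-enough few = +-cancelˡ-≤ (suc (# red)) _ _ (begin
      suc (# red) + t * t ^ s            ≤⟨ +-mono-≤ few (*-monoʳ-≤ t (^-monoˡ-≤ s (n≤1+n t))) ⟩
      suc t ^ s + t * suc t ^ s          ≤⟨ h ⟩
      # a                                ≡⟨ #-∖ a av ⟨
      suc (# (a ∖ v))                    ≡⟨ cong suc red+blue ⟨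
      suc (# red) + # blue               ∎)

K-isRamsey : ∀ t → IsRamsey 4 t (K (t ^ 3))
K-isRamsey t χ χ-sym = [ inj₁ ∘ mono , inj₂ ∘ mono ]′
  (ramsey-bound χ χ-sym 3 t everything (≤-reflexive (sym (trans (∑-allFin-const (t ^ 3) 1) (*-identityʳ (t ^ 3))))))
  where
  mono : ∀ {c k} → CliqueWithin χ χ-sym c k everything → MonoClique (K (t ^ 3)) χ c k
  mono Q = vertex , injective , λ i j i≢j → not-== (distinct i j i≢j) , coloured i j i≢j
    where
    open CliqueWithin Q
    injective : Injective _≡_ _≡_ vertex
    injective {i} {j} e with i Fin.≟ j
    ... | yes i≡j = i≡j
    ... | no  i≢j = contradiction e (distinct i j i≢j)

-- Binomial coefficients, powers and logarithms

count-subsets : ∀ n s → ∑ (subsets n) (λ p → 𝟙 (∣ p ∣ ≡ᵇ s)) ≡ n C s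
count-subsets zero zero       = refl
count-subsets zero (suc s)    = sym (k>n⇒nCk≡0 {0} {suc s} z<s)
count-subsets (suc n) s = trans (∑-++ (map (inside ∷_) (subsets n)) _ _)
  (trans (cong₂ _+_ (∑-map (inside ∷_) (subsets n) _) (∑-map (outside ∷_) (subsets n) _)) (pascal s))
  where
  pascal : ∀ s → ∑ (subsets n) (λ p → 𝟙 (suc ∣ p ∣ ≡ᵇ s)) + ∑ (subsets n) (λ p → 𝟙 (∣ p ∣ ≡ᵇ s)) ≡ suc n C s
  pascal zero    = cong₂ _+_ (∑-zero (subsets n) (λ _ → refl)) (count-subsets n zero)
  pascal (suc s) = trans (cong₂ _+_ (count-subsets n s) (count-subsets n (suc s))) (nCk+nC[k+1]≡[n+1]C[k+1] n s)

cliqueCount≤C : ∀ {n} (G : Graph n) s → cliqueCount G s ≤ n C s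
cliqueCount≤C {n} G s = ≤-trans (≤-reflexive (length-filterᵇ _ (subsets n)))
  (≤-trans (∑-mono (subsets n) (λ p → 𝟙-mono (λ h → proj₁ (∧-true {∣ p ∣ ≡ᵇ s} h)))) (≤-reflexive (count-subsets n s)))

C*!≤^ : ∀ n k → (n C k) * k ! ≤ n ^ k
C*!≤^ n zero          = ≤-refl
C*!≤^ zero (suc k)    = ≤-reflexive (cong (_* suc k !) (k>n⇒nCk≡0 {0} {suc k} z<s))
C*!≤^ (suc n) (suc k) = begin
  (suc n C suc k) * (suc k * k !)   ≡⟨ eq (suc n C suc k) (suc k) (k !) ⟩
  suc k * (suc n C suc k) * k !     ≡⟨ cong (_* k !) (C-absorption n k) ⟩
  suc n * (n C k) * k !             ≡⟨ *-assoc (suc n) (n C k) (k !) ⟩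
  suc n * ((n C k) * k !)           ≤⟨ *-monoʳ-≤ (suc n) (≤-trans (C*!≤^ n k) (^-monoˡ-≤ k (n≤1+n n))) ⟩
  suc n ^ suc k                     ∎
  where
  open ≤-Reasoning
  eq : ∀ c k f → c * (k * f) ≡ k * c * f
  eq = solve-∀

^≤C*! : ∀ n k → n ^ k ≤ ((n + k) C k) * k !
^≤C*! n zero    = ≤-refl
^≤C*! n (suc k) = begin
  n * n ^ k                                     ≤⟨ *-mono-≤ (≤-trans (m≤m+n n k) (n≤1+n (n + k))) (^≤C*! n k) ⟩
  suc (n + k) * (((n + k) C k) * k !)           ≡⟨ *-assoc (suc (n + k)) ((n + k) C k) (k !) ⟨
  suc (n + k) * ((n + k) C k) * k !             ≡⟨ cong (_* k !) (C-absorption (n + k) k) ⟨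
  suc k * (suc (n + k) C suc k) * k !           ≡⟨ eq (suc k) (suc (n + k) C suc k) (k !) ⟩
  (suc (n + k) C suc k) * (suc k * k !)         ≡⟨ cong (λ m → (m C suc k) * suc k !) (+-suc n k) ⟨
  ((n + suc k) C suc k) * suc k !               ∎
  where
  open ≤-Reasoning
  eq : ∀ k c f → k * c * f ≡ c * (k * f)
  eq = solve-∀

-- A crude form of Stirling's formula, from `(n + n) C n ≤ 4 ^ n`. It is the source of the factor 4
-- in `from-top`.
n^n≤4^n*n! : ∀ n → n ^ n ≤ 4 ^ n * n !
n^n≤4^n*n! n = ≤-trans (^≤C*! n n) (*-monoˡ-≤ (n !) (≤-trans (nCk≤2^n (n + n) n)
  (≤-reflexive (trans (^-distribˡ-+-* 2 n n) (sym (^-distribʳ-* 2 2 n))))))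

n<2^n : ∀ n → n < 2 ^ n
n<2^n zero    = ≤-refl
n<2^n (suc n) = begin-strict
  suc n                 ≤⟨ n<2^n n ⟩
  2 ^ n                 <⟨ m<m+n (2 ^ n) (m^n>0 2 n) ⟩
  2 ^ n + 2 ^ n         ≡⟨ cong (2 ^ n +_) (+-identityʳ (2 ^ n)) ⟨
  2 ^ suc n             ∎
  where open ≤-Reasoning

-- Write `l` as `d * n` plus a remainder, with `d = 2 * k`, so that `2 ^ l` is at least the square
-- of `(2 ^ n) ^ k`. One factor absorbs `l ^ k ≤ (d * 2 ^ n) ^ k` up to `d ^ k`, the other absorbs
-- the constant `c * d ^ k ≤ n`.
poly≤exp : ∀ c k .{{_ : NonZero k}} → ∃ λ l₀ → ∀ l → l₀ ≤ l → c * l ^ k ≤ 2 ^ l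
poly≤exp c k = d * (c * d ^ k) , λ l l₀≤l →
  let n = l / d
      l< : l < d * suc n
      l< = begin-strict
        l                     ≡⟨ m≡m%n+[m/n]*n l d ⟩
        l % d + n * d         <⟨ +-monoˡ-< (n * d) (m%n<n l d) ⟩
        d + n * d             ≡⟨ *-comm (suc n) d ⟩
        d * suc n             ∎
      n≥ : c * d ^ k ≤ n
      n≥ = s≤s⁻¹ (*-cancelˡ-< d (c * d ^ k) (suc n) (≤-<-trans l₀≤l l<))
  in begin
    c * l ^ k                      ≤⟨ *-monoʳ-≤ c (^-monoˡ-≤ k (<⇒≤ (<-≤-trans l< (*-monoʳ-≤ d (n<2^n n))))) ⟩
    c * (d * 2 ^ n) ^ k            ≡⟨ cong (c *_) (^-distribʳ-* d (2 ^ n) k) ⟩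
    c * (d ^ k * (2 ^ n) ^ k)      ≡⟨ *-assoc c (d ^ k) _ ⟨
    c * d ^ k * (2 ^ n) ^ k        ≤⟨ *-monoˡ-≤ ((2 ^ n) ^ k) (≤-trans n≥ (≤-trans (<⇒≤ (n<2^n n)) (m≤m^k (2 ^ n) {{m^n≢0 2 n}}))) ⟩
    (2 ^ n) ^ k * (2 ^ n) ^ k      ≡⟨ cong (λ x → x * x) (^-*-assoc 2 n k) ⟩
    2 ^ (n * k) * 2 ^ (n * k)      ≡⟨ ^-distribˡ-+-* 2 (n * k) (n * k) ⟨
    2 ^ (n * k + n * k)            ≡⟨ cong (2 ^_) (eq n k) ⟩
    2 ^ (n * d)                    ≤⟨ ^-monoʳ-≤ 2 (≤-trans (m≤n+m (n * d) (l % d)) (≤-reflexive (sym (m≡m%n+[m/n]*n l d)))) ⟩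
    2 ^ l                          ∎
  where
  open ≤-Reasoning
  d : ℕ
  d = k + k
  instance
    d≢0 : NonZero d
    d≢0 = >-nonZero (≤-trans (>-nonZero⁻¹ k) (m≤m+n k k))
  eq : ∀ n k → n * k + n * k ≡ n * (k + k)
  eq = solve-∀
  m≤m^k : ∀ m .{{_ : NonZero m}} → m ≤ m ^ k
  m≤m^k m = subst (_≤ m ^ k) (^-identityʳ m) (^-monoʳ-≤ m (>-nonZero⁻¹ k))

greatest-power : ∀ b c x → 1 < b → 0 < c → c ≤ x → ∃ λ f → b ^ f * c ≤ x × x < b ^ suc f * c
greatest-power b c x 1<b 0<c c≤x = search x (<-≤-trans (x<b^x x) (m≤m*n (b ^ x) c {{>-nonZero 0<c}}))
  where
  x<b^x : ∀ x → x < b ^ x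
  x<b^x x = <-≤-trans (n<2^n x) (^-monoˡ-≤ x 1<b)
  search : ∀ f → x < b ^ f * c → ∃ λ f → b ^ f * c ≤ x × x < b ^ suc f * c
  search zero h    = contradiction c≤x (<⇒≱ (subst (x <_) (*-identityˡ c) h))
  search (suc f) h = case b ^ f * c ≤? x of λ
    { (yes le) → f , le , h
    ; (no ¬le) → search f (≰⇒> ¬le) }

t<2^[1+log] : ∀ t → t < 2 ^ suc ⌊log₂ t ⌋
t<2^[1+log] t = ≰⇒> λ h → 1+n≰n (subst (_≤ ⌊log₂ t ⌋) (⌊log₂[2^n]⌋≡n (suc ⌊log₂ t ⌋)) (⌊log₂⌋-mono-≤ h))

2^log≤2t : ∀ t → 1 ≤ t → 2 ^ ⌊log₂ t ⌋ ≤ 2 * t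
2^log≤2t t 1≤t =
  let f , 2^f≤t , t<2^ = greatest-power 2 1 t (s<s z<s) (s≤s z≤n) 1≤t in begin
  2 ^ ⌊log₂ t ⌋   ≤⟨ ^-monoʳ-≤ 2 (subst (⌊log₂ t ⌋ ≤_) (⌊log₂[2^n]⌋≡n (suc f)) (⌊log₂⌋-mono-≤ {t} {2 ^ suc f} (<⇒≤ (subst (t <_) (*-identityʳ (2 ^ suc f)) t<2^)))) ⟩
  2 * 2 ^ f       ≤⟨ *-monoʳ-≤ 2 (subst (_≤ t) (*-identityʳ (2 ^ f)) 2^f≤t) ⟩
  2 * t           ∎
  where open ≤-Reasoning

poly-log≤ : ∀ c k .{{_ : NonZero k}} → ∃ λ t₀ → ∀ t → t₀ ≤ t → c * ⌊log₂ t ⌋ ^ k ≤ t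
poly-log≤ c k = let l₀ , h = poly≤exp (2 * c) k in 2 ^ l₀ , λ t t₀≤t →
  *-cancelˡ-≤ 2 (begin
    2 * (c * ⌊log₂ t ⌋ ^ k)  ≡⟨ *-assoc 2 c _ ⟨
    2 * c * ⌊log₂ t ⌋ ^ k    ≤⟨ h ⌊log₂ t ⌋ (subst (_≤ ⌊log₂ t ⌋) (⌊log₂[2^n]⌋≡n l₀) (⌊log₂⌋-mono-≤ t₀≤t)) ⟩
    2 ^ ⌊log₂ t ⌋            ≤⟨ 2^log≤2t t (≤-trans (m^n>0 2 l₀) t₀≤t) ⟩
    2 * t                    ∎)
  where open ≤-Reasoning

-- The size of the prime and the constants

57+4m<2^ : ∀ m → 1 + (7 + (7 + m)) * 4 < 2 ^ (7 + m)
57+4m<2^ zero    = ≤ᵇ⇒≤ 58 128 tt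
57+4m<2^ (suc m) = begin-strict
  1 + (7 + (7 + suc m)) * 4            ≡⟨ eq m ⟩
  1 + (7 + (7 + m)) * 4 + 4            <⟨ +-mono-<-≤ (57+4m<2^ m) (≤-trans (≤ᵇ⇒≤ 4 128 tt) (^-monoʳ-≤ 2 (m≤m+n 7 m))) ⟩
  2 ^ (7 + m) + 2 ^ (7 + m)            ≡⟨ cong (2 ^ (7 + m) +_) (+-identityʳ (2 ^ (7 + m))) ⟨
  2 ^ (7 + suc m)                      ∎
  where
  open ≤-Reasoning
  eq : ∀ m → 1 + (7 + (7 + (1 + m))) * 4 ≡ 1 + (7 + (7 + m)) * 4 + 4
  eq = solve-∀

-- Abstract, since the type checker would unfold products with so large a numeral.
abstract
  E₀ : ℕ
  E₀ = 2 ^ 28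

  -- One `128 * 128` is from `1 + β = 128 * 128 * q`, the other from `q ≤ 128 * (128 * x)`, and ten
  -- is the product of the coefficients in `2 * ℓ` and `5 * ℓ`. The left side equals `10 * E₀`.
  E₀-large : 128 * 128 * (128 * 128) * 10 ≤ 16 * E₀
  E₀-large = ≤ᵇ⇒≤ (128 * 128 * (128 * 128) * 10) (16 * 2 ^ 28) tt

E₀≥1 : 1 ≤ E₀
E₀≥1 = *-cancelˡ-< 16 0 E₀ (≤-trans (s≤s z≤n) E₀-large)

2*⁴< : ∀ {q} e {w} → q ≤ 2 ^ e → 1 + e * 4 < w → 2 * (q * (q * (q * q))) < 2 ^ w
2*⁴< {q} e {w} q≤ e< = begin-strict
  2 * (q * (q * (q * q)))   ≡⟨ cong (λ z → 2 * (q * (q * (q * z)))) (*-identityʳ q) ⟨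
  2 * q ^ 4                 ≤⟨ *-monoʳ-≤ 2 (^-monoˡ-≤ 4 q≤) ⟩
  2 * (2 ^ e) ^ 4           ≡⟨ cong (2 *_) (^-*-assoc 2 e 4) ⟩
  2 ^ (1 + e * 4)           <⟨ ^-monoʳ-< 2 (s<s z<s) e< ⟩
  2 ^ w                     ∎
  where open ≤-Reasoning

-- Here `j = 128 * x`. The window `16 * j < q ≤ 128 * j` has ratio eight, just what `prime-between`
-- offers, and `(16 * j)² = 1024 * (64 * x)²` explains the base `(64 * x)²`.
design-cliques : ∀ q x → .{{NonZero x}} → Prime q → 16 * (128 * x) < q → q ≤ 128 * (128 * x) →
  2 * (q * (q * (q * q))) < 2 ^ (128 * x) → ∀ t ℓ {n} (G : Graph n) → 1 ≤ ℓ → t < 2 ^ ℓ → x * (16 * E₀ * (ℓ * ℓ)) ≤ t →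
  IsRamsey 4 t G → (64 * x * (64 * x)) ^ t ≤ cliqueCount G t
design-cliques q x {{x≢0}} q-prime 16j<q q≤128j q⁴< t ℓ G 1≤ℓ t<2^ℓ small ramsey =
  design⇒cliques D {{q≢0}} {{j≢0}} q≤128j large-j G t ℓ (64 * x * (64 * x)) t<2^ℓ q<2^ℓ small-q d-small ramsey
  where
  open ≤-Reasoning
  j≢0 : NonZero (128 * x)
  j≢0 = m*n≢0 128 x
  q≢0 : NonZero q
  q≢0 = prime⇒nonZero q-prime
  D : Design q (128 * x)
  D = UnitalDesign.unital-design q (128 * x) {{q≢0}} q-prime (≤-<-trans (≤-trans (≤ᵇ⇒≤ 2 16 tt) (m≤m*n 16 (128 * x) {{j≢0}})) 16j<q) (<⇒≤ 16j<q)
  large-j : 2 * Design.N D < 2 ^ (128 * x)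
  large-j = ≤-<-trans (*-monoʳ-≤ 2 (Design.N≤q⁴ D)) q⁴<
  small-q : 128 * 128 * q * (2 * ℓ) * (5 * ℓ) ≤ t
  small-q = begin
    128 * 128 * q * (2 * ℓ) * (5 * ℓ)              ≤⟨ *-monoˡ-≤ (5 * ℓ) (*-monoˡ-≤ (2 * ℓ) (*-monoʳ-≤ (128 * 128) q≤128j)) ⟩
    128 * 128 * (128 * (128 * x)) * (2 * ℓ) * (5 * ℓ) ≡⟨ eq₁ 128 x ℓ ⟩
    128 * 128 * (128 * 128) * 10 * (x * (ℓ * ℓ))   ≤⟨ *-monoˡ-≤ (x * (ℓ * ℓ)) E₀-large ⟩
    16 * E₀ * (x * (ℓ * ℓ))                        ≡⟨ eq₂ (16 * E₀) x (ℓ * ℓ) ⟩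
    x * (16 * E₀ * (ℓ * ℓ))                        ≤⟨ small ⟩
    t                                              ∎
    where
    eq₁ : ∀ c x ℓ → c * c * (c * (c * x)) * (2 * ℓ) * (5 * ℓ) ≡ c * c * (c * c) * 10 * (x * (ℓ * ℓ))
    eq₁ = solve-∀
    eq₂ : ∀ e x l → e * (x * l) ≡ x * (e * l)
    eq₂ = solve-∀
  q<2^ℓ : q < 2 ^ ℓ
  q<2^ℓ = ≤-<-trans (≤-trans (m≤m*n q (2 * ℓ * (5 * ℓ)) {{>-nonZero (*-mono-≤ (*-mono-≤ {1} {2} (s≤s z≤n) 1≤ℓ) (*-mono-≤ {1} {5} (s≤s z≤n) 1≤ℓ))}})
    (≤-trans (≤-trans (m≤n*m _ (128 * 128)) (≤-reflexive (eq (128 * 128) q (2 * ℓ) (5 * ℓ)))) small-q)) t<2^ℓ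
    where
    eq : ∀ c q a b → c * (q * (a * b)) ≡ c * q * a * b
    eq = solve-∀
  d-small : 1024 * (64 * x * (64 * x)) ≤ q * q
  d-small = ≤-trans (≤-reflexive (eq x)) (*-mono-≤ (<⇒≤ 16j<q) (<⇒≤ 16j<q))
    where
    eq : ∀ x → 1024 * (64 * x * (64 * x)) ≡ 16 * (128 * x) * (16 * (128 * x))
    eq = solve-∀

2^[a+n] : ∀ a c n → 2 ^ a ≡ c → 2 ^ (a + n) ≡ c * 2 ^ n
2^[a+n] a c n refl = ^-distribˡ-+-* 2 a n

module _ (i x : ℕ) (y² : 2 ^ i * 2 ^ i ≡ x) where

  private
    j≡ : 2 ^ (7 + (i + i)) ≡ 128 * x
    j≡ = trans (2^[a+n] 7 128 (i + i) refl) (cong (128 *_) (trans (^-distribˡ-+-* 2 i i) y²))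

    lower : ∀ y z → y ≡ 32 * z → z * z ≡ x → y * (2 * y) ≡ 16 * (128 * x)
    lower y z refl z² = trans (eq z) (cong (λ w → 16 * (128 * w)) z²)
      where
      eq : ∀ z → 32 * z * (2 * (32 * z)) ≡ 16 * (128 * (z * z))
      eq = solve-∀

    upper : ∀ y z → y ≡ 32 * z → z * z ≡ x → 2 * (2 * y) * (2 * (2 * y)) ≡ 128 * (128 * x)
    upper y z refl z² = trans (eq z) (cong (λ w → 128 * (128 * w)) z²)
      where
      eq : ∀ z → 2 * (2 * (32 * z)) * (2 * (2 * (32 * z))) ≡ 128 * (128 * (z * z))
      eq = solve-∀

  prime-size-lower : 2 ^ (5 + i) * (2 * 2 ^ (5 + i)) ≡ 16 * (128 * x)
  prime-size-lower = lower (2 ^ (5 + i)) (2 ^ i) (2^[a+n] 5 32 i refl) y²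

  prime-size-upper : 2 * (2 * 2 ^ (5 + i)) * (2 * (2 * 2 ^ (5 + i))) ≡ 128 * (128 * x)
  prime-size-upper = upper (2 ^ (5 + i)) (2 ^ i) (2^[a+n] 5 32 i refl) y²

  -- With `128 * x = 2 ^ (7 + 2 * i)` and `q ≤ 2 ^ (14 + 2 * i)`, `2 * q⁴` has exponent at most
  -- `57 + 8 * i`, which `57+4m<2^` for `m = 2 * i` puts below `128 * x`. The union bound over sets
  -- of lines asks for this.
  prime-size-exponent : ∀ {q} → q ≤ 128 * (128 * x) → 2 * (q * (q * (q * q))) < 2 ^ (128 * x)
  prime-size-exponent {q} q≤ = subst (λ z → 2 * (q * (q * (q * q))) < 2 ^ z) j≡
    (2*⁴< (7 + (7 + (i + i))) (subst (q ≤_) (sym (trans (2^[a+n] 7 128 (7 + (i + i)) refl) (cong (128 *_) j≡))) q≤) (57+4m<2^ (i + i)))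

-- The prime q is of order 4^i, and 4^i will be of order t / log² t.
dyadic-cliques : ∀ i t ℓ {n} (G : Graph n) → 1 ≤ ℓ → t < 2 ^ ℓ → 4 ^ i * (16 * E₀ * (ℓ * ℓ)) ≤ t →
  IsRamsey 4 t G → (64 * 4 ^ i * (64 * 4 ^ i)) ^ t ≤ cliqueCount G t
dyadic-cliques i = go (4 ^ i) {{m^n≢0 4 i}} (sym (^-distribʳ-* 2 2 i)) (prime-between i)
  where
  go : ∀ x .{{_ : NonZero x}} → 2 ^ i * 2 ^ i ≡ x →
    (∃ λ p → Prime p × 2 ^ (5 + i) * (2 * 2 ^ (5 + i)) < p × p ≤ 2 * (2 * 2 ^ (5 + i)) * (2 * (2 * 2 ^ (5 + i)))) →
    ∀ t ℓ {n} (G : Graph n) → 1 ≤ ℓ → t < 2 ^ ℓ → x * (16 * E₀ * (ℓ * ℓ)) ≤ t → IsRamsey 4 t G → (64 * x * (64 * x)) ^ t ≤ cliqueCount G t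
  go x y² (q , q-prime , q> , q≤) = design-cliques q x q-prime
    (subst (_< q) (prime-size-lower i x y²) q>) q≤′ (prime-size-exponent i x y² q≤′)
    where
    q≤′ : q ≤ 128 * (128 * x)
    q≤′ = subst (q ≤_) (prime-size-upper i x y²) q≤

-- The constant c of the theorem is 1 / Q.
abstract
  Q : ℕ
  Q = 64 * (E₀ * E₀)

  Q≡ : Q ≡ 64 * (E₀ * E₀)
  Q≡ = refl

Q≥1 : 1 ≤ Q
Q≥1 = subst (1 ≤_) (sym Q≡) (*-mono-≤ {1} {64} (s≤s z≤n) (*-mono-≤ E₀≥1 E₀≥1))

-- From cliques of order t to the final bounds

from-top : ∀ {n} (G : Graph n) {t s d W} → d ^ t ≤ cliqueCount G t → 4 * W ≤ t * d → 1 ≤ s → s ≤ t →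
  W ^ s ≤ s ! * cliqueCount G s
from-top G {t} {s@(suc _)} {d} {W} top 4W≤td 1≤s s≤t = ^-cancelˡ-≤ t {{t≢0}} (begin
  (W ^ s) ^ t                    ≡⟨ trans (^-*-assoc W s t) (trans (cong (W ^_) (*-comm s t)) (sym (^-*-assoc W t s))) ⟩
  (W ^ t) ^ s                    ≤⟨ ^-monoˡ-≤ s W^t≤ ⟩
  τ t ^ s                        ≤⟨ subst (λ u → τ u ^ s ≤ τ s ^ u) (m∸n+n≡m s≤t) (tuples-power (adj G) s (t ∸ s) everything) ⟩
  τ s ^ t                        ≡⟨ cong (_^ t) (tuples≡!*cliqueCount G s) ⟩
  (s ! * cliqueCount G s) ^ t    ∎)
  where
  open ≤-Reasoning
  t≢0 : NonZero t
  t≢0 = >-nonZero (≤-trans 1≤s s≤t)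
  τ : ℕ → ℕ
  τ u = tuples (adj G) u everything
  -- Each clique has `t !` orderings, and `t ! ≥ (t / 4) ^ t` raises `d ^ t` to `(t * d / 4) ^ t`.
  W^t≤ : W ^ t ≤ τ t
  W^t≤ = *-cancelˡ-≤ (4 ^ t) {{m^n≢0 4 t}} (begin
    4 ^ t * W ^ t                      ≡⟨ ^-distribʳ-* 4 W t ⟨
    (4 * W) ^ t                        ≤⟨ ^-monoˡ-≤ t 4W≤td ⟩
    (t * d) ^ t                        ≡⟨ ^-distribʳ-* t d t ⟩
    t ^ t * d ^ t                      ≤⟨ *-mono-≤ (n^n≤4^n*n! t) top ⟩
    4 ^ t * t ! * cliqueCount G t      ≡⟨ *-assoc (4 ^ t) (t !) _ ⟩
    4 ^ t * (t ! * cliqueCount G t)    ≡⟨ cong (4 ^ t *_) (tuples≡!*cliqueCount G t) ⟨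
    4 ^ t * τ t                        ∎)

-- Stated with powers in place of binomial coefficients, since `binomial-bound` and `exponent-bound`
-- both start from this form.
clique-power-bound : ∃ λ t₀ → 1 ≤ t₀ × (∀ t → t₀ ≤ t → 1 ≤ ⌊log₂ t ⌋) × (∀ t → t₀ ≤ t → ∀ s → 1 ≤ s → s ≤ t →
  ∀ {n} (G : Graph n) → IsRamsey 4 t G →
  ∀ W → W * (Q * ⌊log₂ t ⌋ ^ 4) ≤ t ^ 3 → W ^ s ≤ s ! * cliqueCount G s)
clique-power-bound =
  let t₁ , large = poly-log≤ (16 * E₀ * 4) 2
  -- The summand 2 makes the logarithm positive, as `ℓ ≤ 2 * L` and the cancellation of `L ^ 4`
  -- require.
  in 2 + t₁ , s≤s z≤n , (λ t t₀≤t → log≥1 t (≤-trans (m≤m+n 2 t₁) t₀≤t)) , λ t t₀≤t s 1≤s s≤t G ramsey W W≤ →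
    let L = ⌊log₂ t ⌋
        ℓ = suc L
        1≤L : 1 ≤ L
        1≤L = log≥1 t (≤-trans (m≤m+n 2 t₁) t₀≤t)
        ℓ≤2L : ℓ ≤ 2 * L
        ℓ≤2L = ≤-trans (+-monoˡ-≤ L 1≤L) (≤-reflexive (cong (L +_) (sym (+-identityʳ L))))
        c = 16 * E₀ * (ℓ * ℓ)
        c≤t : c ≤ t
        c≤t = begin
          16 * E₀ * (ℓ * ℓ)             ≤⟨ *-monoʳ-≤ (16 * E₀) (*-mono-≤ ℓ≤2L ℓ≤2L) ⟩
          16 * E₀ * (2 * L * (2 * L))   ≡⟨ eq₁ (16 * E₀) L ⟩
          16 * E₀ * 4 * (L * (L * 1))   ≤⟨ large t (≤-trans (m≤n+m t₁ 2) t₀≤t) ⟩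
          t                             ∎
        c>0 : 0 < c
        c>0 = *-mono-≤ (*-mono-≤ {1} {16} (s≤s z≤n) E₀≥1) (s≤s z≤n)
        -- `i` is the largest exponent that `dyadic-cliques` admits, so `t < 4 * 4 ^ i * c`.
        -- Squaring gives `t² ≤ d * 16 * E₀² * L⁴`, and the factor 4 of `from-top` turns 16 into the
        -- 64 of `Q`.
        i , small , t< = greatest-power 4 c t (s<s z<s) c>0 c≤t
        x = 4 ^ i
        d = 64 * x * (64 * x)
        t≤ : 4 * x * c ≤ 4 * x * (16 * E₀ * (2 * L * (2 * L)))
        t≤ = *-monoʳ-≤ (4 * x) (*-monoʳ-≤ (16 * E₀) (*-mono-≤ ℓ≤2L ℓ≤2L))
        t² : t * t ≤ d * (16 * (E₀ * E₀) * L ^ 4)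
        t² = begin
          t * t                                      ≤⟨ *-mono-≤ (<⇒≤ t<) (<⇒≤ t<) ⟩
          4 * x * c * (4 * x * c)                    ≤⟨ *-mono-≤ t≤ t≤ ⟩
          4 * x * (16 * E₀ * (2 * L * (2 * L))) * (4 * x * (16 * E₀ * (2 * L * (2 * L)))) ≡⟨ eq₂ x E₀ L ⟩
          d * (16 * (E₀ * E₀) * (L * (L * (L * (L * 1))))) ∎
        4W≤td : 4 * W ≤ t * d
        4W≤td = *-cancelʳ-≤ (4 * W) (t * d) (16 * (E₀ * E₀) * L ^ 4)
          {{m*n≢0 (16 * (E₀ * E₀)) (L ^ 4) {{m*n≢0 16 (E₀ * E₀) {{_}} {{m*n≢0 E₀ E₀ {{>-nonZero E₀≥1}} {{>-nonZero E₀≥1}}}}}} {{m^n≢0 L 4 {{>-nonZero 1≤L}}}}}} (begin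
            4 * W * (16 * (E₀ * E₀) * L ^ 4)         ≡⟨ eq₃ W (E₀ * E₀) (L ^ 4) ⟩
            W * (64 * (E₀ * E₀) * L ^ 4)             ≡⟨ cong (λ z → W * (z * L ^ 4)) Q≡ ⟨
            W * (Q * L ^ 4)                          ≤⟨ W≤ ⟩
            t * (t * (t * 1))                        ≡⟨ cong (λ z → t * (t * z)) (*-identityʳ t) ⟩
            t * (t * t)                              ≤⟨ *-monoʳ-≤ t t² ⟩
            t * (d * (16 * (E₀ * E₀) * L ^ 4))       ≡⟨ *-assoc t d _ ⟨
            t * d * (16 * (E₀ * E₀) * L ^ 4)         ∎)
    in from-top G (dyadic-cliques i t ℓ G (s≤s z≤n) (t<2^[1+log] t) small ramsey) 4W≤td 1≤s s≤t
  where
  open ≤-Reasoning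
  log≥1 : ∀ t → 2 ≤ t → 1 ≤ ⌊log₂ t ⌋
  log≥1 t = ⌊log₂⌋-mono-≤
  eq₁ : ∀ e l → e * (2 * l * (2 * l)) ≡ e * 4 * (l * (l * 1))
  eq₁ = solve-∀
  eq₂ : ∀ x e l → 4 * x * (16 * e * (2 * l * (2 * l))) * (4 * x * (16 * e * (2 * l * (2 * l)))) ≡
    64 * x * (64 * x) * (16 * (e * e) * (l * (l * (l * (l * 1)))))
  eq₂ = solve-∀
  eq₃ : ∀ w e l → 4 * w * (16 * e * l) ≡ w * (64 * e * l)
  eq₃ = solve-∀

module _ {t₀} (1≤t₀ : 1 ≤ t₀) (log≥1 : ∀ t → t₀ ≤ t → 1 ≤ ⌊log₂ t ⌋)
  (bound : ∀ t → t₀ ≤ t → ∀ s → 1 ≤ s → s ≤ t → ∀ {n} (G : Graph n) → IsRamsey 4 t G →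
    ∀ W → W * (Q * ⌊log₂ t ⌋ ^ 4) ≤ t ^ 3 → W ^ s ≤ s ! * cliqueCount G s) where

  binomial-bound : ∀ t → t₀ ≤ t → ∀ s → 1 ≤ s → s ≤ t → ∀ n (G : Graph n) → IsRamsey 4 t G →
    ∀ m → m * (Q * ⌊log₂ t ⌋ ^ 4) ≤ 1 * t ^ 3 → m C s ≤ cliqueCount G s
  binomial-bound t t₀≤t s 1≤s s≤t n G ramsey m m≤ = *-cancelʳ-≤ (m C s) (cliqueCount G s) (s !) {{s !≢0}} (begin
    (m C s) * s !          ≤⟨ C*!≤^ m s ⟩
    m ^ s                  ≤⟨ bound t t₀≤t s 1≤s s≤t G ramsey m (subst (m * (Q * ⌊log₂ t ⌋ ^ 4) ≤_) (*-identityˡ (t ^ 3)) m≤) ⟩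
    s ! * cliqueCount G s  ≡⟨ *-comm (s !) (cliqueCount G s) ⟩
    cliqueCount G s * s !  ∎)
    where open ≤-Reasoning

  -- That `ε` tends to zero is expressed by arbitrary rationals `p / q`, each with a threshold for
  -- `t` that does not depend on `s`. Once factorials are cleared, `r ≤ t ^ 3` and `s ! ≤ t ^ s`
  -- leave `t ^ (3 * (q - p)) * t ^ p` against `W ^ q`; the spare factor `t ^ (2 * p)` outweighs the
  -- polylogarithmic loss `(2 * X) ^ q ≤ t`.
  exponent-bound : ∀ p q → 0 < p → p < q → ∃ λ t₁ → ∀ t → t₁ ≤ t → ∀ s → 1 ≤ s → s ≤ t → ∀ r → IsRamseyNumber 4 t r →
    ∀ n (G : Graph n) → IsRamsey 4 t G → (r C s) ^ (q ∸ p) ≤ (cliqueCount G s) ^ q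
  exponent-bound p q 0<p p<q = t₀ + proj₁ small , λ t t₁≤t s 1≤s s≤t r (_ , r-least) n G ramsey →
    go t (≤-trans (m≤m+n t₀ _) t₁≤t) (proj₂ small t (≤-trans (m≤n+m _ t₀) t₁≤t)) s 1≤s s≤t r (r-least (t ^ 3) (K-isRamsey t)) G ramsey
    where
    open ≤-Reasoning
    instance
      q≢0 : NonZero q
      q≢0 = >-nonZero (≤-<-trans z≤n p<q)
      4q≢0 : NonZero (4 * q)
      4q≢0 = m*n≢0 4 q
    small : ∃ λ t₁ → ∀ t → t₁ ≤ t → (2 * Q) ^ q * ⌊log₂ t ⌋ ^ (4 * q) ≤ t
    small = poly-log≤ ((2 * Q) ^ q) (4 * q)
    q≡ : q ≡ (q ∸ p) + p
    q≡ = sym (m∸n+n≡m (<⇒≤ p<q))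
    go : ∀ t → t₀ ≤ t → (2 * Q) ^ q * ⌊log₂ t ⌋ ^ (4 * q) ≤ t → ∀ s → 1 ≤ s → s ≤ t → ∀ r → r ≤ t ^ 3 →
      ∀ {n} (G : Graph n) → IsRamsey 4 t G → (r C s) ^ (q ∸ p) ≤ (cliqueCount G s) ^ q
    go t t₀≤t L-small s 1≤s s≤t r r≤t³ G ramsey = *-cancelʳ-≤ ((r C s) ^ (q ∸ p)) (cliqueCount G s ^ q) ((s !) ^ q) {{m^n≢0 (s !) q {{s !≢0}}}} (begin
      (r C s) ^ (q ∸ p) * (s !) ^ q                        ≡⟨ cong (λ u → (r C s) ^ (q ∸ p) * (s !) ^ u) q≡ ⟩
      (r C s) ^ (q ∸ p) * (s !) ^ (q ∸ p + p)              ≡⟨ cong ((r C s) ^ (q ∸ p) *_) (^-distribˡ-+-* (s !) (q ∸ p) p) ⟩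
      (r C s) ^ (q ∸ p) * ((s !) ^ (q ∸ p) * (s !) ^ p)      ≡⟨ *-assoc ((r C s) ^ (q ∸ p)) _ _ ⟨
      (r C s) ^ (q ∸ p) * (s !) ^ (q ∸ p) * (s !) ^ p        ≡⟨ cong (_* (s !) ^ p) (^-distribʳ-* (r C s) (s !) (q ∸ p)) ⟨
      ((r C s) * s !) ^ (q ∸ p) * (s !) ^ p                ≤⟨ *-mono-≤ (^-monoˡ-≤ (q ∸ p) (C*!≤^ r s)) (^-monoˡ-≤ p (≤-trans (n!≤n^n s) (^-monoˡ-≤ s s≤t))) ⟩
      (r ^ s) ^ (q ∸ p) * (t ^ s) ^ p                    ≡⟨ cong₂ _*_ (^-swap r s (q ∸ p)) (^-swap t s p) ⟩
      (r ^ (q ∸ p)) ^ s * (t ^ p) ^ s                    ≡⟨ ^-distribʳ-* (r ^ (q ∸ p)) (t ^ p) s ⟨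
      (r ^ (q ∸ p) * t ^ p) ^ s                          ≤⟨ ^-monoˡ-≤ s r^t≤ ⟩
      (W ^ q) ^ s                                        ≡⟨ ^-swap W q s ⟩
      (W ^ s) ^ q                                        ≤⟨ ^-monoˡ-≤ q (bound t t₀≤t s 1≤s s≤t G ramsey W W*X≤) ⟩
      (s ! * cliqueCount G s) ^ q                        ≡⟨ trans (cong (_^ q) (*-comm (s !) (cliqueCount G s))) (^-distribʳ-* (cliqueCount G s) (s !) q) ⟩
      cliqueCount G s ^ q * (s !) ^ q                      ∎)
      where
      ^-swap : ∀ x m k → (x ^ m) ^ k ≡ (x ^ k) ^ m
      ^-swap x m k = trans (^-*-assoc x m k) (trans (cong (x ^_) (*-comm m k)) (sym (^-*-assoc x k m)))
      X : ℕ
      X = Q * ⌊log₂ t ⌋ ^ 4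
      instance
        t≢0 : NonZero t
        t≢0 = >-nonZero (≤-trans 1≤t₀ t₀≤t)
        X≢0 : NonZero X
        X≢0 = m*n≢0 Q (⌊log₂ t ⌋ ^ 4) {{>-nonZero Q≥1}} {{m^n≢0 ⌊log₂ t ⌋ 4 {{>-nonZero (log≥1 t t₀≤t)}}}}
        2X≢0 : NonZero (2 * X)
        2X≢0 = m*n≢0 2 X
      W : ℕ
      W = t ^ 3 / X
      W*X≤ : W * X ≤ t ^ 3
      W*X≤ = m/n*n≤m (t ^ 3) X
      [2X]^q≤t : (2 * X) ^ q ≤ t
      [2X]^q≤t = subst (_≤ t) (trans (cong ((2 * Q) ^ q *_) (sym (^-*-assoc ⌊log₂ t ⌋ 4 q)))
        (trans (sym (^-distribʳ-* (2 * Q) (⌊log₂ t ⌋ ^ 4) q)) (cong (_^ q) (*-assoc 2 Q (⌊log₂ t ⌋ ^ 4))))) L-small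
      x≤x^k : ∀ x k .{{_ : NonZero x}} .{{_ : NonZero k}} → x ≤ x ^ k
      x≤x^k x k = subst (_≤ x ^ k) (^-identityʳ x) (^-monoʳ-≤ x (>-nonZero⁻¹ k))
      X≤t³ : X ≤ t ^ 3
      X≤t³ = ≤-trans (m≤n*m X 2) (≤-trans (x≤x^k (2 * X) q) (≤-trans [2X]^q≤t (x≤x^k t 3)))
      W≥1 : 1 ≤ W
      W≥1 = ≮⇒≥ λ W<1 → <⇒≱ (m<n⇒m/n≡0⁻¹ W<1) X≤t³
        where
        m<n⇒m/n≡0⁻¹ : W < 1 → t ^ 3 < X
        m<n⇒m/n≡0⁻¹ W<1 = subst (_< X) (sym (trans (m≡m%n+[m/n]*n (t ^ 3) X) (trans (cong (λ w → t ^ 3 % X + w * X) (n<1⇒n≡0 W<1)) (+-identityʳ _)))) (m%n<n (t ^ 3) X)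
      -- Since `W ≥ 1`, rounding the quotient `t ^ 3 / X` down costs at most a factor two.
      t³≤W2X : t ^ 3 ≤ W * (2 * X)
      t³≤W2X = begin
        t ^ 3                ≡⟨ m≡m%n+[m/n]*n (t ^ 3) X ⟩
        t ^ 3 % X + W * X    ≤⟨ +-monoˡ-≤ (W * X) (≤-trans (<⇒≤ (m%n<n (t ^ 3) X)) (m≤n*m X W {{>-nonZero W≥1}})) ⟩
        W * X + W * X        ≡⟨ eq W X ⟩
        W * (2 * X)          ∎
        where
        eq : ∀ w x → w * x + w * x ≡ w * (2 * x)
        eq = solve-∀
      r^t≤ : r ^ (q ∸ p) * t ^ p ≤ W ^ q
      r^t≤ = *-cancelʳ-≤ (r ^ (q ∸ p) * t ^ p) (W ^ q) ((2 * X) ^ q) {{m^n≢0 (2 * X) q}} (begin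
        r ^ (q ∸ p) * t ^ p * (2 * X) ^ q        ≤⟨ *-mono-≤ (*-monoˡ-≤ (t ^ p) (^-monoˡ-≤ (q ∸ p) r≤t³)) (≤-trans [2X]^q≤t (x≤x^k t (2 * p) {{t≢0}} {{m*n≢0 2 p {{_}} {{>-nonZero 0<p}}}})) ⟩
        (t ^ 3) ^ (q ∸ p) * t ^ p * t ^ (2 * p)  ≡⟨ *-assoc ((t ^ 3) ^ (q ∸ p)) (t ^ p) _ ⟩
        (t ^ 3) ^ (q ∸ p) * (t ^ p * t ^ (2 * p)) ≡⟨ cong ((t ^ 3) ^ (q ∸ p) *_) (trans (sym (^-distribˡ-+-* t p (2 * p))) (sym (^-*-assoc t 3 p))) ⟩
        (t ^ 3) ^ (q ∸ p) * (t ^ 3) ^ p          ≡⟨ ^-distribˡ-+-* (t ^ 3) (q ∸ p) p ⟨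
        (t ^ 3) ^ (q ∸ p + p)                    ≡⟨ cong ((t ^ 3) ^_) q≡ ⟨
        (t ^ 3) ^ q                              ≤⟨ ^-monoˡ-≤ q t³≤W2X ⟩
        (W * (2 * X)) ^ q                        ≡⟨ ^-distribʳ-* W (2 * X) q ⟩
        W ^ q * (2 * X) ^ q                      ∎)

-- The constant `c` is `p / q`; the base and the rounding of the logarithm affect only its value. A
-- minimum over Ramsey graphs is bounded below by a claim about each such graph and above by
-- exhibiting one.
theorem1p3 : (Σ ℕ λ p → Σ ℕ λ q → Σ ℕ λ t₀ → (1 ≤ p) × (1 ≤ q) ×
    (∀ t → t₀ ≤ t → ∀ s → 1 ≤ s → s ≤ t →
    ∀ n (G : Graph n) → IsRamsey 4 t G →
    ∀ m → m * (q * ⌊log₂ t ⌋ ^ 4) ≤ p * t ^ 3 →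
    m C s ≤ cliqueCount G s))
    ×
    ((∀ p q → 0 < p → p < q → Σ ℕ λ t₁ →
    ∀ t → t₁ ≤ t → ∀ s → 1 ≤ s → s ≤ t →
    ∀ r → IsRamseyNumber 4 t r →
    ∀ n (G : Graph n) → IsRamsey 4 t G →
    (r C s) ^ (q ∸ p) ≤ (cliqueCount G s) ^ q)
    ×
    (∀ t s → 1 ≤ s → s ≤ t → ∀ r → IsRamseyNumber 4 t r →
    Σ ℕ λ n → Σ (Graph n) λ G → IsRamsey 4 t G × (cliqueCount G s ≤ r C s)))
theorem1p3 = let t₀ , 1≤t₀ , log≥1 , bound = clique-power-bound in
  (1 , Q , t₀ , s≤s z≤n , Q≥1 , binomial-bound 1≤t₀ log≥1 bound) ,
  exponent-bound 1≤t₀ log≥1 bound ,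
  λ t s 1≤s s≤t r (K-ramsey , _) → r , K r , K-ramsey , cliqueCount≤C (K r) s
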